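{- (i) For $r=2$ there are constants $0<c_2<C_2$ such that, for every integer $n\ge 2$, $$\frac{c_2}{n}\le \Delta_{\mathcal{C}}(n)\le C_2\,\frac{\ln n}{n}.$$ (ii) For any integer $r\ge 3$ there are constants $0<c_r<C_r$ such that, for every integer $n\ge 1$, $$\frac{c_r}{n}\le \Delta_{\mathcal{C}}(n)\le \frac{C_r}{n}.$$
   Context: For fixed $r\ge2$, $\mathcal{C}$ is the set of $r$-tuples $\mathbf{x}=(x_1,\dots,x_r)$ of positive integers with $\gcd(x_1,\dots,x_r)=1$. For $n\ge1$ and $\boldsymbol{\alpha}=(\alpha_1,\dots,\alpha_r)\in[0,1]^r$ put $|\boldsymbol{\alpha}|=\alpha_1\cdots\alpha_r$ and $F(n,\boldsymbol{\alpha})=\#\{\mathbf{x}\in\mathcal{C}: x_j\le n\alpha_j \text{ for } j=1,\dots,r\}$. With $\boldsymbol{1}=(1,\dots,1)$, the discrepancy function of $\mathcal{C}$ is $$\Delta_{\mathcal{C}}(n)=\sup_{\boldsymbol{\alpha}\in[0,1]^r}\bigg|\frac{F(n,\boldsymbol{\alpha})}{F(n,\boldsymbol{1})}-|\boldsymbol{\alpha}|\bigg|.$$ -}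

module Defs where

open import Data.Integer.Base as ℤ using (+_)
import Data.Integer.Properties as ℤₚ
open import Data.List.Base using (List; length)
open import Data.List.Membership.Propositional using (_∈_)
open import Data.List.Relation.Unary.Unique.Propositional using (Unique)
open import Data.Nat.Base as ℕ using (ℕ; zero; suc; NonZero; _⊔_)
open import Data.Nat.GCD using (gcd)
import Data.Nat.Properties as ℕₚ
open import Data.Product using (Σ-syntax; ∃-syntax; _×_; _,_; proj₁; proj₂)
open import Data.Rational.Base as ℚ using (ℚ; 0ℚ; 1ℚ; ½; _/_; Positive; NonNegative; positive; nonNegative; 1/_)
open import Data.Rational.Properties as ℚₚ using (≤-trans; module ≤-Reasoning)
open import Data.Rational.Unnormalised.Base as ℚᵘ using (mkℚᵘ)
import Data.Rational.Unnormalised.Properties as ℚᵘₚ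
open import Data.Rational.Solver using (module +-*-Solver)
open import Data.Sum.Base using (inj₁; inj₂)
open import Data.Vec.Base using (Vec; lookup; foldr′; replicate)
open import Function.Bundles using (_⇔_)
open import Relation.Binary.PropositionalEquality

------------------------------------------------------------------------
-- Real numbers as Cauchy sequences of rationals

Cauchy : (ℕ → ℚ) → Set
Cauchy s = ∀ ε → 0ℚ ℚ.< ε →
           ∃[ N ] ∀ m n → N ℕ.≤ m → N ℕ.≤ n → ℚ.∣ s m ℚ.- s n ∣ ℚ.≤ ε

record ℝ : Set where
  constructor mkℝ
  field
    seq    : ℕ → ℚ
    cauchy : Cauchy seq

open ℝ public

infix 4 _≤ℝ_ _<ℝ_

_≤ℝ_ : ℝ → ℝ → Set
x ≤ℝ y = ∀ ε → 0ℚ ℚ.< ε → ∃[ N ] ∀ m → N ℕ.≤ m → seq x m ℚ.≤ seq y m ℚ.+ ε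

_<ℝ_ : ℝ → ℝ → Set
x <ℝ y = ∃[ ε ] 0ℚ ℚ.< ε × ∃[ N ] ∀ m → N ℕ.≤ m → seq x m ℚ.+ ε ℚ.≤ seq y m

module Cauchy-Lemmas where
  half-pos : ∀ ε → 0ℚ ℚ.< ε → 0ℚ ℚ.< ε ℚ.* ½
  half-pos ε 0<ε = ℚₚ.positive⁻¹ (ε ℚ.* ½) {{ℚₚ.pos*pos⇒pos ε {{positive 0<ε}} ½}}

  halves : ∀ ε → ε ℚ.* ½ ℚ.+ ε ℚ.* ½ ≡ ε
  halves ε = trans (sym (ℚₚ.*-distribˡ-+ ε ½ ½)) (ℚₚ.*-identityʳ ε)

  -‿comm-∣∣ : ∀ p q → ℚ.∣ p ℚ.- q ∣ ≡ ℚ.∣ q ℚ.- p ∣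
  -‿comm-∣∣ p q = trans (sym (ℚₚ.∣-p∣≡∣p∣ (p ℚ.- q))) (cong ℚ.∣_∣ lem)
    where
    open +-*-Solver
    lem : ℚ.- (p ℚ.- q) ≡ q ℚ.- p
    lem = solve 2 (λ p q → :- (p :- q) := q :- p) refl p q

  ∣∣≤ : ∀ {p q} → p ℚ.≤ q → ℚ.- p ℚ.≤ q → ℚ.∣ p ∣ ℚ.≤ q
  ∣∣≤ {p} h₁ h₂ with ℚₚ.∣p∣≡p∨∣p∣≡-p p
  ... | inj₁ e = subst (ℚ._≤ _) (sym e) h₁
  ... | inj₂ e = subst (ℚ._≤ _) (sym e) h₂

  ∣p∣-∣q∣≤∣p-q∣ : ∀ p q → ℚ.∣ p ∣ ℚ.- ℚ.∣ q ∣ ℚ.≤ ℚ.∣ p ℚ.- q ∣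
  ∣p∣-∣q∣≤∣p-q∣ p q = begin
    ℚ.∣ p ∣ ℚ.- ℚ.∣ q ∣
      ≡⟨ cong (λ t → ℚ.∣ t ∣ ℚ.- ℚ.∣ q ∣) (solve 2 (λ p q → p := (p :- q) :+ q) refl p q) ⟩
    ℚ.∣ (p ℚ.- q) ℚ.+ q ∣ ℚ.- ℚ.∣ q ∣
      ≤⟨ ℚₚ.+-monoˡ-≤ (ℚ.- ℚ.∣ q ∣) (ℚₚ.∣p+q∣≤∣p∣+∣q∣ (p ℚ.- q) q) ⟩
    ℚ.∣ p ℚ.- q ∣ ℚ.+ ℚ.∣ q ∣ ℚ.- ℚ.∣ q ∣
      ≡⟨ solve 2 (λ a b → a :+ b :- b := a) refl ℚ.∣ p ℚ.- q ∣ ℚ.∣ q ∣ ⟩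
    ℚ.∣ p ℚ.- q ∣ ∎
    where
    open ≤-Reasoning
    open +-*-Solver

  -- A sequence is Cauchy once its tail oscillations are bounded for m ≤ n.
  cauchy-≤ : (s : ℕ → ℚ) →
             (∀ ε → 0ℚ ℚ.< ε → ∃[ N ] ∀ m n → N ℕ.≤ m → m ℕ.≤ n → ℚ.∣ s m ℚ.- s n ∣ ℚ.≤ ε) →
             Cauchy s
  cauchy-≤ s h ε 0<ε = proj₁ (h ε 0<ε) , go
    where
    go : ∀ m n → _ ℕ.≤ m → _ ℕ.≤ n → ℚ.∣ s m ℚ.- s n ∣ ℚ.≤ ε
    go m n N≤m N≤n with ℕₚ.≤-total m n
    ... | inj₁ m≤n = proj₂ (h ε 0<ε) m n N≤m m≤n
    ... | inj₂ n≤m = subst (ℚ._≤ ε) (-‿comm-∣∣ (s n) (s m)) (proj₂ (h ε 0<ε) n m N≤n n≤m)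

  fromℚ-cauchy : ∀ q → Cauchy (λ _ → q)
  fromℚ-cauchy q ε 0<ε = 0 , λ _ _ _ _ →
    subst (ℚ._≤ ε) (sym (cong ℚ.∣_∣ (ℚₚ.+-inverseʳ q))) (ℚₚ.<⇒≤ 0<ε)

  +-cauchy : ∀ x y → Cauchy (λ n → seq x n ℚ.+ seq y n)
  +-cauchy x y ε 0<ε = proj₁ cx ⊔ proj₁ cy , bound
    where
    cx = cauchy x (ε ℚ.* ½) (half-pos ε 0<ε)
    cy = cauchy y (ε ℚ.* ½) (half-pos ε 0<ε)
    bound : ∀ m n → _ ℕ.≤ m → _ ℕ.≤ n →
            ℚ.∣ (seq x m ℚ.+ seq y m) ℚ.- (seq x n ℚ.+ seq y n) ∣ ℚ.≤ ε
    bound m n hm hn = begin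
      ℚ.∣ (a ℚ.+ b) ℚ.- (c ℚ.+ d) ∣
        ≡⟨ cong ℚ.∣_∣ (solve 4 (λ a b c d → (a :+ b) :- (c :+ d) := (a :- c) :+ (b :- d)) refl a b c d) ⟩
      ℚ.∣ (a ℚ.- c) ℚ.+ (b ℚ.- d) ∣
        ≤⟨ ℚₚ.∣p+q∣≤∣p∣+∣q∣ (a ℚ.- c) (b ℚ.- d) ⟩
      ℚ.∣ a ℚ.- c ∣ ℚ.+ ℚ.∣ b ℚ.- d ∣
        ≤⟨ ℚₚ.+-mono-≤ (proj₂ cx m n (ℕₚ.m⊔n≤o⇒m≤o _ _ hm) (ℕₚ.m⊔n≤o⇒m≤o _ _ hn))
                       (proj₂ cy m n (ℕₚ.m⊔n≤o⇒n≤o _ _ hm) (ℕₚ.m⊔n≤o⇒n≤o _ _ hn)) ⟩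
      ε ℚ.* ½ ℚ.+ ε ℚ.* ½
        ≡⟨ halves ε ⟩
      ε ∎
      where
      open ≤-Reasoning
      open +-*-Solver
      a = seq x m ; b = seq y m ; c = seq x n ; d = seq y n

  neg-cauchy : ∀ x → Cauchy (λ n → ℚ.- seq x n)
  neg-cauchy x ε 0<ε = proj₁ (cauchy x ε 0<ε) , λ m n hm hn →
    subst (ℚ._≤ ε)
      (trans (-‿comm-∣∣ (seq x m) (seq x n))
        (cong ℚ.∣_∣ (solve 2 (λ p q → q :- p := (:- p) :- (:- q)) refl (seq x m) (seq x n))))
      (proj₂ (cauchy x ε 0<ε) m n hm hn)
    where open +-*-Solver

  ∣∣-cauchy : ∀ x → Cauchy (λ n → ℚ.∣ seq x n ∣)
  ∣∣-cauchy x ε 0<ε = proj₁ (cauchy x ε 0<ε) , λ m n hm hn →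
    ≤-trans
      (∣∣≤ (∣p∣-∣q∣≤∣p-q∣ (seq x m) (seq x n))
           (subst₂ ℚ._≤_
             (solve 2 (λ a b → b :- a := :- (a :- b)) refl ℚ.∣ seq x m ∣ ℚ.∣ seq x n ∣)
             (-‿comm-∣∣ (seq x n) (seq x m))
             (∣p∣-∣q∣≤∣p-q∣ (seq x n) (seq x m))))
      (proj₂ (cauchy x ε 0<ε) m n hm hn)
    where open +-*-Solver

  bounded : ∀ x → ∃[ B ] Positive B × ∃[ N ] ∀ m → N ℕ.≤ m → ℚ.∣ seq x m ∣ ℚ.≤ B
  bounded x = ℚ.∣ seq x N ∣ ℚ.+ 1ℚ
            , ℚₚ.nonNeg+pos⇒pos ℚ.∣ seq x N ∣ {{ℚₚ.∣-∣-nonNeg (seq x N)}} 1ℚ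
            , N , bnd
    where
    c = cauchy x 1ℚ (ℚₚ.positive⁻¹ 1ℚ)
    N = proj₁ c
    open ≤-Reasoning
    open +-*-Solver
    bnd : ∀ m → N ℕ.≤ m → ℚ.∣ seq x m ∣ ℚ.≤ ℚ.∣ seq x N ∣ ℚ.+ 1ℚ
    bnd m h = begin
      ℚ.∣ seq x m ∣
        ≡⟨ cong ℚ.∣_∣ (solve 2 (λ p q → p := q :+ (p :- q)) refl (seq x m) (seq x N)) ⟩
      ℚ.∣ seq x N ℚ.+ (seq x m ℚ.- seq x N) ∣
        ≤⟨ ℚₚ.∣p+q∣≤∣p∣+∣q∣ (seq x N) (seq x m ℚ.- seq x N) ⟩
      ℚ.∣ seq x N ∣ ℚ.+ ℚ.∣ seq x m ℚ.- seq x N ∣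
        ≤⟨ ℚₚ.+-monoʳ-≤ ℚ.∣ seq x N ∣ (proj₂ c m N h ℕₚ.≤-refl) ⟩
      ℚ.∣ seq x N ∣ ℚ.+ 1ℚ ∎

  rescale : ∀ A B → Positive A → Positive B → ∀ ε → 0ℚ ℚ.< ε →
            ∃[ δ ] 0ℚ ℚ.< δ × A ℚ.* δ ℚ.+ δ ℚ.* B ≡ ε
  rescale A B posA posB ε 0<ε = ε ℚ.* i , 0<δ , eq
    where
    instance
      posD : Positive (A ℚ.+ B)
      posD = ℚₚ.pos+pos⇒pos A {{posA}} B {{posB}}
      nzD : ℚ.NonZero (A ℚ.+ B)
      nzD = ℚₚ.pos⇒nonZero (A ℚ.+ B)
    i = 1/ (A ℚ.+ B)
    0<δ : 0ℚ ℚ.< ε ℚ.* i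
    0<δ = ℚₚ.positive⁻¹ _ {{ℚₚ.pos*pos⇒pos ε {{positive 0<ε}} i {{ℚₚ.1/pos⇒pos (A ℚ.+ B)}}}}
    lem : ∀ a b e j → a ℚ.* (e ℚ.* j) ℚ.+ (e ℚ.* j) ℚ.* b ≡ e ℚ.* ((a ℚ.+ b) ℚ.* j)
    lem = solve 4 (λ a b e j → a :* (e :* j) :+ (e :* j) :* b := e :* ((a :+ b) :* j)) refl
      where open +-*-Solver
    eq : A ℚ.* (ε ℚ.* i) ℚ.+ (ε ℚ.* i) ℚ.* B ≡ ε
    eq = trans (lem A B ε i)
               (trans (cong (ε ℚ.*_) (ℚₚ.*-inverseʳ (A ℚ.+ B))) (ℚₚ.*-identityʳ ε))

  *-mono-nonNeg : ∀ {p q r s} → 0ℚ ℚ.≤ p → p ℚ.≤ q → 0ℚ ℚ.≤ s → r ℚ.≤ s →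
                  p ℚ.* r ℚ.≤ q ℚ.* s
  *-mono-nonNeg {p} {s = s} 0≤p p≤q 0≤s r≤s = ≤-trans
    (ℚₚ.*-monoˡ-≤-nonNeg p {{nonNegative 0≤p}} r≤s)
    (ℚₚ.*-monoʳ-≤-nonNeg s {{nonNegative 0≤s}} p≤q)

  ∣ab-cd∣≤ : ∀ a b c d {A B δ} → ℚ.∣ a ∣ ℚ.≤ A → ℚ.∣ d ∣ ℚ.≤ B → 0ℚ ℚ.≤ B → 0ℚ ℚ.≤ δ →
             ℚ.∣ a ℚ.- c ∣ ℚ.≤ δ → ℚ.∣ b ℚ.- d ∣ ℚ.≤ δ →
             ℚ.∣ a ℚ.* b ℚ.- c ℚ.* d ∣ ℚ.≤ A ℚ.* δ ℚ.+ δ ℚ.* B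
  ∣ab-cd∣≤ a b c d {A} {B} {δ} ha hd 0≤B 0≤δ hac hbd = begin
    ℚ.∣ a ℚ.* b ℚ.- c ℚ.* d ∣
      ≡⟨ cong ℚ.∣_∣ (solve 4 (λ a b c d → a :* b :- c :* d := a :* (b :- d) :+ (a :- c) :* d) refl a b c d) ⟩
    ℚ.∣ a ℚ.* (b ℚ.- d) ℚ.+ (a ℚ.- c) ℚ.* d ∣
      ≤⟨ ℚₚ.∣p+q∣≤∣p∣+∣q∣ (a ℚ.* (b ℚ.- d)) ((a ℚ.- c) ℚ.* d) ⟩
    ℚ.∣ a ℚ.* (b ℚ.- d) ∣ ℚ.+ ℚ.∣ (a ℚ.- c) ℚ.* d ∣
      ≡⟨ cong₂ ℚ._+_ (ℚₚ.∣p*q∣≡∣p∣*∣q∣ a (b ℚ.- d)) (ℚₚ.∣p*q∣≡∣p∣*∣q∣ (a ℚ.- c) d) ⟩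
    ℚ.∣ a ∣ ℚ.* ℚ.∣ b ℚ.- d ∣ ℚ.+ ℚ.∣ a ℚ.- c ∣ ℚ.* ℚ.∣ d ∣
      ≤⟨ ℚₚ.+-mono-≤ (*-mono-nonNeg (ℚₚ.0≤∣p∣ a) ha 0≤δ hbd)
                     (*-mono-nonNeg (ℚₚ.0≤∣p∣ (a ℚ.- c)) hac 0≤B hd) ⟩
    A ℚ.* δ ℚ.+ δ ℚ.* B ∎
    where
    open ≤-Reasoning
    open +-*-Solver

  *-cauchy : ∀ x y → Cauchy (λ n → seq x n ℚ.* seq y n)
  *-cauchy x y ε 0<ε =
    let A , posA , N₁ , h₁ = bounded x
        B , posB , N₂ , h₂ = bounded y
        δ , 0<δ , eq = rescale A B posA posB ε 0<ε
        M₁ , g₁ = cauchy x δ 0<δ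
        M₂ , g₂ = cauchy y δ 0<δ
    in (N₁ ⊔ M₁) ⊔ (N₂ ⊔ M₂) , λ m n hm hn →
       let hm₁ = ℕₚ.m⊔n≤o⇒m≤o (N₁ ⊔ M₁) (N₂ ⊔ M₂) hm
           hm₂ = ℕₚ.m⊔n≤o⇒n≤o (N₁ ⊔ M₁) (N₂ ⊔ M₂) hm
           hn₁ = ℕₚ.m⊔n≤o⇒m≤o (N₁ ⊔ M₁) (N₂ ⊔ M₂) hn
           hn₂ = ℕₚ.m⊔n≤o⇒n≤o (N₁ ⊔ M₁) (N₂ ⊔ M₂) hn
       in subst (ℚ.∣ seq x m ℚ.* seq y m ℚ.- seq x n ℚ.* seq y n ∣ ℚ.≤_) eq
            (∣ab-cd∣≤ (seq x m) (seq y m) (seq x n) (seq y n)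
              (h₁ m (ℕₚ.m⊔n≤o⇒m≤o N₁ M₁ hm₁)) (h₂ n (ℕₚ.m⊔n≤o⇒m≤o N₂ M₂ hn₂))
              (ℚₚ.<⇒≤ (ℚₚ.positive⁻¹ B {{posB}})) (ℚₚ.<⇒≤ 0<δ)
              (g₁ m n (ℕₚ.m⊔n≤o⇒n≤o N₁ M₁ hm₁) (ℕₚ.m⊔n≤o⇒n≤o N₁ M₁ hn₁))
              (g₂ m n (ℕₚ.m⊔n≤o⇒n≤o N₂ M₂ hm₂) (ℕₚ.m⊔n≤o⇒n≤o N₂ M₂ hn₂)))

open Cauchy-Lemmas

infixl 7 _*ℝ_ _/ℕ_
infixl 6 _+ℝ_ _-ℝ_
infix  8 -ℝ_

fromℚ : ℚ → ℝ
fromℚ q = mkℝ (λ _ → q) (fromℚ-cauchy q)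

fromℕ : ℕ → ℝ
fromℕ n = fromℚ (+ n / 1)

0ℝ 1ℝ : ℝ
0ℝ = fromℚ 0ℚ
1ℝ = fromℚ 1ℚ

_+ℝ_ : ℝ → ℝ → ℝ
x +ℝ y = mkℝ (λ n → seq x n ℚ.+ seq y n) (+-cauchy x y)

-ℝ_ : ℝ → ℝ
-ℝ x = mkℝ (λ n → ℚ.- seq x n) (neg-cauchy x)

_-ℝ_ : ℝ → ℝ → ℝ
x -ℝ y = x +ℝ (-ℝ y)

_*ℝ_ : ℝ → ℝ → ℝ
x *ℝ y = mkℝ (λ n → seq x n ℚ.* seq y n) (*-cauchy x y)

_/ℕ_ : ℝ → (n : ℕ) .{{_ : NonZero n}} → ℝ
x /ℕ n = x *ℝ fromℚ (+ 1 / n)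

∣_∣ℝ : ℝ → ℝ
∣ x ∣ℝ = mkℝ (λ n → ℚ.∣ seq x n ∣) (∣∣-cauchy x)

record IsSupremum {I : Set} (f : I → ℝ) (s : ℝ) : Set where
  field
    upper : ∀ i → f i ≤ℝ s
    least : ∀ u → (∀ i → f i ≤ℝ u) → s ≤ℝ u

------------------------------------------------------------------------
-- The natural logarithm of a positive integer

infixr 8 _^ℚ_

_^ℚ_ : ℚ → ℕ → ℚ
q ^ℚ zero  = 1ℚ
q ^ℚ suc k = q ℚ.* q ^ℚ k

-- mercator q K = Σ_{k=1}^{K} qᵏ/k, the K-th partial sum of -ln(1 - q).
mercator : ℚ → ℕ → ℚ
mercator q zero    = 0ℚ
mercator q (suc k) = mercator q k ℚ.+ (q ^ℚ suc k) ℚ.* (+ 1 / suc k)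

module Mercator-Lemmas where
  /-mono : ∀ a b c d → a ℕ.* suc d ℕ.≤ c ℕ.* suc b → + a / suc b ℚ.≤ + c / suc d
  /-mono a b c d h = ℚₚ.toℚᵘ-cancel-≤
    (ℚᵘₚ.≤-trans (ℚᵘₚ.≤-reflexive (ℚₚ.toℚᵘ-fromℚᵘ (mkℚᵘ (+ a) b)))
      (ℚᵘₚ.≤-trans
        (ℚᵘ.*≤* (subst₂ ℤ._≤_ (ℤₚ.pos-* a (suc d)) (ℤₚ.pos-* c (suc b)) (ℤ.+≤+ h)))
        (ℚᵘₚ.≤-reflexive (ℚᵘₚ.≃-sym (ℚₚ.toℚᵘ-fromℚᵘ (mkℚᵘ (+ c) d))))))

  0≤/ : ∀ a b → 0ℚ ℚ.≤ + a / suc b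
  0≤/ a b = ℚₚ.nonNegative⁻¹ _ {{ℚₚ.normalize-nonNeg a (suc b)}}

  n*1/m : ∀ n k → (+ n / 1) ℚ.* (+ 1 / suc k) ≡ + n / suc k
  n*1/m n k = ℚₚ.toℚᵘ-injective
    (ℚᵘₚ.≃-trans (ℚₚ.toℚᵘ-homo-* (+ n / 1) (+ 1 / suc k))
      (ℚᵘₚ.≃-trans
        (ℚᵘₚ.*-cong (ℚₚ.toℚᵘ-fromℚᵘ (mkℚᵘ (+ n) 0)) (ℚₚ.toℚᵘ-fromℚᵘ (mkℚᵘ (+ 1) k)))
        (ℚᵘₚ.≃-trans
          (ℚᵘₚ.≃-reflexive (cong₂ mkℚᵘ (ℤₚ.*-identityʳ (+ n)) (ℕₚ.+-identityʳ k)))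
          (ℚᵘₚ.≃-sym (ℚₚ.toℚᵘ-fromℚᵘ (mkℚᵘ (+ n) k))))))

  n/n≡1 : ∀ k → + suc k / suc k ≡ 1ℚ
  n/n≡1 k = ℚₚ.≤-antisym (/-mono (suc k) k 1 0 (ℕₚ.≤-reflexive (ℕₚ.*-comm (suc k) 1)))
                        (/-mono 1 0 (suc k) k (ℕₚ.≤-reflexive (ℕₚ.*-comm 1 (suc k))))

  archimedean : ∀ n ε → 0ℚ ℚ.< ε → ∃[ N ] ∀ m → N ℕ.≤ m → + n / suc m ℚ.≤ ε
  archimedean n ε@(ℚ.mkℚ (+ suc p) d c) 0<ε = n ℕ.* suc d , λ m h →
    subst (+ n / suc m ℚ.≤_) (ℚₚ.fromℚᵘ-toℚᵘ ε)
      (/-mono n m (suc p) d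
        (ℕₚ.≤-trans h (ℕₚ.≤-trans (ℕₚ.n≤1+n m) (ℕₚ.m≤m+n (suc m) (p ℕ.* suc m)))))
  archimedean n (ℚ.mkℚ (+ zero) d c) 0<ε with positive 0<ε
  ... | ()
  archimedean n (ℚ.mkℚ ℤ.-[1+ p ] d c) 0<ε with positive 0<ε
  ... | ()

  module _ (k : ℕ) where
    u v q : ℚ
    u = + 1 / suc k
    v = + suc k / 1
    q = 1ℚ ℚ.- u

    T : ℕ → ℚ
    T m = mercator q m ℚ.+ v ℚ.* ((q ^ℚ suc m) ℚ.* (+ 1 / suc m))

    vu≡1 : v ℚ.* u ≡ 1ℚ
    vu≡1 = trans (n*1/m (suc k) k) (n/n≡1 k)

    0≤q : 0ℚ ℚ.≤ q
    0≤q = subst (ℚ._≤ q) (ℚₚ.+-inverseʳ u)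
      (ℚₚ.+-monoˡ-≤ (ℚ.- u) (/-mono 1 k 1 0 (ℕ.s≤s ℕ.z≤n)))

    q≤1 : q ℚ.≤ 1ℚ
    q≤1 = subst (q ℚ.≤_) (ℚₚ.+-identityʳ 1ℚ)
      (ℚₚ.+-monoʳ-≤ 1ℚ (ℚₚ.neg-antimono-≤ (0≤/ 1 k)))

    0≤* : ∀ {a b} → 0ℚ ℚ.≤ a → 0ℚ ℚ.≤ b → 0ℚ ℚ.≤ a ℚ.* b
    0≤* {a} {b} ha hb = ℚₚ.nonNegative⁻¹ _
      {{ℚₚ.nonNeg*nonNeg⇒nonNeg a {{nonNegative ha}} b {{nonNegative hb}}}}

    0≤q^ : ∀ m → 0ℚ ℚ.≤ q ^ℚ m
    0≤q^ zero    = 0≤/ 1 0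
    0≤q^ (suc m) = 0≤* 0≤q (0≤q^ m)

    q^≤1 : ∀ m → q ^ℚ m ℚ.≤ 1ℚ
    q^≤1 zero    = ℚₚ.≤-refl
    q^≤1 (suc m) = subst (q ℚ.* q ^ℚ m ℚ.≤_) (ℚₚ.*-identityʳ 1ℚ)
      (*-mono-nonNeg 0≤q q≤1 (0≤/ 1 0) (q^≤1 m))

    0≤term : ∀ m → 0ℚ ℚ.≤ (q ^ℚ suc m) ℚ.* (+ 1 / suc m)
    0≤term m = 0≤* (0≤q^ (suc m)) (0≤/ 1 m)

    mercator-mono : ∀ {m n} → m ℕ.≤′ n → mercator q m ℚ.≤ mercator q n
    mercator-mono (ℕ.≤′-reflexive refl) = ℚₚ.≤-refl
    mercator-mono {n = suc n} (ℕ.≤′-step h) = ≤-trans (mercator-mono h)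
      (subst (ℚ._≤ mercator q (suc n)) (ℚₚ.+-identityʳ (mercator q n))
        (ℚₚ.+-monoʳ-≤ (mercator q n) (0≤term n)))

    T-algebra : ∀ s p a v u w → w ≡ 1ℚ ℚ.- u → v ℚ.* u ≡ 1ℚ →
                (s ℚ.+ p ℚ.* a) ℚ.+ v ℚ.* ((w ℚ.* p) ℚ.* a) ≡ s ℚ.+ v ℚ.* (p ℚ.* a)
    T-algebra s p a v u w refl vu = trans
      (solve 5 (λ s p a v u →
         (s :+ p :* a) :+ v :* (((con 1ℚ :- u) :* p) :* a) :=
         (s :+ v :* (p :* a)) :+ p :* a :* (con 1ℚ :- v :* u)) refl s p a v u)
      (trans (cong (λ t → (s ℚ.+ v ℚ.* (p ℚ.* a)) ℚ.+ p ℚ.* a ℚ.* (1ℚ ℚ.- t)) vu)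
        (trans (cong ((s ℚ.+ v ℚ.* (p ℚ.* a)) ℚ.+_) (ℚₚ.*-zeroʳ (p ℚ.* a)))
          (ℚₚ.+-identityʳ _)))
      where open +-*-Solver

    T-step : ∀ m → T (suc m) ℚ.≤ T m
    T-step m = subst (T (suc m) ℚ.≤_)
      (T-algebra (mercator q m) (q ^ℚ suc m) (+ 1 / suc m) v u q refl vu≡1)
      (ℚₚ.+-monoʳ-≤ (mercator q (suc m))
        (ℚₚ.*-monoˡ-≤-nonNeg v {{nonNegative (0≤/ (suc k) 0)}}
          (ℚₚ.*-monoˡ-≤-nonNeg (q ^ℚ suc (suc m)) {{nonNegative (0≤q^ (suc (suc m)))}}
            (/-mono 1 (suc m) 1 m
              (subst₂ ℕ._≤_ (sym (ℕₚ.*-identityˡ (suc m))) (sym (ℕₚ.*-identityˡ (suc (suc m))))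
                (ℕₚ.n≤1+n (suc m)))))))

    T-anti : ∀ {m n} → m ℕ.≤′ n → T n ℚ.≤ T m
    T-anti (ℕ.≤′-reflexive refl)   = ℚₚ.≤-refl
    T-anti {n = suc n} (ℕ.≤′-step h) = ≤-trans (T-step n) (T-anti h)

    tail-≤ : ∀ m n → m ℕ.≤ n →
             ℚ.∣ mercator q m ℚ.- mercator q n ∣ ℚ.≤ + suc k / suc m
    tail-≤ m n m≤n = begin
      ℚ.∣ mercator q m ℚ.- mercator q n ∣
        ≡⟨ -‿comm-∣∣ (mercator q m) (mercator q n) ⟩
      ℚ.∣ mercator q n ℚ.- mercator q m ∣
        ≡⟨ ℚₚ.0≤p⇒∣p∣≡p (subst (ℚ._≤ mercator q n ℚ.- mercator q m) (ℚₚ.+-inverseʳ (mercator q m))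
             (ℚₚ.+-monoˡ-≤ (ℚ.- mercator q m) (mercator-mono (ℕₚ.≤⇒≤′ m≤n)))) ⟩
      mercator q n ℚ.- mercator q m
        ≤⟨ ℚₚ.+-monoˡ-≤ (ℚ.- mercator q m) (≤-trans Sn≤Tn (T-anti (ℕₚ.≤⇒≤′ m≤n))) ⟩
      T m ℚ.- mercator q m
        ≡⟨ cancel (mercator q m) (v ℚ.* ((q ^ℚ suc m) ℚ.* (+ 1 / suc m))) ⟩
      v ℚ.* ((q ^ℚ suc m) ℚ.* (+ 1 / suc m))
        ≤⟨ ℚₚ.*-monoˡ-≤-nonNeg v {{nonNegative (0≤/ (suc k) 0)}}
             (ℚₚ.*-monoʳ-≤-nonNeg (+ 1 / suc m) {{nonNegative (0≤/ 1 m)}} (q^≤1 (suc m))) ⟩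
      v ℚ.* (1ℚ ℚ.* (+ 1 / suc m))
        ≡⟨ cong (v ℚ.*_) (ℚₚ.*-identityˡ (+ 1 / suc m)) ⟩
      v ℚ.* (+ 1 / suc m)
        ≡⟨ n*1/m (suc k) m ⟩
      + suc k / suc m ∎
      where
      open ≤-Reasoning
      cancel : ∀ a b → a ℚ.+ b ℚ.- a ≡ b
      cancel = solve 2 (λ a b → a :+ b :- a := b) refl
        where open +-*-Solver
      Sn≤Tn : mercator q n ℚ.≤ T n
      Sn≤Tn = subst (ℚ._≤ T n) (ℚₚ.+-identityʳ (mercator q n))
        (ℚₚ.+-monoʳ-≤ (mercator q n) (0≤* (0≤/ (suc k) 0) (0≤term n)))

  mercator-cauchy : ∀ n .{{_ : NonZero n}} → Cauchy (mercator (1ℚ ℚ.- + 1 / n))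
  mercator-cauchy (suc k) = cauchy-≤ (mercator (1ℚ ℚ.- + 1 / suc k)) λ ε 0<ε →
    let N , h = archimedean (suc k) ε 0<ε
    in N , λ m n N≤m m≤n → ≤-trans (tail-≤ k m n m≤n) (h m N≤m)

open Mercator-Lemmas

-- ln n = -ln(1/n) = -ln(1 - (1 - 1/n)), where 0 ≤ 1 - 1/n < 1.
ln : (n : ℕ) .{{_ : NonZero n}} → ℝ
ln n = mkℝ (mercator (1ℚ ℚ.- + 1 / n)) (mercator-cauchy n)

------------------------------------------------------------------------
-- Coprime tuples and their discrepancy

𝒞 : (r : ℕ) → Vec ℕ r → Set
𝒞 r x = (∀ j → 0 ℕ.< lookup x j) × foldr′ gcd 0 x ≡ 1

HasCardinality : {A : Set} → (A → Set) → ℕ → Set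
HasCardinality {A} P k =
  Σ[ xs ∈ List A ] Unique xs × (∀ x → x ∈ xs ⇔ P x) × length xs ≡ k

-- F r n α k says that F(n,α) = k.  A relation, because the integer part of a
-- Cauchy real is not computable.
F : (r n : ℕ) → Vec ℝ r → ℕ → Set
F r n α = HasCardinality λ x →
  𝒞 r x × (∀ j → fromℕ (lookup x j) ≤ℝ fromℕ n *ℝ lookup α j)

𝟏 : ∀ r → Vec ℝ r
𝟏 r = replicate r 1ℝ

∏ : ∀ {r} → Vec ℝ r → ℝ
∏ = foldr′ _*ℝ_ 1ℝ

record Sample (r n : ℕ) : Set where
  field
    α          : Vec ℝ r
    α≥0        : ∀ j → 0ℝ ≤ℝ lookup α j
    α≤1        : ∀ j → lookup α j ≤ℝ 1ℝ
    Fα F𝟏      : ℕ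
    F[n,α]≡Fα  : F r n α Fα
    F[n,𝟏]≡F𝟏  : F r n (𝟏 r) F𝟏
    -- automatic for n ≥ 1, as (1,…,1) is then counted
    F𝟏≢0       : NonZero F𝟏

deviation : ∀ {r n} → Sample r n → ℝ
deviation s = ∣ fromℚ (_/_ (+ Fα) F𝟏 {{F𝟏≢0}}) -ℝ ∏ α ∣ℝ
  where open Sample s

-- Δ is the value of the discrepancy function at n, for tuples of length r.
IsDiscrepancy : (r n : ℕ) → ℝ → Set
IsDiscrepancy r n Δ = IsSupremum (deviation {r} {n}) Δ

{-# OPTIONS --safe #-}

-- For k ∈ {0,…,n}^r the function α ↦ F(n,α) is constant on the cell of the k/n-grid with lower
-- corner k/n, while |α| is monotone.  Hence the supremum defining Δ(n) is the maximum of finitely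
-- many rationals: the deviations F(k)/F(n,𝟏) − |k/n| at the grid points, and the limits
-- |k/n| − F(k − 𝟏)/F(n,𝟏) as α increases to k/n.
--
-- Möbius inversion gives F(k) = Σ_{d≤n} μ(d) ∏ⱼ ⌊kⱼ/d⌋, so F(k) = c ∏ⱼ kⱼ + O(n^{r-1} Σ_{d≤n} d^{1-r})
-- with c = Σ_{d≤n} μ(d)/d^r, the same for all k.  Since F(n,𝟏) ≥ n^r/4, this bounds Δ(n) by a
-- multiple of n⁻¹ Σ_{d≤n} d^{1-r}; for r ≥ 3 the sum is bounded, for r = 2 it is O(ln n).
-- For the lower bound, k = (1,n,…,n) has only coprime tuples below it, whereas the tuples with all
-- entries even account for a positive proportion of [1,n]^r.

module Submission where

open import Defs
open import Data.Nat.Base using (ℕ; NonZero; _≤_)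
open import Data.Product using (∃-syntax; _×_)

open import Data.Empty using (⊥-elim)
open import Data.Fin.Base using (Fin; zero; suc)
import Data.Integer.Base as ℤ
import Data.Integer.Properties as ℤₚ
open import Data.List.Base using (List; []; _∷_; length; map; downFrom; upTo; _++_; cartesianProductWith; filter)
open import Data.List.Membership.Propositional using (_∈_; _∉_)
open import Data.List.Membership.Propositional.Properties
  using (∈-cartesianProductWith⁺; ∈-cartesianProductWith⁻; ∈-filter⁺; ∈-filter⁻; ∈-∃++; ∈-++⁻; ∈-++⁺ˡ; ∈-++⁺ʳ; ∈-upTo⁺; ∈-upTo⁻)
import Data.List.Properties as Listₚ
open import Data.List.Relation.Binary.Permutation.Propositional using (_↭_; ↭-sym; ↭⇒↭ₛ)
open import Data.List.Relation.Binary.Permutation.Propositional.Properties using (↭-length)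
import Data.List.Relation.Binary.Permutation.Setoid.Properties as ↭ₛ
open import Data.List.Relation.Unary.All as All using ([]; _∷_)
open import Data.List.Relation.Unary.AllPairs as AllPairs using ([]; _∷_)
open import Data.List.Relation.Unary.Any using (here; there)
open import Data.List.Relation.Unary.Unique.Propositional using (Unique)
import Data.List.Relation.Unary.Unique.Propositional.Properties as Uniqueₚ
open import Data.Nat.Base as ℕ using (zero; suc; pred)
open import Data.Nat.Coprimality using (Coprime)
open import Data.Nat.Divisibility
  using (_∣_; _∣?_; _∣0; divides; 1∣_; ∣-refl; ∣-trans; ∣1⇒≡1; ∣⇒≤; m∣m*n; n∣m*n; ∣m+n∣m⇒∣n)
open import Data.Nat.GCD using (gcd; gcd[m,n]∣m; gcd[m,n]∣n; gcd[m,n]≢0; gcd-greatest)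
open import Data.Nat.ListAction using (product)
open import Data.Nat.ListAction.Properties using (∈⇒∣product)
open import Data.Nat.Primality using (Prime; euclidsLemma; prime⇒nonZero)
open import Data.Nat.Primality.Factorisation
import Data.Nat.Properties as ℕₚ
open import Data.Product using (∃; _,_; proj₁; proj₂)
open import Data.Rational.Base as ℚ using (ℚ; 0ℚ; 1ℚ; ½; _/_; _+_; _*_; _-_; -_; mkℚ; positive; nonNegative)
open import Data.Rational.Properties as ℚₚ using (module ≤-Reasoning)
open import Data.Rational.Solver using (module +-*-Solver)
open import Data.Sum.Base using (inj₁; inj₂; _⊎_)
open import Data.Vec.Base as Vec using (Vec; []; _∷_; lookup; foldr′; replicate)
import Data.Vec.Properties as Vecₚ
import Data.Vec.Relation.Unary.All as VAll
open VAll using ([]; _∷_) renaming (All to VAll)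
open import Function.Base using (_∘_)
open import Function.Bundles using (_⇔_; mk⇔; Equivalence)
open import Relation.Binary.PropositionalEquality
open import Relation.Nullary using (¬_; Dec; yes; no; ¬?)
open import Relation.Nullary.Negation using (contradiction; ¬¬-map)
open import Data.List.Relation.Unary.Unique.DecPropositional ℕₚ._≟_ using (unique?)
open Cauchy-Lemmas using (half-pos; halves; -‿comm-∣∣; ∣∣≤; bounded; rescale; *-mono-nonNeg)
open Mercator-Lemmas using (/-mono; 0≤/; n*1/m; n/n≡1; archimedean; mercator-mono)
open +-*-Solver using (solve; _:=_; _:+_; _:*_; _:-_; :-_; con)

-- The deviation compares two ratios, and the coefficient c occurs both in F(k) ≈ c ∏ⱼ kⱼ and in
-- F(n,𝟏) ≈ c nʳ, so it cancels and is never evaluated. Dividing still requires F(n,𝟏) to be of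
-- order nʳ. This comes from counting divisors: a gcd g > 1 has the two divisors 1 and g, so 2nʳ ≤
-- F(n,𝟏) + Σ_d ⌊n/d⌋ʳ, and Σ_d d⁻ʳ ≤ 7/4 < 2.
--
-- The obstacle is constructive. The supremum has to be exhibited as a Cauchy real, yet the cell of
-- a given α cannot be found, since integer parts of Cauchy reals are not computable. The maximum
-- over the grid is a rational that mentions no α; that a deviation lies below it is an instance of
-- `_≤ℝ_`, which is ¬¬-stable, so in that proof the cell may be assumed known.
--
-- Constants: ⌊n/2⌋ ≥ n/3 for n ≥ 2 gives the lower constant 3⁻ʳ. The harmonic sum H satisfies H - 1
-- ≤ ln n and, for n ≥ 2, H ≥ 3/2, whence H ≤ 3 ln n.

-- Naturals and their reciprocals as rationals

opaque
  ι : ℕ → ℚ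
  ι n = ℤ.+ n / 1

  -- The value 0 at 0 makes `inv` total, so that sums over `d` carry no `NonZero` instance; `ι*inv`
  -- asks for one.
  inv : ℕ → ℚ
  inv zero    = 0ℚ
  inv (suc d) = ℤ.+ 1 / suc d

opaque
  unfolding ι

  ι-def : ∀ n → ι n ≡ ℤ.+ n / 1
  ι-def n = refl

  ι-0 : ι 0 ≡ 0ℚ
  ι-0 = refl

  ι-1 : ι 1 ≡ 1ℚ
  ι-1 = refl

  inv-def : ∀ d → inv (suc d) ≡ ℤ.+ 1 / suc d
  inv-def d = refl

  inv-1 : inv 1 ≡ 1ℚ
  inv-1 = refl

  coprime-1 : ∀ n → Coprime n 1
  coprime-1 n (_ , i∣1) = ∣1⇒≡1 i∣1

  -- Once the normal form with denominator 1 is exposed, `_+_` and `_*_` compute and only integer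
  -- identities remain.
  ι≡mkℚ : ∀ n → ι n ≡ mkℚ (ℤ.+ n) 0 (coprime-1 n)
  ι≡mkℚ n = ℚₚ.normalize-coprime (coprime-1 n)

  ι-+ : ∀ m n → ι (m ℕ.+ n) ≡ ι m + ι n
  ι-+ m n = sym (trans (cong₂ _+_ (ι≡mkℚ m) (ι≡mkℚ n))
    (cong (_/ 1) (cong₂ ℤ._+_ (ℤₚ.*-identityʳ (ℤ.+ m)) (ℤₚ.*-identityʳ (ℤ.+ n)))))

  ι-* : ∀ m n → ι (m ℕ.* n) ≡ ι m * ι n
  ι-* m n = sym (trans (cong₂ _*_ (ι≡mkℚ m) (ι≡mkℚ n))
    (cong (_/ 1) (sym (ℤₚ.pos-* m n))))

  ι-mono : ∀ {m n} → m ℕ.≤ n → ι m ℚ.≤ ι n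
  ι-mono {m} {n} m≤n = /-mono m 0 n 0 (ℕₚ.*-monoˡ-≤ 1 m≤n)

  0≤ι : ∀ n → 0ℚ ℚ.≤ ι n
  0≤ι n = 0≤/ n 0

  0≤inv : ∀ d → 0ℚ ℚ.≤ inv d
  0≤inv zero    = ℚₚ.≤-refl
  0≤inv (suc d) = 0≤/ 1 d

  ι*inv : ∀ d .{{_ : NonZero d}} → ι d * inv d ≡ 1ℚ
  ι*inv (suc d) = trans (n*1/m (suc d) d) (n/n≡1 d)

  /≡ι*inv : ∀ n d .{{_ : NonZero d}} → ℤ.+ n / d ≡ ι n * inv d
  /≡ι*inv n (suc d) = sym (n*1/m n d)

  inv-anti : ∀ {m n} → m ℕ.≤ n → inv (suc n) ℚ.≤ inv (suc m)
  inv-anti {m} {n} m≤n = /-mono 1 n 1 m (ℕₚ.*-monoʳ-≤ 1 (ℕ.s≤s m≤n))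

  inv≤1 : ∀ d → inv d ℚ.≤ 1ℚ
  inv≤1 zero    = 0≤/ 1 0
  inv≤1 (suc d) = inv-anti {0} {d} ℕ.z≤n

-- Order arithmetic in ℚ

≤-by : ∀ {p q} d → 0ℚ ℚ.≤ d → q ≡ p + d → p ℚ.≤ q
≤-by {p} {q} d 0≤d eq = begin
  p       ≡⟨ ℚₚ.+-identityʳ p ⟨
  p + 0ℚ  ≤⟨ ℚₚ.+-monoʳ-≤ p 0≤d ⟩
  p + d   ≡⟨ eq ⟨
  q       ∎
  where open ≤-Reasoning

0≤-diff : ∀ {p q} → p ℚ.≤ q → 0ℚ ℚ.≤ q - p
0≤-diff {p} {q} p≤q = begin
  0ℚ     ≡⟨ ℚₚ.+-inverseʳ p ⟨
  p - p  ≤⟨ ℚₚ.+-monoˡ-≤ (- p) p≤q ⟩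
  q - p  ∎
  where open ≤-Reasoning

0≤+ : ∀ {p q} → 0ℚ ℚ.≤ p → 0ℚ ℚ.≤ q → 0ℚ ℚ.≤ p + q
0≤+ = ℚₚ.+-mono-≤ {0ℚ} {_} {0ℚ}

0≤* : ∀ {p q} → 0ℚ ℚ.≤ p → 0ℚ ℚ.≤ q → 0ℚ ℚ.≤ p * q
0≤* {p} {q} 0≤p 0≤q = ℚₚ.nonNegative⁻¹ _
  {{ℚₚ.nonNeg*nonNeg⇒nonNeg p {{nonNegative 0≤p}} q {{nonNegative 0≤q}}}}

*-monoʳ : ∀ {p q} r → 0ℚ ℚ.≤ r → p ℚ.≤ q → r * p ℚ.≤ r * q
*-monoʳ r 0≤r = ℚₚ.*-monoˡ-≤-nonNeg r {{nonNegative 0≤r}}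

*-monoˡ : ∀ {p q} r → 0ℚ ℚ.≤ r → p ℚ.≤ q → p * r ℚ.≤ q * r
*-monoˡ r 0≤r = ℚₚ.*-monoʳ-≤-nonNeg r {{nonNegative 0≤r}}

*-mono : ∀ {p q r s} → 0ℚ ℚ.≤ p → p ℚ.≤ q → 0ℚ ℚ.≤ r → r ℚ.≤ s → p * r ℚ.≤ q * s
*-mono 0≤p p≤q 0≤r r≤s = *-mono-nonNeg 0≤p p≤q (ℚₚ.≤-trans 0≤r r≤s) r≤s

0≤1 : 0ℚ ℚ.≤ 1ℚ
0≤1 = 0≤/ 1 0

ι-suc : ∀ n → ι (suc n) ≡ 1ℚ + ι n
ι-suc n = trans (ι-+ 1 n) (cong (_+ ι n) ι-1)

ι-cancel : ∀ {m n} → ι m ℚ.≤ ι n → m ℕ.≤ n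
ι-cancel {m} {n} h with m ℕₚ.≤? n
... | yes m≤n = m≤n
... | no m≰n = ⊥-elim (ℚₚ.<-irrefl refl (ℚₚ.<-≤-trans n<1+n (ℚₚ.≤-trans (ι-mono (ℕₚ.≰⇒> m≰n)) h)))
  where
  n<1+n : ι n ℚ.< ι (suc n)
  n<1+n = subst₂ ℚ._<_ (ℚₚ.+-identityˡ (ι n)) (sym (ι-suc n)) (ℚₚ.+-monoˡ-< (ι n) (ℚₚ.positive⁻¹ 1ℚ))

-- Finite sums

∑ : {A : Set} → List A → (A → ℚ) → ℚ
∑ []       f = 0ℚ
∑ (x ∷ xs) f = f x + ∑ xs f

module _ {A : Set} where

  ∑-cong : ∀ (xs : List A) {f g} → (∀ x → x ∈ xs → f x ≡ g x) → ∑ xs f ≡ ∑ xs g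
  ∑-cong []       h = refl
  ∑-cong (x ∷ xs) h = cong₂ _+_ (h x (here refl)) (∑-cong xs (λ y → h y ∘ there))

  ∑-mono : ∀ (xs : List A) {f g} → (∀ x → x ∈ xs → f x ℚ.≤ g x) → ∑ xs f ℚ.≤ ∑ xs g
  ∑-mono []       h = ℚₚ.≤-refl
  ∑-mono (x ∷ xs) h = ℚₚ.+-mono-≤ (h x (here refl)) (∑-mono xs (λ y → h y ∘ there))

  ∑-0 : ∀ (xs : List A) {f} → (∀ x → x ∈ xs → f x ≡ 0ℚ) → ∑ xs f ≡ 0ℚ
  ∑-0 []       h = refl
  ∑-0 (x ∷ xs) h = cong₂ _+_ (h x (here refl)) (∑-0 xs (λ y → h y ∘ there))

  ∑-+ : ∀ (xs : List A) f g → ∑ xs (λ x → f x + g x) ≡ ∑ xs f + ∑ xs g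
  ∑-+ []       f g = refl
  ∑-+ (x ∷ xs) f g = trans (cong (f x + g x +_) (∑-+ xs f g))
    (solve 4 (λ a b c d → (a :+ b) :+ (c :+ d) := (a :+ c) :+ (b :+ d)) refl (f x) (g x) (∑ xs f) (∑ xs g))

  ∑-*ˡ : ∀ (xs : List A) c f → ∑ xs (λ x → c * f x) ≡ c * ∑ xs f
  ∑-*ˡ []       c f = sym (ℚₚ.*-zeroʳ c)
  ∑-*ˡ (x ∷ xs) c f = trans (cong (c * f x +_) (∑-*ˡ xs c f)) (sym (ℚₚ.*-distribˡ-+ c (f x) (∑ xs f)))

  ∑-*ʳ : ∀ (xs : List A) c f → ∑ xs (λ x → f x * c) ≡ ∑ xs f * c
  ∑-*ʳ xs c f = trans (∑-cong xs (λ x _ → ℚₚ.*-comm (f x) c)) (trans (∑-*ˡ xs c f) (ℚₚ.*-comm c _))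

  ∑-++ : ∀ (xs ys : List A) f → ∑ (xs ++ ys) f ≡ ∑ xs f + ∑ ys f
  ∑-++ []       ys f = sym (ℚₚ.+-identityˡ _)
  ∑-++ (x ∷ xs) ys f = trans (cong (f x +_) (∑-++ xs ys f)) (sym (ℚₚ.+-assoc (f x) _ _))

  ∣∑∣≤ : ∀ (xs : List A) f → ℚ.∣ ∑ xs f ∣ ℚ.≤ ∑ xs (λ x → ℚ.∣ f x ∣)
  ∣∑∣≤ []       f = ℚₚ.≤-refl
  ∣∑∣≤ (x ∷ xs) f = ℚₚ.≤-trans (ℚₚ.∣p+q∣≤∣p∣+∣q∣ (f x) (∑ xs f)) (ℚₚ.+-monoʳ-≤ ℚ.∣ f x ∣ (∣∑∣≤ xs f))

  ∑-1 : ∀ (xs : List A) → ∑ xs (λ _ → 1ℚ) ≡ ι (length xs)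
  ∑-1 []       = sym ι-0
  ∑-1 (x ∷ xs) = trans (cong (1ℚ +_) (∑-1 xs)) (sym (ι-suc (length xs)))

  ∑-map : ∀ {B : Set} (g : B → A) (xs : List B) f → ∑ (map g xs) f ≡ ∑ xs (f ∘ g)
  ∑-map g []       f = refl
  ∑-map g (x ∷ xs) f = cong (f (g x) +_) (∑-map g xs f)

∑-swap : ∀ {A B : Set} (xs : List A) (ys : List B) (f : A → B → ℚ) →
         ∑ xs (λ x → ∑ ys (f x)) ≡ ∑ ys (λ y → ∑ xs (λ x → f x y))
∑-swap []       ys f = sym (∑-0 ys (λ _ _ → refl))
∑-swap (x ∷ xs) ys f = trans (cong (∑ ys (f x) +_) (∑-swap xs ys f)) (sym (∑-+ ys (f x) (λ y → ∑ xs (λ x′ → f x′ y))))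

∑-cartesian : ∀ {A B C : Set} (g : A → B → C) xs ys (f : C → ℚ) →
              ∑ (cartesianProductWith g xs ys) f ≡ ∑ xs (λ x → ∑ ys (λ y → f (g x y)))
∑-cartesian g []       ys f = refl
∑-cartesian g (x ∷ xs) ys f = trans (∑-++ (map (g x) ys) _ f)
  (cong₂ _+_ (∑-map (g x) ys f) (∑-cartesian g xs ys f))

-- Indicators and sums over 1, ..., n

𝟙 : ∀ {P : Set} → Dec P → ℚ
𝟙 (yes _) = 1ℚ
𝟙 (no _)  = 0ℚ

module _ {P : Set} where

  𝟙-yes : (p? : Dec P) → P → 𝟙 p? ≡ 1ℚ
  𝟙-yes (yes _) _ = refl
  𝟙-yes (no ¬p) p = ⊥-elim (¬p p)

  𝟙-no : (p? : Dec P) → ¬ P → 𝟙 p? ≡ 0ℚ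
  𝟙-no (yes p) ¬p = ⊥-elim (¬p p)
  𝟙-no (no _)  _  = refl

  0≤𝟙 : (p? : Dec P) → 0ℚ ℚ.≤ 𝟙 p?
  0≤𝟙 (yes _) = 0≤1
  0≤𝟙 (no _)  = ℚₚ.≤-refl

𝟙-⇔ : ∀ {P Q : Set} (p? : Dec P) (q? : Dec Q) → (P → Q) → (Q → P) → 𝟙 p? ≡ 𝟙 q?
𝟙-⇔ (yes p) q? f g = sym (𝟙-yes q? (f p))
𝟙-⇔ (no ¬p) q? f g = sym (𝟙-no q? (¬p ∘ g))

𝟙-× : ∀ {P Q R : Set} (p? : Dec P) (q? : Dec Q) (r? : Dec R) → (R → P × Q) → (P → Q → R) →
      𝟙 r? ≡ 𝟙 p? * 𝟙 q?
𝟙-× (yes p) q? r? f g = trans (𝟙-⇔ r? q? (proj₂ ∘ f) (g p)) (sym (ℚₚ.*-identityˡ (𝟙 q?)))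
𝟙-× (no ¬p) q? r? f g = trans (𝟙-no r? (¬p ∘ proj₁ ∘ f)) (sym (ℚₚ.*-zeroˡ (𝟙 q?)))

∑-filter : ∀ {A : Set} {P : A → Set} (P? : ∀ x → Dec (P x)) xs →
           ι (length (filter P? xs)) ≡ ∑ xs (𝟙 ∘ P?)
∑-filter P? []       = ι-0
∑-filter P? (x ∷ xs) with P? x
... | yes _ = trans (ι-suc (length (filter P? xs))) (cong (1ℚ +_) (∑-filter P? xs))
... | no  _ = trans (∑-filter P? xs) (sym (ℚₚ.+-identityˡ _))

range : ℕ → List ℕ
range n = map suc (downFrom n)

∈-range⁻ : ∀ n {x} → x ∈ range n → 0 ℕ.< x × x ℕ.≤ n
∈-range⁻ (suc n) (here refl) = ℕ.s≤s ℕ.z≤n , ℕₚ.≤-refl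
∈-range⁻ (suc n) (there p)   = proj₁ (∈-range⁻ n p) , ℕₚ.m≤n⇒m≤1+n (proj₂ (∈-range⁻ n p))

∈-range⁺ : ∀ n {x} → 0 ℕ.< x → x ℕ.≤ n → x ∈ range n
∈-range⁺ zero    0<x x≤n = ⊥-elim (ℕₚ.<⇒≱ 0<x x≤n)
∈-range⁺ (suc n) 0<x x≤n with ℕₚ.m≤n⇒m<n∨m≡n x≤n
... | inj₁ (ℕ.s≤s x≤n′) = there (∈-range⁺ n 0<x x≤n′)
... | inj₂ refl         = here refl

-- The condition on `h m` stands in for `m ≤ n`: it allows indices such as a product p·e that may
-- leave the range, provided that `h` vanishes there.
∑-kronecker : ∀ n m (h : ℕ → ℚ) → 0 ℕ.< m → (n ℕ.< m → h m ≡ 0ℚ) →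
              ∑ (range n) (λ d → 𝟙 (d ℕₚ.≟ m) * h d) ≡ h m
∑-kronecker zero    m h 0<m out = sym (out 0<m)
∑-kronecker (suc n) m h 0<m out with suc n ℕₚ.≟ m
... | yes refl = trans (cong₂ _+_ (ℚₚ.*-identityˡ (h m)) (∑-0 (range n) λ d d∈ →
        trans (cong (_* h d) (𝟙-no (d ℕₚ.≟ m) λ { refl → ℕₚ.1+n≰n (proj₂ (∈-range⁻ n d∈)) }))
              (ℚₚ.*-zeroˡ (h d)))) (ℚₚ.+-identityʳ (h m))
... | no  ≢m   = trans (cong₂ _+_ (ℚₚ.*-zeroˡ (h (suc n)))
                    (∑-kronecker n m h 0<m (λ n<m → out (ℕₚ.≤∧≢⇒< n<m ≢m))))
                  (ℚₚ.+-identityˡ (h m))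

-- The Möbius function

sign : ℕ → ℚ
sign zero    = 1ℚ
sign (suc k) = - sign k

∣sign∣ : ∀ k → ℚ.∣ sign k ∣ ≡ 1ℚ
∣sign∣ zero    = refl
∣sign∣ (suc k) = trans (ℚₚ.∣-p∣≡∣p∣ (sign k)) (∣sign∣ k)

-- For a list of primes this is μ of their product: the entries are distinct exactly when the
-- product is squarefree.
μ-factors : List ℕ → ℚ
μ-factors ps = 𝟙 (unique? ps) * sign (length ps)

opaque
  μ : ℕ → ℚ
  μ zero        = 0ℚ
  μ n@(suc _)   = μ-factors (factors (factorise n))

Unique-resp-↭ : ∀ {xs ys : List ℕ} → xs ↭ ys → Unique xs → Unique ys
Unique-resp-↭ xs↭ys = ↭ₛ.Unique-resp-↭ (setoid ℕ) (↭⇒↭ₛ xs↭ys)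

μ-factors-↭ : ∀ {xs ys} → xs ↭ ys → μ-factors xs ≡ μ-factors ys
μ-factors-↭ {xs} {ys} σ = cong₂ _*_
  (𝟙-⇔ (unique? xs) (unique? ys) (Unique-resp-↭ σ) (Unique-resp-↭ (↭-sym σ)))
  (cong sign (↭-length σ))

μ-factors-∷ : ∀ p ps → p ∉ ps → μ-factors (p ∷ ps) ≡ - μ-factors ps
μ-factors-∷ p ps p∉ps = trans
  (cong (_* - sign (length ps)) (𝟙-⇔ (unique? (p ∷ ps)) (unique? ps) AllPairs.tail
    (λ u → All.tabulate (λ { q∈ refl → p∉ps q∈ }) ∷ u)))
  (sym (ℚₚ.neg-distribʳ-* (𝟙 (unique? ps)) _))

μ-factors-∷-∈ : ∀ p ps → p ∈ ps → μ-factors (p ∷ ps) ≡ 0ℚ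
μ-factors-∷-∈ p ps p∈ps = trans
  (cong (_* - sign (length ps)) (𝟙-no (unique? (p ∷ ps)) λ u → All.lookup (AllPairs.head u) p∈ps refl))
  (ℚₚ.*-zeroˡ (- sign (length ps)))

opaque
  unfolding μ

  ∣μ∣≤1 : ∀ n → ℚ.∣ μ n ∣ ℚ.≤ 1ℚ
  ∣μ∣≤1 zero      = 0≤1
  ∣μ∣≤1 n@(suc _) = go (unique? (factors (factorise n)))
    where
    s : ℚ
    s = sign (length (factors (factorise n)))
    go : ∀ {P : Set} (p? : Dec P) → ℚ.∣ 𝟙 p? * s ∣ ℚ.≤ 1ℚ
    go (yes _) = ℚₚ.≤-reflexive (trans (cong ℚ.∣_∣ (ℚₚ.*-identityˡ s)) (∣sign∣ (length (factors (factorise n)))))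
    go (no  _) = subst (λ t → ℚ.∣ t ∣ ℚ.≤ 1ℚ) (sym (ℚₚ.*-zeroˡ s)) 0≤1

  μ-1 : μ 1 ≡ 1ℚ
  μ-1 = refl

  -- By unique factorisation, prepending `p` to the factors of `e` gives those of p·e up to order.
  -- The new entry flips the sign, or is a repetition when `p` divides `e`.
  μ-prime-* : ∀ {p} → Prime p → ∀ e .{{_ : NonZero e}} →
              μ (p ℕ.* e) ≡ - (𝟙 (¬? (p ∣? e)) * μ e)
  μ-prime-* {p@(suc _)} pPrime e@(suc _) = trans (μ-factors-↭ pe↭) lem
    where
    open PrimeFactorisation
    fe : PrimeFactorisation e
    fe = factorise e
    pe↭ : factors (factorise (p ℕ.* e)) ↭ p ∷ factors fe
    pe↭ = factorisationUnique (factorise (p ℕ.* e)) (record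
      { factors         = p ∷ factors fe
      ; isFactorisation = cong (p ℕ.*_) (isFactorisation fe)
      ; factorsPrime    = pPrime ∷ factorsPrime fe
      })
    lem : μ-factors (p ∷ factors fe) ≡ - (𝟙 (¬? (p ∣? e)) * μ e)
    lem with p ∣? e
    ... | yes p∣e = trans (μ-factors-∷-∈ p (factors fe)
            (factorisationHasAllPrimeFactors pPrime (subst (p ∣_) (isFactorisation fe) p∣e) (factorsPrime fe)))
            (sym (cong -_ (ℚₚ.*-zeroˡ (μ e))))
    ... | no  p∤e = trans (μ-factors-∷ p (factors fe)
            (λ p∈ → p∤e (subst (p ∣_) (sym (isFactorisation fe)) (∈⇒∣product p∈))))
            (sym (cong -_ (ℚₚ.*-identityˡ (μ e))))

-- Write 𝟙(p ∣ d) as Σ_e 𝟙(d = p·e) and exchange the sums. On the right p·e may exceed `N`, where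
-- `h` is zero.
∑-range-multiples : ∀ p .{{_ : NonZero p}} N (h : ℕ → ℚ) → (∀ m → N ℕ.< m → h m ≡ 0ℚ) →
                    ∑ (range N) (λ d → 𝟙 (p ∣? d) * h d) ≡ ∑ (range N) (λ e → h (p ℕ.* e))
∑-range-multiples p N h out = begin
  ∑ (range N) (λ d → 𝟙 (p ∣? d) * h d)
    ≡⟨ ∑-cong (range N) (λ d d∈ → trans (cong (_* h d) (sym (count d d∈)))
         (sym (∑-*ʳ (range N) (h d) (λ e → 𝟙 (d ℕₚ.≟ p ℕ.* e))))) ⟩
  ∑ (range N) (λ d → ∑ (range N) (λ e → 𝟙 (d ℕₚ.≟ p ℕ.* e) * h d))
    ≡⟨ ∑-swap (range N) (range N) (λ d e → 𝟙 (d ℕₚ.≟ p ℕ.* e) * h d) ⟩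
  ∑ (range N) (λ e → ∑ (range N) (λ d → 𝟙 (d ℕₚ.≟ p ℕ.* e) * h d))
    ≡⟨ ∑-cong (range N) (λ e e∈ → ∑-kronecker N (p ℕ.* e) h
         (ℕₚ.*-mono-< {0} {p} {0} (ℕ.>-nonZero⁻¹ p) (proj₁ (∈-range⁻ N e∈))) (out (p ℕ.* e))) ⟩
  ∑ (range N) (λ e → h (p ℕ.* e)) ∎
  where
  open ≡-Reasoning
  count : ∀ d → d ∈ range N → ∑ (range N) (λ e → 𝟙 (d ℕₚ.≟ p ℕ.* e)) ≡ 𝟙 (p ∣? d)
  count d d∈ with p ∣? d
  ... | no p∤d = ∑-0 (range N) λ e _ → 𝟙-no (d ℕₚ.≟ p ℕ.* e)
        λ { refl → p∤d (m∣m*n e) }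
  ... | yes (divides q refl) = trans
        (∑-cong (range N) λ e _ → trans (𝟙-⇔ (q ℕ.* p ℕₚ.≟ p ℕ.* e) (e ℕₚ.≟ q)
            (λ eq → sym (ℕₚ.*-cancelˡ-≡ q e p (trans (ℕₚ.*-comm p q) eq)))
            (λ { refl → ℕₚ.*-comm q p }))
          (sym (ℚₚ.*-identityʳ _)))
        (∑-kronecker N q (λ _ → 1ℚ) 0<q (λ N<q → ⊥-elim (ℕₚ.<⇒≱ N<q
          (ℕₚ.≤-trans (ℕₚ.m≤m*n q p) (proj₂ (∈-range⁻ N d∈))))))
    where
    0<q : 0 ℕ.< q
    0<q = ℕₚ.n≢0⇒n>0 λ { refl → ℕₚ.n≮0 (proj₁ (∈-range⁻ N d∈)) }

∃-prime-∣ : ∀ g → 1 ℕ.< g → ∃[ p ] Prime p × p ∣ g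
∃-prime-∣ g@(suc (suc _)) _ = go (factorise g)
  where
  open PrimeFactorisation
  go : PrimeFactorisation g → ∃[ p ] Prime p × p ∣ g
  go record { factors = p ∷ ps ; isFactorisation = eq ; factorsPrime = pPrime ∷ _ } =
    p , pPrime , divides (product ps) (trans eq (ℕₚ.*-comm p (product ps)))
  go record { factors = [] ; isFactorisation = () }
∃-prime-∣ zero ()
∃-prime-∣ (suc zero) (ℕ.s≤s ())

𝟙-¬ : ∀ {P : Set} (p? : Dec P) → 𝟙 p? + 𝟙 (¬? p?) ≡ 1ℚ
𝟙-¬ (yes _) = refl
𝟙-¬ (no _)  = refl

-- For a prime p ∣ g the divisors of g prime to p cancel against their multiples by p.
∑-μ : ∀ N g → 0 ℕ.< g → g ℕ.≤ N → ∑ (range N) (λ d → μ d * 𝟙 (d ∣? g)) ≡ 𝟙 (g ℕₚ.≟ 1)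
∑-μ N g 0<g g≤N with g ℕₚ.≟ 1
... | yes refl = trans
      (∑-cong (range N) λ d _ → trans (ℚₚ.*-comm (μ d) _) (cong (_* μ d)
        (𝟙-⇔ (d ∣? 1) (d ℕₚ.≟ 1) ∣1⇒≡1 (λ { refl → ∣-refl }))))
      (trans (∑-kronecker N 1 μ (ℕ.s≤s ℕ.z≤n) (λ N<1 → ⊥-elim (ℕₚ.<⇒≱ N<1 g≤N))) μ-1)
... | no g≢1 with ∃-prime-∣ g (ℕₚ.≤∧≢⇒< 0<g (g≢1 ∘ sym))
...   | p , pPrime , p∣g = begin
  ∑ (range N) f
    ≡⟨ ∑-cong (range N) (λ d _ → split (p ∣? d) (f d)) ⟩
  ∑ (range N) (λ d → 𝟙 (p ∣? d) * f d + 𝟙 (¬? (p ∣? d)) * f d)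
    ≡⟨ ∑-+ (range N) (λ d → 𝟙 (p ∣? d) * f d) (λ d → 𝟙 (¬? (p ∣? d)) * f d) ⟩
  ∑ (range N) (λ d → 𝟙 (p ∣? d) * f d) + ∑ (range N) coprimePart
    ≡⟨ cong (_+ ∑ (range N) coprimePart) (∑-range-multiples p N f out) ⟩
  ∑ (range N) (λ e → f (p ℕ.* e)) + ∑ (range N) coprimePart
    ≡⟨ ∑-+ (range N) (λ e → f (p ℕ.* e)) coprimePart ⟨
  ∑ (range N) (λ e → f (p ℕ.* e) + coprimePart e)
    ≡⟨ ∑-0 (range N) (λ e e∈ → cancel e (proj₁ (∈-range⁻ N e∈))) ⟩
  0ℚ ∎
  where
  open ≡-Reasoning
  instance
    nz-p : NonZero p
    nz-p = prime⇒nonZero pPrime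
    nz-g : NonZero g
    nz-g = ℕ.>-nonZero 0<g
  f coprimePart : ℕ → ℚ
  f d = μ d * 𝟙 (d ∣? g)
  coprimePart d = 𝟙 (¬? (p ∣? d)) * f d
  split : ∀ {P : Set} (p? : Dec P) t → t ≡ 𝟙 p? * t + 𝟙 (¬? p?) * t
  split p? t = trans (sym (ℚₚ.*-identityˡ t))
    (trans (cong (_* t) (sym (𝟙-¬ p?))) (ℚₚ.*-distribʳ-+ t (𝟙 p?) (𝟙 (¬? p?))))
  out : ∀ m → N ℕ.< m → f m ≡ 0ℚ
  out m N<m = trans (cong (μ m *_) (𝟙-no (m ∣? g) λ m∣g →
    ℕₚ.<⇒≱ N<m (ℕₚ.≤-trans (∣⇒≤ m∣g) g≤N))) (ℚₚ.*-zeroʳ (μ m))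
  pe∣g : ∀ e → ¬ (p ∣ e) → e ∣ g → p ℕ.* e ∣ g
  -- `p` divides g = q·e but not `e`, hence it divides the cofactor `q`.
  pe∣g e p∤e (divides q eq) with euclidsLemma q e pPrime (subst (p ∣_) eq p∣g)
  ... | inj₂ p∣e = ⊥-elim (p∤e p∣e)
  ... | inj₁ (divides q′ refl) = divides q′ (trans eq (ℕₚ.*-assoc q′ p e))
  cancel : ∀ e → 0 ℕ.< e → f (p ℕ.* e) + coprimePart e ≡ 0ℚ
  cancel e 0<e = trans (cong (λ t → t * 𝟙 (p ℕ.* e ∣? g) + coprimePart e)
    (μ-prime-* pPrime e {{ℕ.>-nonZero 0<e}})) (go (p ∣? e))
    where
    go : (p? : Dec (p ∣ e)) →
         - (𝟙 (¬? p?) * μ e) * 𝟙 (p ℕ.* e ∣? g) + 𝟙 (¬? p?) * f e ≡ 0ℚ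
    go (yes _)  = solve 3 (λ a b c → :- (con 0ℚ :* a) :* b :+ con 0ℚ :* c := con 0ℚ) refl
                    (μ e) (𝟙 (p ℕ.* e ∣? g)) (f e)
    go (no p∤e) = trans
      (cong (λ t → - (1ℚ * μ e) * t + 1ℚ * f e)
        (𝟙-⇔ (p ℕ.* e ∣? g) (e ∣? g) (∣-trans (n∣m*n p)) (pe∣g e p∤e)))
      (solve 2 (λ a b → :- (con 1ℚ :* a) :* b :+ con 1ℚ :* (a :* b) := con 0ℚ) refl (μ e) (𝟙 (e ∣? g)))

-- Coprime tuples in boxes

prod : ∀ {r} → Vec (List ℕ) r → List (Vec ℕ r)
prod []       = [] ∷ []
prod (L ∷ Ls) = cartesianProductWith _∷_ L (prod Ls)

∈-prod⁺ : ∀ {r} (Ls : Vec (List ℕ) r) {x} → (∀ j → lookup x j ∈ lookup Ls j) → x ∈ prod Ls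
∈-prod⁺ []       {[]}    h = here refl
∈-prod⁺ (L ∷ Ls) {y ∷ x} h = ∈-cartesianProductWith⁺ _∷_ (h zero) (∈-prod⁺ Ls (h ∘ suc))

∈-prod⁻ : ∀ {r} (Ls : Vec (List ℕ) r) {x} → x ∈ prod Ls → ∀ j → lookup x j ∈ lookup Ls j
∈-prod⁻ (L ∷ Ls) x∈ j with ∈-cartesianProductWith⁻ _∷_ L (prod Ls) x∈
∈-prod⁻ (L ∷ Ls) x∈ zero    | _ , _ , y∈ , _ , refl = y∈
∈-prod⁻ (L ∷ Ls) x∈ (suc j) | _ , _ , _ , x∈′ , refl = ∈-prod⁻ Ls x∈′ j

prod-unique : ∀ {r} (Ls : Vec (List ℕ) r) → (∀ j → Unique (lookup Ls j)) → Unique (prod Ls)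
prod-unique []       h = [] ∷ []
prod-unique (L ∷ Ls) h = Uniqueₚ.cartesianProductWith⁺ _∷_ Vecₚ.∷-injective (h zero) (prod-unique Ls (h ∘ suc))

box : ∀ {r} → Vec ℕ r → List (Vec ℕ r)
box k = prod (Vec.map range k)

∈-box⁺ : ∀ {r} (k : Vec ℕ r) {x} → (∀ j → 0 ℕ.< lookup x j) → (∀ j → lookup x j ℕ.≤ lookup k j) → x ∈ box k
∈-box⁺ k 0<x x≤k = ∈-prod⁺ (Vec.map range k) λ j →
  subst (_ ∈_) (sym (Vecₚ.lookup-map j range k)) (∈-range⁺ (lookup k j) (0<x j) (x≤k j))

∈-box⁻ : ∀ {r} (k : Vec ℕ r) {x} → x ∈ box k → ∀ j → 0 ℕ.< lookup x j × lookup x j ℕ.≤ lookup k j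
∈-box⁻ k x∈ j = ∈-range⁻ (lookup k j)
  (subst (_ ∈_) (Vecₚ.lookup-map j range k) (∈-prod⁻ (Vec.map range k) x∈ j))

gcds : ∀ {r} → Vec ℕ r → ℕ
gcds = foldr′ gcd 0

coprime? : ∀ {r} (x : Vec ℕ r) → Dec (gcds x ≡ 1)
coprime? x = gcds x ℕₚ.≟ 1

coprimes : ∀ {r} → Vec ℕ r → List (Vec ℕ r)
coprimes k = filter coprime? (box k)

count : ∀ {r} → Vec ℕ r → ℕ
count k = length (coprimes k)

coprimes-unique : ∀ {r} (k : Vec ℕ r) → Unique (coprimes k)
coprimes-unique k = Uniqueₚ.filter⁺ coprime? (prod-unique (Vec.map range k)
  λ j → subst Unique (sym (Vecₚ.lookup-map j range k)) (Uniqueₚ.map⁺ ℕₚ.suc-injective (Uniqueₚ.downFrom⁺ (lookup k j))))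

∈-coprimes : ∀ {r} (k : Vec ℕ r) x → x ∈ coprimes k ⇔ (𝒞 r x × (∀ j → lookup x j ℕ.≤ lookup k j))
∈-coprimes k x = mk⇔
  (λ x∈ → let x∈box , g≡1 = ∈-filter⁻ coprime? x∈ in
    (proj₁ ∘ ∈-box⁻ k x∈box , g≡1) , proj₂ ∘ ∈-box⁻ k x∈box)
  (λ { ((0<x , g≡1) , x≤k) → ∈-filter⁺ coprime? (∈-box⁺ k 0<x x≤k) g≡1 })

-- Induction that removes one occurrence of the head of `xs` from `ys`; by uniqueness the tail of
-- `xs` survives this removal.
unique-⊆-length : ∀ {A : Set} {xs ys : List A} → Unique xs → (∀ {x} → x ∈ xs → x ∈ ys) → length xs ℕ.≤ length ys
unique-⊆-length []            xs⊆ys = ℕ.z≤n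
unique-⊆-length {A} {x ∷ xs} (x∉xs ∷ u) xs⊆ys with ∈-∃++ (xs⊆ys (here refl))
... | as , bs , refl = ℕₚ.≤-trans (ℕ.s≤s (unique-⊆-length u drop-x)) (ℕₚ.≤-reflexive (sym lem))
  where
  drop-x : ∀ {y} → y ∈ xs → y ∈ as ++ bs
  drop-x y∈ with ∈-++⁻ as (xs⊆ys (there y∈))
  ... | inj₁ y∈as         = ∈-++⁺ˡ y∈as
  ... | inj₂ (here refl)  = ⊥-elim (All.lookup x∉xs y∈ refl)
  ... | inj₂ (there y∈bs) = ∈-++⁺ʳ as y∈bs
  lem : length (as ++ x ∷ bs) ≡ suc (length (as ++ bs))
  lem = trans (Listₚ.length-++ as) (trans (ℕₚ.+-suc (length as) (length bs)) (cong suc (sym (Listₚ.length-++ as))))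

-- Volumes and sums over boxes

∏ℚ : ∀ {r} → Vec ℚ r → ℚ
∏ℚ = foldr′ _*_ 1ℚ

vol : ∀ {r} → Vec ℕ r → ℚ
vol k = ∏ℚ (Vec.map ι k)

∏ℚ-replicate : ∀ r a → ∏ℚ (replicate r a) ≡ a ^ℚ r
∏ℚ-replicate zero    a = refl
∏ℚ-replicate (suc r) a = cong (a *_) (∏ℚ-replicate r a)

vol-replicate : ∀ r n → vol (replicate r n) ≡ ι n ^ℚ r
vol-replicate r n = trans (cong ∏ℚ (Vecₚ.map-replicate ι n r)) (∏ℚ-replicate r (ι n))

∏ℚ-scale : ∀ {r} (f : ℕ → ℚ) c (k : Vec ℕ r) → ∏ℚ (Vec.map (λ x → f x * c) k) ≡ ∏ℚ (Vec.map f k) * c ^ℚ r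
∏ℚ-scale f c []      = refl
∏ℚ-scale {suc r} f c (x ∷ k) = trans (cong (f x * c *_) (∏ℚ-scale f c k))
  (solve 4 (λ a c p q → (a :* c) :* (p :* q) := (a :* p) :* (c :* q)) refl (f x) c (∏ℚ (Vec.map f k)) (c ^ℚ r))

-- Distributivity: a summand that splits off its first coordinate has a box sum that splits
-- likewise, which drives the inductions on the dimension.
∑-box-∷ : ∀ {r} y (k : Vec ℕ r) (f : ℕ → ℚ) (g : Vec ℕ r → ℚ) (h : Vec ℕ (suc r) → ℚ) →
          (∀ i x → h (i ∷ x) ≡ f i * g x) → ∑ (box (y ∷ k)) h ≡ ∑ (range y) f * ∑ (box k) g
∑-box-∷ y k f g h eq = begin
  ∑ (box (y ∷ k)) h
    ≡⟨ ∑-cartesian _∷_ (range y) (box k) h ⟩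
  ∑ (range y) (λ i → ∑ (box k) (λ x → h (i ∷ x)))
    ≡⟨ ∑-cong (range y) (λ i _ → trans (∑-cong (box k) (λ x _ → eq i x)) (∑-*ˡ (box k) (f i) g)) ⟩
  ∑ (range y) (λ i → f i * ∑ (box k) g)
    ≡⟨ ∑-*ʳ (range y) (∑ (box k) g) f ⟩
  ∑ (range y) f * ∑ (box k) g ∎
  where open ≡-Reasoning

∑-box-1 : ∀ {r} (k : Vec ℕ r) → ∑ (box k) (λ _ → 1ℚ) ≡ vol k
∑-box-1 []      = refl
∑-box-1 (y ∷ k) = trans (∑-box-∷ y k (λ _ → 1ℚ) (λ _ → 1ℚ) (λ _ → 1ℚ) (λ _ _ → refl))
  (cong₂ _*_ (trans (∑-1 (range y)) (cong ι (trans (Listₚ.length-map suc (downFrom y)) (Listₚ.length-downFrom y))))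
             (∑-box-1 k))

-- For d ≥ 1 this is ⌊n/d⌋, in the form in which it falls out of a sum over a box;
-- `multiples-divMod` identifies it with a quotient.
multiples : ℕ → ℕ → ℚ
multiples d n = ∑ (range n) (λ x → 𝟙 (d ∣? x))

-- `d` divides a gcd iff it divides every coordinate, so the count factors. In dimension 0 the gcd
-- is 0, which every `d` divides, matching the empty product.
∑-box-∣ : ∀ {r} d (k : Vec ℕ r) → ∑ (box k) (λ x → 𝟙 (d ∣? gcds x)) ≡ ∏ℚ (Vec.map (multiples d) k)
∑-box-∣ d []      = cong (_+ 0ℚ) (𝟙-yes (d ∣? 0) (d ∣0))
∑-box-∣ d (y ∷ k) = trans
  (∑-box-∷ y k (λ i → 𝟙 (d ∣? i)) (λ x → 𝟙 (d ∣? gcds x)) (λ x → 𝟙 (d ∣? gcds x)) λ i x →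
    𝟙-× (d ∣? i) (d ∣? gcds x) (d ∣? gcd i (gcds x))
      (λ d∣g → ∣-trans d∣g (gcd[m,n]∣m i (gcds x)) , ∣-trans d∣g (gcd[m,n]∣n i (gcds x)))
      gcd-greatest)
  (cong (multiples d y *_) (∑-box-∣ d k))

ι-count : ∀ {r} (k : Vec ℕ r) → ι (count k) ≡ ∑ (box k) (𝟙 ∘ coprime?)
ι-count k = ∑-filter coprime? (box k)

-- Division with remainder carried along the induction on `n`: the count increases exactly when the
-- remainder wraps around to 0.
multiples-divMod : ∀ d .{{_ : NonZero d}} n → ∃[ q ] ∃[ ρ ] multiples d n ≡ ι q × n ≡ ρ ℕ.+ q ℕ.* d × ρ ℕ.< d
multiples-divMod d zero = 0 , 0 , sym ι-0 , refl , ℕ.>-nonZero⁻¹ d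
multiples-divMod d (suc n) with multiples-divMod d n | d ∣? suc n
... | q , ρ , eq , n≡ , ρ<d | yes d∣1+n = suc q , 0
    , trans (cong (1ℚ +_) eq) (sym (ι-suc q))
    , trans (cong suc n≡) (cong (ℕ._+ q ℕ.* d) 1+ρ≡d)
    , ℕ.>-nonZero⁻¹ d
  where
  -- `d` divides suc n = suc ρ + q·d, hence `suc ρ`, which is positive and at most `d`.
  1+ρ≡d : suc ρ ≡ d
  1+ρ≡d = ℕₚ.≤-antisym ρ<d (∣⇒≤ (∣m+n∣m⇒∣n
    (subst (d ∣_) (trans (cong suc n≡) (ℕₚ.+-comm (suc ρ) (q ℕ.* d))) d∣1+n) (n∣m*n q)))
... | q , ρ , eq , n≡ , ρ<d | no d∤1+n = q , suc ρ
    , trans (ℚₚ.+-identityˡ _) eq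
    , cong suc n≡
    , ℕₚ.≤∧≢⇒< ρ<d λ { refl → d∤1+n (subst (d ∣_) (sym (cong suc n≡)) (n∣m*n (suc q))) }

*-inv : ∀ d .{{_ : NonZero d}} p → p * ι d * inv d ≡ p
*-inv d p = trans (ℚₚ.*-assoc p (ι d) (inv d)) (trans (cong (p *_) (ι*inv d)) (ℚₚ.*-identityʳ p))

0≤multiples : ∀ d .{{_ : NonZero d}} n → 0ℚ ℚ.≤ multiples d n
0≤multiples d n with multiples-divMod d n
... | q , _ , eq , _ = subst (0ℚ ℚ.≤_) (sym eq) (0≤ι q)

multiples-≤ : ∀ d .{{_ : NonZero d}} n → multiples d n ℚ.≤ ι n * inv d
multiples-≤ d n with multiples-divMod d n
... | q , ρ , eq , n≡ , _ = begin
  multiples d n      ≡⟨ eq ⟩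
  ι q                ≡⟨ *-inv d (ι q) ⟨
  ι q * ι d * inv d  ≡⟨ cong (_* inv d) (ι-* q d) ⟨
  ι (q ℕ.* d) * inv d ≤⟨ *-monoˡ (inv d) (0≤inv d) (ι-mono (ℕₚ.≤-trans (ℕₚ.m≤n+m (q ℕ.* d) ρ) (ℕₚ.≤-reflexive (sym n≡)))) ⟩
  ι n * inv d        ∎
  where open ≤-Reasoning

≤-multiples : ∀ d .{{_ : NonZero d}} n → ι n * inv d ℚ.≤ multiples d n + 1ℚ
≤-multiples d n with multiples-divMod d n
... | q , ρ , eq , n≡ , ρ<d = begin
  ι n * inv d               ≤⟨ *-monoˡ (inv d) (0≤inv d) (ι-mono n≤) ⟩
  ι (suc q ℕ.* d) * inv d   ≡⟨ cong (_* inv d) (ι-* (suc q) d) ⟩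
  ι (suc q) * ι d * inv d   ≡⟨ *-inv d (ι (suc q)) ⟩
  ι (suc q)                 ≡⟨ ι-suc q ⟩
  1ℚ + ι q                  ≡⟨ ℚₚ.+-comm 1ℚ (ι q) ⟩
  ι q + 1ℚ                  ≡⟨ cong (_+ 1ℚ) eq ⟨
  multiples d n + 1ℚ        ∎
  where
  open ≤-Reasoning
  n≤ : n ℕ.≤ suc q ℕ.* d
  n≤ = ℕₚ.≤-trans (ℕₚ.≤-reflexive n≡) (ℕₚ.+-monoˡ-≤ (q ℕ.* d) (ℕₚ.<⇒≤ ρ<d))

-- For n ≥ 2 the quotient q is at least 1 and the remainder at most 1, so n ≤ 1 + 2q ≤ 3q. Equality
-- at n = 3 shows that 3 is the best constant.
multiples-2 : ∀ n → 2 ℕ.≤ n → ι n * inv 3 ℚ.≤ multiples 2 n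
multiples-2 n 2≤n with multiples-divMod 2 n
... | zero  , ρ , _ , n≡ , ρ<2 = ⊥-elim (ℕₚ.<⇒≱ ρ<2 (subst (2 ℕ.≤_) (trans n≡ (ℕₚ.+-identityʳ ρ)) 2≤n))
... | suc q , ρ , eq , n≡ , ρ<2 = begin
  ι n * inv 3                ≤⟨ *-monoˡ (inv 3) (0≤inv 3) (ι-mono n≤) ⟩
  ι (suc q ℕ.* 3) * inv 3    ≡⟨ cong (_* inv 3) (ι-* (suc q) 3) ⟩
  ι (suc q) * ι 3 * inv 3    ≡⟨ *-inv 3 (ι (suc q)) ⟩
  ι (suc q)                  ≡⟨ eq ⟨
  multiples 2 n              ∎
  where
  open ≤-Reasoning
  n≤ : n ℕ.≤ suc q ℕ.* 3
  n≤ = ℕₚ.≤-trans (ℕₚ.≤-reflexive n≡) (ℕₚ.≤-trans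
    (ℕₚ.+-mono-≤ (ℕₚ.≤-trans (ℕ.s≤s⁻¹ ρ<2) (ℕ.s≤s (ℕ.z≤n {q}))) (ℕₚ.≤-refl {suc q ℕ.* 2}))
    (ℕₚ.≤-reflexive (sym (ℕₚ.*-suc (suc q) 2))))

-- Powers and perturbed products

0≤^ : ∀ {a} → 0ℚ ℚ.≤ a → ∀ r → 0ℚ ℚ.≤ a ^ℚ r
0≤^ 0≤a zero    = 0≤1
0≤^ 0≤a (suc r) = 0≤* 0≤a (0≤^ 0≤a r)

^-mono : ∀ {a b} → 0ℚ ℚ.≤ a → a ℚ.≤ b → ∀ r → a ^ℚ r ℚ.≤ b ^ℚ r
^-mono 0≤a a≤b zero    = ℚₚ.≤-refl
^-mono 0≤a a≤b (suc r) = *-mono 0≤a a≤b (0≤^ 0≤a r) (^-mono 0≤a a≤b r)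

^-≤1 : ∀ {a} → 0ℚ ℚ.≤ a → a ℚ.≤ 1ℚ → ∀ r → a ^ℚ r ℚ.≤ 1ℚ
^-≤1 0≤a a≤1 zero    = ℚₚ.≤-refl
^-≤1 0≤a a≤1 (suc r) = *-mono 0≤a a≤1 (0≤^ 0≤a r) (^-≤1 0≤a a≤1 r)

^-*  : ∀ a b r → (a * b) ^ℚ r ≡ a ^ℚ r * b ^ℚ r
^-* a b zero    = refl
^-* a b (suc r) = trans (cong (a * b *_) (^-* a b r))
  (solve 4 (λ a b p q → (a :* b) :* (p :* q) := (a :* p) :* (b :* q)) refl a b (a ^ℚ r) (b ^ℚ r))

1^ : ∀ r → 1ℚ ^ℚ r ≡ 1ℚ
1^ zero    = refl
1^ (suc r) = trans (ℚₚ.*-identityˡ _) (1^ r)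

-- Serves for two pairs `f`, `g`: ⌊i/d⌋ against i/d in the Möbius sum, and i - 1 against i in
-- passing from a grid point to the cell below it.
module Perturbation (n : ℕ) (f g : ℕ → ℚ) (B : ℚ)
  (0≤f : ∀ i → 0ℚ ℚ.≤ f i) (f≤g : ∀ i → f i ℚ.≤ g i) where

  0≤∏ : ∀ {r} (k : Vec ℕ r) → 0ℚ ℚ.≤ ∏ℚ (Vec.map f k)
  0≤∏ []      = 0≤1
  0≤∏ (i ∷ k) = 0≤* (0≤f i) (0≤∏ k)

  ∏-≤ : ∀ {r} (k : Vec ℕ r) → ∏ℚ (Vec.map f k) ℚ.≤ ∏ℚ (Vec.map g k)
  ∏-≤ []      = ℚₚ.≤-refl
  ∏-≤ (i ∷ k) = *-mono (0≤f i) (f≤g i) (0≤∏ k) (∏-≤ k)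

  module _ (g≤B : ∀ i → i ℕ.≤ n → g i ℚ.≤ B) (g≤f+1 : ∀ i → g i ℚ.≤ f i + 1ℚ) where

    0≤g : ∀ i → 0ℚ ℚ.≤ g i
    0≤g i = ℚₚ.≤-trans (0≤f i) (f≤g i)

    0≤B : 0ℚ ℚ.≤ B
    0≤B = ℚₚ.≤-trans (0≤g 0) (g≤B 0 ℕ.z≤n)

    ∏-≤-^ : ∀ {r} (k : Vec ℕ r) → VAll (ℕ._≤ n) k → ∏ℚ (Vec.map g k) ℚ.≤ B ^ℚ r
    ∏-≤-^ []      []          = ℚₚ.≤-refl
    ∏-≤-^ (i ∷ k) (i≤n ∷ k≤n) = *-mono (0≤g i) (g≤B i i≤n)
      (ℚₚ.≤-trans (0≤∏ k) (∏-≤ k)) (∏-≤-^ k k≤n)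

    -- The factors are exchanged one at a time. Each exchange changes one factor by at most 1 while
    -- the other ρ factors are at most `B`, and there are ρ + 1 exchanges.
    ∏-close : ∀ {ρ} (k : Vec ℕ (suc ρ)) → VAll (ℕ._≤ n) k →
              ∏ℚ (Vec.map g k) ℚ.≤ ∏ℚ (Vec.map f k) + ι (suc ρ) * B ^ℚ ρ
    ∏-close {zero} (i ∷ []) _ = begin
      g i * 1ℚ                ≡⟨ ℚₚ.*-identityʳ (g i) ⟩
      g i                     ≤⟨ g≤f+1 i ⟩
      f i + 1ℚ                ≡⟨ cong₂ _+_ (sym (ℚₚ.*-identityʳ (f i))) (sym (trans (ℚₚ.*-identityʳ (ι 1)) ι-1)) ⟩
      f i * 1ℚ + ι 1 * 1ℚ     ∎
      where open ≤-Reasoning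
    ∏-close {suc ρ} (i ∷ k) (i≤n ∷ k≤n) = begin
      g i * G
        ≡⟨ solve 3 (λ a b c → b :* c := (b :- a) :* c :+ a :* c) refl (f i) (g i) G ⟩
      (g i - f i) * G + f i * G
        ≤⟨ ℚₚ.+-mono-≤ (*-mono (0≤-diff (f≤g i)) (ℚₚ.≤-trans (ℚₚ.+-monoˡ-≤ (- f i) (g≤f+1 i)) (ℚₚ.≤-reflexive
             (solve 1 (λ a → a :+ con 1ℚ :- a := con 1ℚ) refl (f i)))) (ℚₚ.≤-trans (0≤∏ k) (∏-≤ k)) (∏-≤-^ k k≤n))
             (*-monoʳ (f i) (0≤f i) (∏-close k k≤n)) ⟩
      1ℚ * B ^ℚ suc ρ + f i * (F′ + ι (suc ρ) * B ^ℚ ρ)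
        ≡⟨ cong (1ℚ * B ^ℚ suc ρ +_) (ℚₚ.*-distribˡ-+ (f i) F′ _) ⟩
      1ℚ * B ^ℚ suc ρ + (f i * F′ + f i * (ι (suc ρ) * B ^ℚ ρ))
        ≤⟨ ℚₚ.+-monoʳ-≤ (1ℚ * B ^ℚ suc ρ) (ℚₚ.+-monoʳ-≤ (f i * F′)
             (*-monoˡ (ι (suc ρ) * B ^ℚ ρ) (0≤* (0≤ι (suc ρ)) (0≤^ 0≤B ρ)) (ℚₚ.≤-trans (f≤g i) (g≤B i i≤n)))) ⟩
      1ℚ * (B * B ^ℚ ρ) + (f i * F′ + B * (ι (suc ρ) * B ^ℚ ρ))
        ≡⟨ solve 4 (λ b p a c → con 1ℚ :* (b :* p) :+ (a :+ b :* (c :* p)) := a :+ (con 1ℚ :+ c) :* (b :* p)) refl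
             B (B ^ℚ ρ) (f i * F′) (ι (suc ρ)) ⟩
      f i * F′ + (1ℚ + ι (suc ρ)) * B ^ℚ suc ρ
        ≡⟨ cong (λ t → f i * F′ + t * B ^ℚ suc ρ) (ι-suc (suc ρ)) ⟨
      f i * F′ + ι (suc (suc ρ)) * B ^ℚ suc ρ ∎
      where
      open ≤-Reasoning
      G F′ : ℚ
      G = ∏ℚ (Vec.map g k)
      F′ = ∏ℚ (Vec.map f k)

-- Möbius inversion in a box

gcds-pos : ∀ {r} (k : Vec ℕ (suc r)) {x} → x ∈ box k → 0 ℕ.< gcds x
gcds-pos k {i ∷ x} x∈ = ℕₚ.n≢0⇒n>0 (gcd[m,n]≢0 i (gcds x) (inj₁ (ℕₚ.m<n⇒n≢0 (proj₁ (∈-box⁻ k x∈ zero)))))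

gcds-≤ : ∀ {r} n (k : Vec ℕ (suc r)) → VAll (ℕ._≤ n) k → ∀ {x} → x ∈ box k → gcds x ℕ.≤ n
gcds-≤ n k@(_ ∷ _) (k≤n ∷ _) {i ∷ x} x∈ = ℕₚ.≤-trans
  (∣⇒≤ {{ℕ.>-nonZero (proj₁ (∈-box⁻ k x∈ zero))}} (gcd[m,n]∣m i (gcds x)))
  (ℕₚ.≤-trans (proj₂ (∈-box⁻ k x∈ zero)) k≤n)

range-nonZero : ∀ n {d} → d ∈ range n → NonZero d
range-nonZero n d∈ = ℕ.>-nonZero (proj₁ (∈-range⁻ n d∈))

all-≤-replicate : ∀ r n → VAll (ℕ._≤ n) (replicate r n)
all-≤-replicate zero    n = []
all-≤-replicate (suc r) n = ℕₚ.≤-refl ∷ all-≤-replicate r n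

-- The truncation at `n` is exact, because a gcd of entries bounded by `n` is bounded by `n`. It
-- depends on `n` and not on `k`, so all boxes share one coefficient.
count-≡-∑μ : ∀ {ρ} n (k : Vec ℕ (suc ρ)) → VAll (ℕ._≤ n) k →
             ι (count k) ≡ ∑ (range n) (λ d → μ d * ∏ℚ (Vec.map (multiples d) k))
count-≡-∑μ n k k≤n = begin
  ι (count k)
    ≡⟨ ι-count k ⟩
  ∑ (box k) (𝟙 ∘ coprime?)
    ≡⟨ ∑-cong (box k) (λ x x∈ → sym (∑-μ n (gcds x) (gcds-pos k x∈) (gcds-≤ n k k≤n x∈))) ⟩
  ∑ (box k) (λ x → ∑ (range n) (λ d → μ d * 𝟙 (d ∣? gcds x)))
    ≡⟨ ∑-swap (box k) (range n) (λ x d → μ d * 𝟙 (d ∣? gcds x)) ⟩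
  ∑ (range n) (λ d → ∑ (box k) (λ x → μ d * 𝟙 (d ∣? gcds x)))
    ≡⟨ ∑-cong (range n) (λ d _ → trans (∑-*ˡ (box k) (μ d) (λ x → 𝟙 (d ∣? gcds x)))
         (cong (μ d *_) (∑-box-∣ d k))) ⟩
  ∑ (range n) (λ d → μ d * ∏ℚ (Vec.map (multiples d) k)) ∎
  where open ≡-Reasoning

invPowerSum : ℕ → ℕ → ℚ
invPowerSum s n = ∑ (range n) (λ d → inv d ^ℚ s)

-- A partial sum of Σ μ(d)/dʳ, the series of 1/ζ(r).
density : ℕ → ℕ → ℚ
density r n = ∑ (range n) (λ d → μ d * inv d ^ℚ r)

∣∣-≤-by : ∀ {p q e} → p ℚ.≤ q → q ℚ.≤ p + e → ℚ.∣ p - q ∣ ℚ.≤ e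
∣∣-≤-by {p} {q} {e} p≤q q≤p+e = ∣∣≤
  (ℚₚ.≤-trans (≤-by (q - p) (0≤-diff p≤q) (solve 2 (λ p q → con 0ℚ := p :- q :+ (q :- p)) refl p q))
              (ℚₚ.≤-trans (0≤-diff p≤q) q-p≤e))
  (ℚₚ.≤-trans (ℚₚ.≤-reflexive (solve 2 (λ p q → :- (p :- q) := q :- p) refl p q)) q-p≤e)
  where
  q-p≤e : q - p ℚ.≤ e
  q-p≤e = ≤-by (p + e - q) (0≤-diff q≤p+e) (solve 3 (λ p q e → e := q :- p :+ (p :+ e :- q)) refl p q e)

-- In the `d`-th Möbius term ∏ⱼ ⌊kⱼ/d⌋ is replaced by ∏ⱼ kⱼ/d. All factors are at most B = n/d, so
-- `∏-close` bounds the error by (ρ + 1)(n/d)^ρ, to be summed over `d`.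
count-estimate : ∀ {ρ} n (k : Vec ℕ (suc ρ)) → VAll (ℕ._≤ n) k →
                 ℚ.∣ ι (count k) - density (suc ρ) n * vol k ∣ ℚ.≤ ι (suc ρ) * ι n ^ℚ ρ * invPowerSum ρ n
count-estimate {ρ} n k k≤n = begin
  ℚ.∣ ι (count k) - density (suc ρ) n * vol k ∣
    ≡⟨ cong ℚ.∣_∣ split ⟩
  ℚ.∣ ∑ (range n) (λ d → μ d * (P d - Q d)) ∣
    ≤⟨ ∣∑∣≤ (range n) (λ d → μ d * (P d - Q d)) ⟩
  ∑ (range n) (λ d → ℚ.∣ μ d * (P d - Q d) ∣)
    ≤⟨ ∑-mono (range n) term ⟩
  ∑ (range n) (λ d → ι (suc ρ) * ι n ^ℚ ρ * inv d ^ℚ ρ)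
    ≡⟨ ∑-*ˡ (range n) (ι (suc ρ) * ι n ^ℚ ρ) (λ d → inv d ^ℚ ρ) ⟩
  ι (suc ρ) * ι n ^ℚ ρ * invPowerSum ρ n ∎
  where
  open ≤-Reasoning
  P Q : ℕ → ℚ
  P d = ∏ℚ (Vec.map (multiples d) k)
  Q d = ∏ℚ (Vec.map (λ i → ι i * inv d) k)
  split : ι (count k) - density (suc ρ) n * vol k ≡ ∑ (range n) (λ d → μ d * (P d - Q d))
  split = trans (cong₂ _+_ (count-≡-∑μ n k k≤n)
      (trans (ℚₚ.neg-distribʳ-* (density (suc ρ) n) (vol k))
             (sym (∑-*ʳ (range n) (- vol k) (λ d → μ d * inv d ^ℚ suc ρ)))))
    (trans (sym (∑-+ (range n) (λ d → μ d * P d) (λ d → μ d * inv d ^ℚ suc ρ * - vol k)))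
      (∑-cong (range n) λ d _ → trans
        (solve 4 (λ m p v w → m :* p :+ m :* w :* (:- v) := m :* (p :- v :* w)) refl
          (μ d) (P d) (vol k) (inv d ^ℚ suc ρ))
        (cong (λ t → μ d * (P d - t)) (sym (∏ℚ-scale ι (inv d) k)))))
  term : ∀ d → d ∈ range n → ℚ.∣ μ d * (P d - Q d) ∣ ℚ.≤ ι (suc ρ) * ι n ^ℚ ρ * inv d ^ℚ ρ
  term d d∈ = begin
    ℚ.∣ μ d * (P d - Q d) ∣
      ≡⟨ ℚₚ.∣p*q∣≡∣p∣*∣q∣ (μ d) (P d - Q d) ⟩
    ℚ.∣ μ d ∣ * ℚ.∣ P d - Q d ∣
      ≤⟨ *-mono (ℚₚ.0≤∣p∣ (μ d)) (∣μ∣≤1 d) (ℚₚ.0≤∣p∣ (P d - Q d))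
           (∣∣-≤-by (∏-≤ k) (∏-close
             (λ i i≤n → *-monoˡ (inv d) (0≤inv d) (ι-mono i≤n)) (≤-multiples d) k k≤n)) ⟩
    1ℚ * (ι (suc ρ) * (ι n * inv d) ^ℚ ρ)
      ≡⟨ trans (ℚₚ.*-identityˡ _) (trans (cong (ι (suc ρ) *_) (^-* (ι n) (inv d) ρ))
           (sym (ℚₚ.*-assoc (ι (suc ρ)) (ι n ^ℚ ρ) (inv d ^ℚ ρ)))) ⟩
    ι (suc ρ) * ι n ^ℚ ρ * inv d ^ℚ ρ ∎
    where
    instance
      nz-d : NonZero d
      nz-d = range-nonZero n d∈
    open Perturbation n (multiples d) (λ i → ι i * inv d) (ι n * inv d) (0≤multiples d) (multiples-≤ d)

-- Power sums of reciprocals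

-- Allows an error of order 1/n to be absorbed into a bound that carries the factor `invPowerSum`.
1≤invPowerSum : ∀ s m → 1ℚ ℚ.≤ invPowerSum s (suc m)
1≤invPowerSum s zero    = ℚₚ.≤-reflexive (sym (trans (ℚₚ.+-identityʳ (inv 1 ^ℚ s)) (trans (cong (_^ℚ s) inv-1) (1^ s))))
1≤invPowerSum s (suc m) = ≤-by (d + (invPowerSum s (suc m) - 1ℚ)) (0≤+ (0≤^ (0≤inv (suc (suc m))) s) (0≤-diff (1≤invPowerSum s m)))
  (solve 2 (λ d p → d :+ p := con 1ℚ :+ (d :+ (p :- con 1ℚ))) refl d (invPowerSum s (suc m)))
  where
  d : ℚ
  d = inv (suc (suc m)) ^ℚ s

inv-telescope : ∀ d .{{_ : NonZero d}} → inv d - inv (suc d) ≡ inv d * inv (suc d)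
inv-telescope d = begin
  a - b
    ≡⟨ cong₂ _-_ (sym (ℚₚ.*-identityʳ a)) (sym (ℚₚ.*-identityʳ b)) ⟩
  a * 1ℚ - b * 1ℚ
    ≡⟨ cong₂ (λ s t → a * s - b * t) (sym (ι*inv (suc d))) (sym (ι*inv d)) ⟩
  a * (ι (suc d) * b) - b * (ι d * a)
    ≡⟨ cong (λ t → a * (t * b) - b * (ι d * a)) (ι-suc d) ⟩
  a * ((1ℚ + ι d) * b) - b * (ι d * a)
    ≡⟨ solve 3 (λ a b x → a :* ((con 1ℚ :+ x) :* b) :- b :* (x :* a) := a :* b) refl a b (ι d) ⟩
  a * b ∎
  where
  open ≡-Reasoning
  a b : ℚ
  a = inv d
  b = inv (suc d)

inv-suc-≤ : ∀ d .{{_ : NonZero d}} → inv (suc d) ℚ.≤ inv d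
inv-suc-≤ (suc m) = inv-anti (ℕₚ.n≤1+n m)

-- This is 1 + 1/4 + 1/2, where the telescoping starts at two terms. A start at one term would yield
-- only 1 + 1 = 2, which `total-≥` cannot use: it needs a bound strictly below 2.
7/4 : ℚ
7/4 = ℤ.+ 7 / 4

-- The sum of 1/d² telescopes against 1/(d (d + 1)) = 1/d - 1/(d + 1).
invPowerSum-2-telescope : ∀ m → invPowerSum 2 (suc (suc m)) + inv (suc (suc m)) ℚ.≤ 7/4
invPowerSum-2-telescope zero    = ℚₚ.≤-reflexive
  (cong₂ (λ a b → a * (a * 1ℚ) + (b * (b * 1ℚ) + 0ℚ) + a) (inv-def 1) inv-1)
-- Since a - b = a·b, the old left side p + a equals p + b + a·b. Replacing a·b by b² leaves the
-- slack b(a - b).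
invPowerSum-2-telescope (suc m) = ℚₚ.≤-trans (≤-by (b * (a * 1ℚ - b)) 0≤slack eq) (invPowerSum-2-telescope m)
  where
  a b p : ℚ
  a = inv (suc (suc m))
  b = inv (suc (suc (suc m)))
  p = invPowerSum 2 (suc (suc m))
  0≤slack : 0ℚ ℚ.≤ b * (a * 1ℚ - b)
  0≤slack = 0≤* (0≤inv (suc (suc (suc m)))) (subst (λ t → 0ℚ ℚ.≤ t - b) (sym (ℚₚ.*-identityʳ a))
    (0≤-diff (inv-suc-≤ (suc (suc m)))))
  eq : p + a ≡ b * (b * 1ℚ) + p + b + b * (a * 1ℚ - b)
  eq = trans (cong (p +_) (trans (solve 2 (λ a b → a := a :- b :+ b) refl a b) (cong (_+ b) (inv-telescope (suc (suc m))))))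
    (solve 3 (λ a b p → p :+ (a :* b :+ b) := b :* (b :* con 1ℚ) :+ p :+ b :+ b :* (a :* con 1ℚ :- b)) refl a b p)

invPowerSum-2-≤ : ∀ n → invPowerSum 2 n ℚ.≤ 7/4
invPowerSum-2-≤ zero          = ℚ.*≤* (ℤ.+≤+ ℕ.z≤n)
invPowerSum-2-≤ (suc zero)    = ℚₚ.≤-trans (ℚₚ.≤-reflexive (cong (λ b → b * (b * 1ℚ) + 0ℚ) inv-1)) 1≤7/4
  where
  1≤7/4 : 1ℚ ℚ.≤ 7/4
  1≤7/4 = ℚ.*≤* (ℤ.+≤+ (ℕₚ.m≤m+n 4 3))
invPowerSum-2-≤ (suc (suc m)) = ℚₚ.≤-trans (≤-by (inv (suc (suc m))) (0≤inv (suc (suc m))) refl) (invPowerSum-2-telescope m)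

^-anti : ∀ {a} → 0ℚ ℚ.≤ a → a ℚ.≤ 1ℚ → ∀ {s t} → s ℕ.≤ t → a ^ℚ t ℚ.≤ a ^ℚ s
^-anti 0≤a a≤1 {t = t} ℕ.z≤n = ^-≤1 0≤a a≤1 t
^-anti 0≤a a≤1 (ℕ.s≤s s≤t)   = *-monoʳ _ 0≤a (^-anti 0≤a a≤1 s≤t)

invPowerSum-≤ : ∀ s n → 2 ℕ.≤ s → invPowerSum s n ℚ.≤ 7/4
invPowerSum-≤ s n 2≤s = ℚₚ.≤-trans
  (∑-mono (range n) (λ d _ → ^-anti (0≤inv d) (inv≤1 d) 2≤s)) (invPowerSum-2-≤ n)

-- Bounds for F(n,𝟏)

total : ℕ → ℕ → ℕ
total r n = count (replicate r n)

∏-multiples-replicate : ∀ d r n → ∏ℚ (Vec.map (multiples d) (replicate r n)) ≡ multiples d n ^ℚ r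
∏-multiples-replicate d r n = trans (cong ∏ℚ (Vecₚ.map-replicate (multiples d) n r)) (∏ℚ-replicate r (multiples d n))

-- The divisors 1 and g of g count twice, unless g = 1, where the indicator makes up for it.
two-divisors : ∀ n g → 0 ℕ.< g → g ℕ.≤ n → 1ℚ + 1ℚ ℚ.≤ 𝟙 (g ℕₚ.≟ 1) + ∑ (range n) (λ d → 𝟙 (d ∣? g))
two-divisors n g 0<g g≤n with g ℕₚ.≟ 1
... | yes refl = ℚₚ.+-monoʳ-≤ 1ℚ (ℚₚ.≤-trans (ℚₚ.≤-reflexive (sym (∑-kronecker n 1 (λ _ → 1ℚ) 0<g
        (λ n<1 → ⊥-elim (ℕₚ.<⇒≱ n<1 g≤n))))) (∑-mono (range n) λ d _ →
        ℚₚ.≤-reflexive (trans (ℚₚ.*-identityʳ _) (𝟙-⇔ (d ℕₚ.≟ 1) (d ∣? 1) (λ { refl → ∣-refl }) ∣1⇒≡1))))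
... | no g≢1 = begin
  1ℚ + 1ℚ
    ≡⟨ cong₂ _+_ (∑-kronecker n 1 (λ _ → 1ℚ) (ℕ.s≤s ℕ.z≤n) (λ n<1 → ⊥-elim (ℕₚ.<⇒≱ n<1 (ℕₚ.≤-trans 0<g g≤n))))
                 (∑-kronecker n g (λ _ → 1ℚ) 0<g (λ n<g → ⊥-elim (ℕₚ.<⇒≱ n<g g≤n))) ⟨
  ∑ (range n) (λ d → 𝟙 (d ℕₚ.≟ 1) * 1ℚ) + ∑ (range n) (λ d → 𝟙 (d ℕₚ.≟ g) * 1ℚ)
    ≡⟨ ∑-+ (range n) (λ d → 𝟙 (d ℕₚ.≟ 1) * 1ℚ) (λ d → 𝟙 (d ℕₚ.≟ g) * 1ℚ) ⟨
  ∑ (range n) (λ d → 𝟙 (d ℕₚ.≟ 1) * 1ℚ + 𝟙 (d ℕₚ.≟ g) * 1ℚ)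
    ≤⟨ ∑-mono (range n) (λ d _ → term d (d ℕₚ.≟ 1) (d ℕₚ.≟ g)) ⟩
  ∑ (range n) (λ d → 𝟙 (d ∣? g))
    ≡⟨ ℚₚ.+-identityˡ _ ⟨
  0ℚ + ∑ (range n) (λ d → 𝟙 (d ∣? g)) ∎
  where
  open ≤-Reasoning
  term : ∀ d (p? : Dec (d ≡ 1)) (q? : Dec (d ≡ g)) → 𝟙 p? * 1ℚ + 𝟙 q? * 1ℚ ℚ.≤ 𝟙 (d ∣? g)
  term d (yes refl) (yes refl) = ⊥-elim (g≢1 refl)
  term d (yes refl) (no _)     = ℚₚ.≤-reflexive (sym (𝟙-yes (1 ∣? g) (1∣ g)))
  term d (no _)     (yes refl) = ℚₚ.≤-reflexive (sym (𝟙-yes (g ∣? g) ∣-refl))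
  term d (no _)     (no _)     = 0≤𝟙 (d ∣? g)

-- Summing `two-divisors` over the box gives 2nʳ ≤ F(n,𝟏) + Σ_d ⌊n/d⌋ʳ. The last sum is at most
-- (7/4)nʳ, and the 4 comes from 2 - 7/4 = 1/4.
total-≥ : ∀ r n .{{_ : NonZero n}} → 2 ℕ.≤ r → ι n ^ℚ r ℚ.≤ ι 4 * ι (total r n)
total-≥ r@(suc ρ) n 2≤r = begin
  N
    ≡⟨ solve 1 (λ x → x := con four :* (con 2ℚ :* x) :- con four :* (con 7/4 :* x)) refl N ⟩
  four * (2ℚ * N) - four * (7/4 * N)
    ≤⟨ ℚₚ.+-monoˡ-≤ (- (four * (7/4 * N))) (*-monoʳ four (0≤/ 4 0) key) ⟩
  four * (T + 7/4 * N) - four * (7/4 * N)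
    ≡⟨ solve 2 (λ t x → con four :* (t :+ con 7/4 :* x) :- con four :* (con 7/4 :* x) := con four :* t) refl T N ⟩
  four * T
    ≡⟨ cong (_* T) (ι-def 4) ⟨
  ι 4 * T ∎
  where
  open ≤-Reasoning
  N T 2ℚ four : ℚ
  N = ι n ^ℚ r
  T = ι (total r n)
  2ℚ = 1ℚ + 1ℚ
  four = ℤ.+ 4 / 1
  bx : List (Vec ℕ r)
  bx = box (replicate r n)
  divisorPart : ∑ bx (λ x → ∑ (range n) (λ d → 𝟙 (d ∣? gcds x))) ℚ.≤ 7/4 * N
  divisorPart = begin
    ∑ bx (λ x → ∑ (range n) (λ d → 𝟙 (d ∣? gcds x)))
      ≡⟨ ∑-swap bx (range n) (λ x d → 𝟙 (d ∣? gcds x)) ⟩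
    ∑ (range n) (λ d → ∑ bx (λ x → 𝟙 (d ∣? gcds x)))
      ≡⟨ ∑-cong (range n) (λ d _ → trans (∑-box-∣ d (replicate r n)) (∏-multiples-replicate d r n)) ⟩
    ∑ (range n) (λ d → multiples d n ^ℚ r)
      ≤⟨ ∑-mono (range n) (λ d d∈ → let instance nz = range-nonZero n d∈ in
           ℚₚ.≤-trans (^-mono (0≤multiples d n) (multiples-≤ d n) r)
             (ℚₚ.≤-reflexive (^-* (ι n) (inv d) r))) ⟩
    ∑ (range n) (λ d → N * inv d ^ℚ r)
      ≡⟨ ∑-*ˡ (range n) N (λ d → inv d ^ℚ r) ⟩
    N * invPowerSum r n
      ≤⟨ *-monoʳ N (0≤^ (0≤ι n) r) (invPowerSum-≤ r n 2≤r) ⟩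
    N * 7/4
      ≡⟨ ℚₚ.*-comm N 7/4 ⟩
    7/4 * N ∎
  key : 2ℚ * N ℚ.≤ T + 7/4 * N
  key = begin
    2ℚ * N
      ≡⟨ cong (2ℚ *_) (trans (∑-box-1 (replicate r n)) (vol-replicate r n)) ⟨
    2ℚ * ∑ bx (λ _ → 1ℚ)
      ≡⟨ ∑-*ˡ bx 2ℚ (λ _ → 1ℚ) ⟨
    ∑ bx (λ _ → 2ℚ)
      ≤⟨ ∑-mono bx (λ x x∈ → two-divisors n (gcds x) (gcds-pos (replicate r n) x∈)
           (gcds-≤ n (replicate r n) (all-≤-replicate r n) x∈)) ⟩
    ∑ bx (λ x → 𝟙 (coprime? x) + ∑ (range n) (λ d → 𝟙 (d ∣? gcds x)))
      ≡⟨ ∑-+ bx (𝟙 ∘ coprime?) (λ x → ∑ (range n) (λ d → 𝟙 (d ∣? gcds x))) ⟩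
    ∑ bx (𝟙 ∘ coprime?) + ∑ bx (λ x → ∑ (range n) (λ d → 𝟙 (d ∣? gcds x)))
      ≤⟨ ℚₚ.+-mono-≤ (ℚₚ.≤-reflexive (sym (ι-count (replicate r n)))) divisorPart ⟩
    T + 7/4 * N ∎

-- Tuples with all entries even are not coprime.
total-≤ : ∀ r n → 2 ℕ.≤ n → ι (total r n) + (ι n * inv 3) ^ℚ r ℚ.≤ ι n ^ℚ r
total-≤ r n 2≤n = begin
  ι (total r n) + (ι n * inv 3) ^ℚ r
    ≤⟨ ℚₚ.+-mono-≤ (ℚₚ.≤-reflexive (ι-count (replicate r n)))
         (^-mono (0≤* (0≤ι n) (0≤inv 3)) (multiples-2 n 2≤n) r) ⟩
  ∑ bx (𝟙 ∘ coprime?) + multiples 2 n ^ℚ r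
    ≡⟨ cong (∑ bx (𝟙 ∘ coprime?) +_) (trans (∑-box-∣ 2 (replicate r n)) (∏-multiples-replicate 2 r n)) ⟨
  ∑ bx (𝟙 ∘ coprime?) + ∑ bx (λ x → 𝟙 (2 ∣? gcds x))
    ≡⟨ ∑-+ bx (𝟙 ∘ coprime?) (λ x → 𝟙 (2 ∣? gcds x)) ⟨
  ∑ bx (λ x → 𝟙 (coprime? x) + 𝟙 (2 ∣? gcds x))
    ≤⟨ ∑-mono bx (λ x _ → term (gcds x) (coprime? x) (2 ∣? gcds x)) ⟩
  ∑ bx (λ _ → 1ℚ)
    ≡⟨ trans (∑-box-1 (replicate r n)) (vol-replicate r n) ⟩
  ι n ^ℚ r ∎
  where
  open ≤-Reasoning
  bx : List (Vec ℕ r)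
  bx = box (replicate r n)
  term : ∀ g (p? : Dec (g ≡ 1)) (q? : Dec (2 ∣ g)) → 𝟙 p? + 𝟙 q? ℚ.≤ 1ℚ
  term g (yes refl) (yes 2∣1) with () ← ∣1⇒≡1 2∣1
  term g (yes _)    (no _)  = ℚₚ.≤-refl
  term g (no _)     (yes _) = ℚₚ.≤-refl
  term g (no _)     (no _)  = 0≤1

count-1∷ : ∀ {ρ} (k : Vec ℕ ρ) → ι (count (1 ∷ k)) ≡ vol k
count-1∷ k = begin
  ι (count (1 ∷ k))
    ≡⟨ ι-count (1 ∷ k) ⟩
  ∑ (box (1 ∷ k)) (𝟙 ∘ coprime?)
    ≡⟨ ∑-cong (box (1 ∷ k)) all-coprime ⟩
  ∑ (box (1 ∷ k)) (λ _ → 1ℚ)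
    ≡⟨ ∑-box-1 (1 ∷ k) ⟩
  ι 1 * vol k
    ≡⟨ trans (cong (_* vol k) ι-1) (ℚₚ.*-identityˡ (vol k)) ⟩
  vol k ∎
  where
  open ≡-Reasoning
  all-coprime : ∀ x → x ∈ box (1 ∷ k) → 𝟙 (coprime? x) ≡ 1ℚ
  all-coprime (i ∷ x) x∈ with ∈-box⁻ (1 ∷ k) x∈ zero
  ... | 0<i , i≤1 with refl ← ℕₚ.≤-antisym i≤1 0<i =
    𝟙-yes (coprime? (1 ∷ x)) (∣1⇒≡1 (gcd[m,n]∣m 1 (gcds x)))

∈⇒0<length : ∀ {A : Set} {x : A} {xs} → x ∈ xs → 0 ℕ.< length xs
∈⇒0<length (here _)  = ℕ.s≤s ℕ.z≤n
∈⇒0<length (there _) = ℕ.s≤s ℕ.z≤n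

-- The tuple (1,...,1) is counted; its gcd is 1 because the dimension is positive.
total-nonZero : ∀ ρ n .{{_ : NonZero n}} → NonZero (total (suc ρ) n)
total-nonZero ρ n = ℕ.>-nonZero (∈⇒0<length (Equivalence.from (∈-coprimes (replicate r n) (replicate r 1))
  ( ( (λ j → subst (0 ℕ.<_) (sym (Vecₚ.lookup-replicate j 1)) (ℕ.s≤s ℕ.z≤n))
    , ∣1⇒≡1 (gcd[m,n]∣m 1 (gcds (replicate ρ 1))))
  , λ j → subst₂ ℕ._≤_ (sym (Vecₚ.lookup-replicate j 1)) (sym (Vecₚ.lookup-replicate j n)) (ℕ.>-nonZero⁻¹ n))))
  where
  r : ℕ
  r = suc ρ

-- Deviations at grid points

-- |k/n| and F(n,k/n)/F(n,𝟏).
share coprimeShare : ∀ {r} → ℕ → Vec ℕ r → ℚ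
share {r} n k = vol k * inv n ^ℚ r
coprimeShare {r} n k = ι (count k) * inv (total r n)

^-inverse : ∀ a b → a * b ≡ 1ℚ → ∀ r → a ^ℚ r * b ^ℚ r ≡ 1ℚ
^-inverse a b ab≡1 r = trans (sym (^-* a b r)) (trans (cong (_^ℚ r) ab≡1) (1^ r))

0≤vol : ∀ {r} (k : Vec ℕ r) → 0ℚ ℚ.≤ vol k
0≤vol []      = 0≤1
0≤vol (i ∷ k) = 0≤* (0≤ι i) (0≤vol k)

vol-≤ : ∀ {r} n (k : Vec ℕ r) → VAll (ℕ._≤ n) k → vol k ℚ.≤ ι n ^ℚ r
vol-≤ n []      []          = ℚₚ.≤-refl
vol-≤ n (i ∷ k) (i≤n ∷ k≤n) = *-mono (0≤ι i) (ι-mono i≤n) (0≤vol k) (vol-≤ n k k≤n)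

∣∣-sub : ∀ p q → ℚ.∣ p - q ∣ ℚ.≤ ℚ.∣ p ∣ + ℚ.∣ q ∣
∣∣-sub p q = ℚₚ.≤-trans (ℚₚ.∣p+q∣≤∣p∣+∣q∣ p (- q)) (ℚₚ.≤-reflexive (cong (ℚ.∣ p ∣ +_) (ℚₚ.∣-p∣≡∣p∣ q)))

inv-total-≤ : ∀ ρ n .{{_ : NonZero n}} → 1 ℕ.≤ ρ → inv (total (suc ρ) n) ℚ.≤ ι 4 * inv n ^ℚ suc ρ
inv-total-≤ ρ n 1≤ρ = begin
  u                       ≡⟨ ℚₚ.*-identityʳ u ⟨
  u * 1ℚ                  ≡⟨ cong (u *_) (^-inverse (ι n) (inv n) (ι*inv n) r) ⟨
  u * (N * w)             ≤⟨ *-monoʳ u (0≤inv (total r n)) (*-monoˡ w (0≤^ (0≤inv n) r) (total-≥ r n (ℕ.s≤s 1≤ρ))) ⟩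
  u * (ι 4 * T * w)       ≡⟨ solve 4 (λ u f t w → u :* (f :* t :* w) := t :* u :* (f :* w)) refl u (ι 4) T w ⟩
  T * u * (ι 4 * w)       ≡⟨ cong (_* (ι 4 * w)) (ι*inv (total r n) {{total-nonZero ρ n}}) ⟩
  1ℚ * (ι 4 * w)          ≡⟨ ℚₚ.*-identityˡ (ι 4 * w) ⟩
  ι 4 * w                 ∎
  where
  open ≤-Reasoning
  r : ℕ
  r = suc ρ
  u w N T : ℚ
  u = inv (total r n)
  w = inv n ^ℚ r
  N = ι n ^ℚ r
  T = ι (total r n)

-- With A ≈ cV and T ≈ cN, the difference A/T - V/N is (A - cV)/T minus (V/N)(T - cN)/T, in which c
-- cancels. As V/N ≤ 1, both terms are at most the error of `count-estimate` divided by T. Since 1/T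
-- ≤ 4/nʳ, the two together give the 8, and n^ρ/nʳ leaves one factor 1/n.
coprimeShare-close : ∀ {ρ} n .{{_ : NonZero n}} → 1 ℕ.≤ ρ → (k : Vec ℕ (suc ρ)) → VAll (ℕ._≤ n) k →
  ℚ.∣ coprimeShare n k - share n k ∣ ℚ.≤ ι 8 * (ι (suc ρ) * invPowerSum ρ n * inv n)
coprimeShare-close {ρ} n 1≤ρ k k≤n = begin
  ℚ.∣ A * u - V * w ∣
    ≡⟨ cong ℚ.∣_∣ eq ⟩
  ℚ.∣ (A - c * V) * u - (V * w * u) * (T - c * N) ∣
    ≤⟨ ∣∣-sub ((A - c * V) * u) ((V * w * u) * (T - c * N)) ⟩
  ℚ.∣ (A - c * V) * u ∣ + ℚ.∣ (V * w * u) * (T - c * N) ∣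
    ≡⟨ cong₂ _+_ (trans (ℚₚ.∣p*q∣≡∣p∣*∣q∣ (A - c * V) u) (cong (ℚ.∣ A - c * V ∣ *_) (ℚₚ.0≤p⇒∣p∣≡p 0≤u)))
                 (trans (ℚₚ.∣p*q∣≡∣p∣*∣q∣ (V * w * u) (T - c * N)) (cong (_* ℚ.∣ T - c * N ∣) (ℚₚ.0≤p⇒∣p∣≡p (0≤* 0≤Vw 0≤u)))) ⟩
  ℚ.∣ A - c * V ∣ * u + V * w * u * ℚ.∣ T - c * N ∣
    ≤⟨ ℚₚ.+-mono-≤ (*-monoˡ u 0≤u (count-estimate n k k≤n))
         (*-mono (0≤* 0≤Vw 0≤u) (ℚₚ.≤-trans (*-monoˡ u 0≤u Vw≤1) (ℚₚ.≤-reflexive (ℚₚ.*-identityˡ u)))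
           (ℚₚ.0≤∣p∣ (T - c * N)) (subst (λ t → ℚ.∣ T - c * t ∣ ℚ.≤ E₀) (vol-replicate r n)
             (count-estimate n (replicate r n) (all-≤-replicate r n)))) ⟩
  E₀ * u + u * E₀
    ≤⟨ ℚₚ.+-mono-≤ (*-monoʳ E₀ 0≤E (inv-total-≤ ρ n 1≤ρ)) (*-monoˡ E₀ 0≤E (inv-total-≤ ρ n 1≤ρ)) ⟩
  E₀ * (ι 4 * w) + (ι 4 * w) * E₀
    ≡⟨ solve 6 (λ r p s f i q → r :* p :* s :* (f :* (i :* q)) :+ f :* (i :* q) :* (r :* p :* s) :=
                                (f :+ f) :* (r :* s :* i :* (p :* q))) refl
         (ι r) (ι n ^ℚ ρ) (invPowerSum ρ n) (ι 4) (inv n) (inv n ^ℚ ρ) ⟩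
  (ι 4 + ι 4) * (ι r * invPowerSum ρ n * inv n * (ι n ^ℚ ρ * inv n ^ℚ ρ))
    ≡⟨ cong₂ (λ a b → a * (ι r * invPowerSum ρ n * inv n * b)) (sym (ι-+ 4 4)) (^-inverse (ι n) (inv n) (ι*inv n) ρ) ⟩
  ι 8 * (ι r * invPowerSum ρ n * inv n * 1ℚ)
    ≡⟨ cong (ι 8 *_) (ℚₚ.*-identityʳ _) ⟩
  ι 8 * (ι r * invPowerSum ρ n * inv n) ∎
  where
  open ≤-Reasoning
  r : ℕ
  r = suc ρ
  A V c u w N T E₀ : ℚ
  A = ι (count k)
  V = vol k
  c = density r n
  u = inv (total r n)
  w = inv n ^ℚ r
  N = ι n ^ℚ r
  T = ι (total r n)
  E₀ = ι r * ι n ^ℚ ρ * invPowerSum ρ n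
  0≤u : 0ℚ ℚ.≤ u
  0≤u = 0≤inv (total r n)
  0≤Vw : 0ℚ ℚ.≤ V * w
  0≤Vw = 0≤* (0≤vol k) (0≤^ (0≤inv n) r)
  0≤E : 0ℚ ℚ.≤ E₀
  0≤E = ℚₚ.≤-trans (ℚₚ.0≤∣p∣ (A - c * V)) (count-estimate n k k≤n)
  Nw≡1 : N * w ≡ 1ℚ
  Nw≡1 = ^-inverse (ι n) (inv n) (ι*inv n) r
  Vw≤1 : V * w ℚ.≤ 1ℚ
  Vw≤1 = ℚₚ.≤-trans (*-monoˡ w (0≤^ (0≤inv n) r) (vol-≤ n k k≤n)) (ℚₚ.≤-reflexive Nw≡1)
  Tu≡1 : T * u ≡ 1ℚ
  Tu≡1 = ι*inv (total r n) {{total-nonZero ρ n}}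
  eq : A * u - V * w ≡ (A - c * V) * u - (V * w * u) * (T - c * N)
  -- Neutral occurrences of 1 are inserted so that one of them can become T·u and another N·w; the
  -- rest is a polynomial identity.
  eq = trans (trans
      (solve 5 (λ A V c u w → A :* u :- V :* w := A :* u :- V :* w :* con 1ℚ :+ c :* V :* u :* (con 1ℚ :- con 1ℚ)) refl A V c u w)
      (cong₂ (λ a b → A * u - V * w * a + c * V * u * (b - 1ℚ)) (sym Tu≡1) (sym Nw≡1)))
    (solve 7 (λ A V c u w N T → A :* u :- V :* w :* (T :* u) :+ c :* V :* u :* (N :* w :- con 1ℚ) :=
       (A :- c :* V) :* u :- (V :* w :* u) :* (T :- c :* N)) refl A V c u w N T)

-- `pred` lowers each coordinate by at most 1, a coordinate 0 staying put, so the volume drops by at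
-- most (ρ + 1)n^ρ before division by n^(ρ+1).
pred-share-close : ∀ {ρ} n .{{_ : NonZero n}} (k : Vec ℕ (suc ρ)) → VAll (ℕ._≤ n) k →
  share n k ℚ.≤ share n (Vec.map pred k) + ι (suc ρ) * inv n
pred-share-close {ρ} n k k≤n = begin
  vol k * w
    ≤⟨ *-monoˡ w (0≤^ (0≤inv n) (suc ρ)) (∏-close (λ i i≤n → ι-mono i≤n)
         (λ i → ℚₚ.≤-trans (ι-mono (i≤pred+1 i)) (ℚₚ.≤-reflexive (trans (ι-suc (pred i)) (ℚₚ.+-comm 1ℚ (ι (pred i)))))) k k≤n) ⟩
  (∏ℚ (Vec.map (ι ∘ pred) k) + ι (suc ρ) * ι n ^ℚ ρ) * w
    ≡⟨ solve 5 (λ v s p i q → (v :+ s :* p) :* (i :* q) := v :* (i :* q) :+ s :* i :* (p :* q)) refl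
         (∏ℚ (Vec.map (ι ∘ pred) k)) (ι (suc ρ)) (ι n ^ℚ ρ) (inv n) (inv n ^ℚ ρ) ⟩
  ∏ℚ (Vec.map (ι ∘ pred) k) * w + ι (suc ρ) * inv n * (ι n ^ℚ ρ * inv n ^ℚ ρ)
    ≡⟨ cong₂ (λ a b → ∏ℚ a * w + ι (suc ρ) * inv n * b) (Vecₚ.map-∘ ι pred k) (^-inverse (ι n) (inv n) (ι*inv n) ρ) ⟩
  share n (Vec.map pred k) + ι (suc ρ) * inv n * 1ℚ
    ≡⟨ cong (share n (Vec.map pred k) +_) (ℚₚ.*-identityʳ _) ⟩
  share n (Vec.map pred k) + ι (suc ρ) * inv n ∎
  where
  open ≤-Reasoning
  w : ℚ
  w = inv n ^ℚ suc ρ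
  i≤pred+1 : ∀ i → i ℕ.≤ suc (pred i)
  i≤pred+1 zero    = ℕ.z≤n
  i≤pred+1 (suc i) = ℕₚ.≤-refl
  open Perturbation n (ι ∘ pred) ι (ι n) (λ i → 0≤ι (pred i)) (λ i → ι-mono ℕₚ.pred[n]≤n)

all-≤-pred : ∀ {r} n {k : Vec ℕ r} → VAll (ℕ._≤ n) k → VAll (ℕ._≤ n) (Vec.map pred k)
all-≤-pred n []          = []
all-≤-pred n (i≤n ∷ k≤n) = ℕₚ.≤-trans ℕₚ.pred[n]≤n i≤n ∷ all-≤-pred n k≤n

p≤∣p∣ : ∀ p → p ℚ.≤ ℚ.∣ p ∣
p≤∣p∣ p with ℚₚ.∣p∣≡p∨∣p∣≡-p p
... | inj₁ eq = ℚₚ.≤-reflexive (sym eq)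
... | inj₂ eq = ℚₚ.≤-trans p≤0 (ℚₚ.0≤∣p∣ p)
  where
  p≤0 : p ℚ.≤ 0ℚ
  p≤0 = ≤-by (- p) (subst (0ℚ ℚ.≤_) eq (ℚₚ.0≤∣p∣ p)) (sym (ℚₚ.+-inverseʳ p))

-- The deviation at α = k/n, and its limit as α increases to k/n.
excess deficit : ∀ {r} → ℕ → Vec ℕ r → ℚ
excess  n k = coprimeShare n k - share n k
deficit n k = share n k - coprimeShare n (Vec.map pred k)

-- The 9 is the 8 of `coprimeShare-close` plus 1 for the shift by `pred` inside `deficit`.
bound : ℕ → ℕ → ℚ
bound ρ n = ι 9 * (ι (suc ρ) * invPowerSum ρ n * inv n)

module _ {ρ} (n : ℕ) .{{_ : NonZero n}} (1≤ρ : 1 ℕ.≤ ρ) (k : Vec ℕ (suc ρ)) (k≤n : VAll (ℕ._≤ n) k) where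

  private
    X : ℚ
    X = ι (suc ρ) * invPowerSum ρ n * inv n

    1≤S : 1ℚ ℚ.≤ invPowerSum ρ n
    1≤S = subst (λ m → 1ℚ ℚ.≤ invPowerSum ρ m) (ℕₚ.suc-pred n) (1≤invPowerSum ρ (pred n))

    ιr/n≤X : ι (suc ρ) * inv n ℚ.≤ X
    ιr/n≤X = *-monoˡ (inv n) (0≤inv n) (ℚₚ.≤-trans (ℚₚ.≤-reflexive (sym (ℚₚ.*-identityʳ (ι (suc ρ)))))
      (*-monoʳ (ι (suc ρ)) (0≤ι (suc ρ)) 1≤S))

    0≤X : 0ℚ ℚ.≤ X
    0≤X = ℚₚ.≤-trans (0≤* (0≤ι (suc ρ)) (0≤inv n)) ιr/n≤X

    9X : bound ρ n ≡ X + ι 8 * X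
    9X = trans (cong (_* X) (ι-suc 8)) (trans (ℚₚ.*-distribʳ-+ X 1ℚ (ι 8)) (cong (_+ ι 8 * X) (ℚₚ.*-identityˡ X)))

  excess-≤ : excess n k ℚ.≤ bound ρ n
  excess-≤ = begin
    excess n k         ≤⟨ p≤∣p∣ (excess n k) ⟩
    ℚ.∣ excess n k ∣   ≤⟨ coprimeShare-close n 1≤ρ k k≤n ⟩
    ι 8 * X            ≤⟨ ≤-by X 0≤X (trans 9X (ℚₚ.+-comm X (ι 8 * X))) ⟩
    bound ρ n          ∎
    where open ≤-Reasoning

  deficit-≤ : deficit n k ℚ.≤ bound ρ n
  deficit-≤ = begin
    share n k - coprimeShare n k′
      ≤⟨ ℚₚ.+-monoˡ-≤ (- coprimeShare n k′) (pred-share-close n k k≤n) ⟩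
    share n k′ + ι (suc ρ) * inv n - coprimeShare n k′
      ≡⟨ solve 3 (λ s y c → s :+ y :- c := y :+ :- (c :- s)) refl (share n k′) (ι (suc ρ) * inv n) (coprimeShare n k′) ⟩
    ι (suc ρ) * inv n + - (coprimeShare n k′ - share n k′)
      ≤⟨ ℚₚ.+-mono-≤ ιr/n≤X (ℚₚ.≤-trans (p≤∣p∣ (- (coprimeShare n k′ - share n k′)))
           (ℚₚ.≤-trans (ℚₚ.≤-reflexive (ℚₚ.∣-p∣≡∣p∣ (coprimeShare n k′ - share n k′)))
             (coprimeShare-close n 1≤ρ k′ (all-≤-pred n k≤n)))) ⟩
    X + ι 8 * X
      ≡⟨ 9X ⟨
    bound ρ n ∎
    where
    open ≤-Reasoning
    k′ : Vec ℕ (suc ρ)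
    k′ = Vec.map pred k

-- Tuples with first entry 1 are all coprime, so the box below (1,n,…,n) has too many of them.
excess-≥ : ∀ ρ n .{{_ : NonZero n}} → 2 ℕ.≤ n → inv 3 ^ℚ suc ρ * inv n ℚ.≤ excess n (1 ∷ replicate ρ n)
excess-≥ ρ n 2≤n = begin
  -- Read from the end, the excess is P·u - 1/n = (N - T)·u/n. The even tuples give N - T ≥ N·t, and
  -- N·u ≥ T·u = 1.
  t * inv n
    ≡⟨ solve 3 (λ t i a → t :* i := (t :* i) :* con 1ℚ) refl t (inv n) u ⟩
  t * inv n * 1ℚ
    ≡⟨ cong (t * inv n *_) Tu≡1 ⟨
  t * inv n * (T * u)
    ≤⟨ *-monoʳ (t * inv n) (0≤* (0≤^ (0≤inv 3) r) (0≤inv n)) (*-monoˡ u (0≤inv (total r n)) T≤N) ⟩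
  t * inv n * (N * u)
    ≡⟨ solve 4 (λ t i N u → t :* i :* (N :* u) := (N :* t) :* u :* i) refl t (inv n) N u ⟩
  N * t * u * inv n
    ≤⟨ *-monoˡ (inv n) (0≤inv n) (*-monoˡ u (0≤inv (total r n)) Nt≤N-T) ⟩
  (N - T) * u * inv n
    ≡⟨ solve 5 (λ m p T u i → (m :* p :- T) :* u :* i := (p :* u) :* (m :* i) :- T :* u :* i) refl (ι n) P T u (inv n) ⟩
  P * u * (ι n * inv n) - T * u * inv n
    ≡⟨ cong₂ (λ a b → P * u * a - b * inv n) (ι*inv n) Tu≡1 ⟩
  P * u * 1ℚ - 1ℚ * inv n
    ≡⟨ cong (λ b → P * u * 1ℚ - b * inv n) (^-inverse (ι n) (inv n) (ι*inv n) ρ) ⟨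
  P * u * 1ℚ - P * inv n ^ℚ ρ * inv n
    ≡⟨ solve 4 (λ p u q i → p :* u :* con 1ℚ :- p :* q :* i := p :* u :- con 1ℚ :* p :* (i :* q)) refl P u (inv n ^ℚ ρ) (inv n) ⟩
  P * u - 1ℚ * P * (inv n * inv n ^ℚ ρ)
    ≡⟨ cong₂ (λ a b → a * u - b * P * (inv n * inv n ^ℚ ρ)) (trans (count-1∷ (replicate ρ n)) (vol-replicate ρ n)) ι-1 ⟨
  ι (count (1 ∷ replicate ρ n)) * u - ι 1 * P * (inv n * inv n ^ℚ ρ)
    ≡⟨ cong (λ a → coprimeShare n (1 ∷ replicate ρ n) - ι 1 * a * inv n ^ℚ suc ρ) (vol-replicate ρ n) ⟨
  excess n (1 ∷ replicate ρ n) ∎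
  where
  open ≤-Reasoning
  r : ℕ
  r = suc ρ
  t u N P T : ℚ
  t = inv 3 ^ℚ r
  u = inv (total r n)
  N = ι n ^ℚ r
  P = ι n ^ℚ ρ
  T = ι (total r n)
  Tu≡1 : T * u ≡ 1ℚ
  Tu≡1 = ι*inv (total r n) {{total-nonZero ρ n}}
  T+Nt≤N : T + N * t ℚ.≤ N
  T+Nt≤N = subst (λ x → T + x ℚ.≤ N) (^-* (ι n) (inv 3) r) (total-≤ r n 2≤n)
  0≤Nt : 0ℚ ℚ.≤ N * t
  0≤Nt = 0≤* (0≤^ (0≤ι n) r) (0≤^ (0≤inv 3) r)
  T≤N : T ℚ.≤ N
  T≤N = ℚₚ.≤-trans (≤-by (N * t) 0≤Nt refl) T+Nt≤N
  Nt≤N-T : N * t ℚ.≤ N - T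
  Nt≤N-T = ≤-by (N - (T + N * t)) (0≤-diff T+Nt≤N)
    (solve 3 (λ x T N → N :- T := x :+ (N :- (T :+ x))) refl (N * t) T N)

-- The lower bound at n = 1, where no tuple in the box has even entries: as α increases to 𝟏 nothing
-- is counted, while |α| tends to 1.
deficit-1 : ∀ ρ → deficit 1 (replicate (suc ρ) 1) ≡ 1ℚ
deficit-1 ρ = begin
  vol (replicate r 1) * inv 1 ^ℚ r - ι 0 * inv (total r 1)
    ≡⟨ cong₂ (λ a b → a * inv 1 ^ℚ r - b * inv (total r 1)) (vol-replicate r 1) ι-0 ⟩
  ι 1 ^ℚ r * inv 1 ^ℚ r - 0ℚ * inv (total r 1)
    ≡⟨ cong₂ _-_ (^-inverse (ι 1) (inv 1) (ι*inv 1) r) (ℚₚ.*-zeroˡ (inv (total r 1))) ⟩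
  1ℚ ∎
  where
  open ≡-Reasoning
  r : ℕ
  r = suc ρ

-- Order and products of Cauchy reals

Eventually : (ℕ → Set) → Set
Eventually P = ∃[ N ] ∀ m → N ℕ.≤ m → P m

always : ∀ {P : ℕ → Set} → (∀ m → P m) → Eventually P
always h = 0 , λ m _ → h m

module _ {P Q : ℕ → Set} where

  eventually-map : (∀ m → P m → Q m) → Eventually P → Eventually Q
  eventually-map f (N , p) = N , λ m N≤m → f m (p m N≤m)

  eventually-× : Eventually P → Eventually Q → Eventually (λ m → P m × Q m)
  eventually-× (M , p) (N , q) = M ℕ.⊔ N , λ m h →
    p m (ℕₚ.m⊔n≤o⇒m≤o M N h) , q m (ℕₚ.m⊔n≤o⇒n≤o M N h)

1/8 : ℚ
1/8 = ℤ.+ 1 / 8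

∣p-q∣≤⇒p≤q+ : ∀ {p q η} → ℚ.∣ p - q ∣ ℚ.≤ η → p ℚ.≤ q + η
∣p-q∣≤⇒p≤q+ {p} {q} {η} h = begin
  p            ≡⟨ solve 2 (λ p q → p := q :+ (p :- q)) refl p q ⟩
  q + (p - q)  ≤⟨ ℚₚ.+-monoʳ-≤ q (ℚₚ.≤-trans (p≤∣p∣ (p - q)) h) ⟩
  q + η        ∎
  where open ≤-Reasoning

≤ℝ-refl : ∀ {x} → x ≤ℝ x
≤ℝ-refl {x} ε 0<ε = always λ m → ≤-by ε (ℚₚ.<⇒≤ 0<ε) refl

≤ℝ-trans : ∀ {x y z} → x ≤ℝ y → y ≤ℝ z → x ≤ℝ z
≤ℝ-trans {x} {y} {z} x≤y y≤z ε 0<ε = eventually-map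
  (λ m (p , q) → begin
    seq x m                        ≤⟨ p ⟩
    seq y m + ε * ½                ≤⟨ ℚₚ.+-monoˡ-≤ (ε * ½) q ⟩
    seq z m + ε * ½ + ε * ½        ≡⟨ trans (ℚₚ.+-assoc (seq z m) (ε * ½) (ε * ½)) (cong (seq z m +_) (halves ε)) ⟩
    seq z m + ε                    ∎)
  (eventually-× (x≤y (ε * ½) (half-pos ε 0<ε)) (y≤z (ε * ½) (half-pos ε 0<ε)))
  where open ≤-Reasoning

fromℚ-mono : ∀ {p q} → p ℚ.≤ q → fromℚ p ≤ℝ fromℚ q
fromℚ-mono {p} {q} p≤q ε 0<ε = always λ m → ℚₚ.≤-trans p≤q (≤-by ε (ℚₚ.<⇒≤ 0<ε) refl)

fromℚ-cancel : ∀ {p q} → fromℚ p ≤ℝ fromℚ q → p ℚ.≤ q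
fromℚ-cancel {p} {q} h with p ℚₚ.≤? q
... | yes p≤q = p≤q
... | no p≰q = contradiction (let N , g = h (d * ½) (half-pos d 0<d) in absurd (g N ℕₚ.≤-refl)) (ℚₚ.<-irrefl refl)
  where
  d : ℚ
  d = p - q
  0<d : 0ℚ ℚ.< d
  0<d = subst (ℚ._< d) (ℚₚ.+-inverseʳ q) (ℚₚ.+-monoˡ-< (- q) (ℚₚ.≰⇒> p≰q))
  absurd : p ℚ.≤ q + d * ½ → 0ℚ ℚ.< 0ℚ
  absurd p≤ = ℚₚ.<-≤-trans (half-pos d 0<d) (≤-by (q + d * ½ - p) (0≤-diff p≤)
    (solve 2 (λ p q → con 0ℚ := (p :- q) :* con ½ :+ (q :+ (p :- q) :* con ½ :- p)) refl p q))

-- A constructive substitute for trichotomy, with overlapping alternatives. Beyond a common index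
-- `K` both sequences stay within ε/8 of their `K`-th terms, so the decidable comparison of these
-- two rationals with margin ε/2 settles which alternative to give.
≤-or-<ℝ : ∀ x y ε → 0ℚ ℚ.< ε → Eventually (λ m → seq y m ℚ.≤ seq x m + ε) ⊎ x <ℝ y
≤-or-<ℝ x y ε 0<ε with cauchy x (ε * 1/8) 0<η | cauchy y (ε * 1/8) 0<η
  where
  0<η : 0ℚ ℚ.< ε * 1/8
  0<η = ℚₚ.positive⁻¹ _ {{ℚₚ.pos*pos⇒pos ε {{positive 0<ε}} 1/8}}
... | M , cx | N , cy = dichotomy (seq y K ℚₚ.≤? seq x K + ε * ½)
  where
  open ≤-Reasoning
  K : ℕ
  K = M ℕ.⊔ N
  η : ℚ
  η = ε * 1/8
  0<η : 0ℚ ℚ.< η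
  0<η = ℚₚ.positive⁻¹ _ {{ℚₚ.pos*pos⇒pos ε {{positive 0<ε}} 1/8}}
  near : ∀ z L → (∀ m n → L ℕ.≤ m → L ℕ.≤ n → ℚ.∣ seq z m - seq z n ∣ ℚ.≤ η) → L ℕ.≤ K → ∀ m → K ℕ.≤ m →
         seq z m ℚ.≤ seq z K + η × seq z K ℚ.≤ seq z m + η
  near z L c L≤K m K≤m = ∣p-q∣≤⇒p≤q+ (c m K (ℕₚ.≤-trans L≤K K≤m) L≤K) , ∣p-q∣≤⇒p≤q+ (c K m L≤K (ℕₚ.≤-trans L≤K K≤m))
  nearx : ∀ m → K ℕ.≤ m → seq x m ℚ.≤ seq x K + η × seq x K ℚ.≤ seq x m + η
  nearx = near x M cx (ℕₚ.m≤m⊔n M N)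
  neary : ∀ m → K ℕ.≤ m → seq y m ℚ.≤ seq y K + η × seq y K ℚ.≤ seq y m + η
  neary = near y N cy (ℕₚ.m≤n⊔m M N)
  dichotomy : Dec (seq y K ℚ.≤ seq x K + ε * ½) → Eventually (λ m → seq y m ℚ.≤ seq x m + ε) ⊎ x <ℝ y
  dichotomy (yes y≤x) = inj₁ (K , λ m K≤m → begin
    seq y m                            ≤⟨ proj₁ (neary m K≤m) ⟩
    seq y K + η                        ≤⟨ ℚₚ.+-monoˡ-≤ η y≤x ⟩
    seq x K + ε * ½ + η                ≤⟨ ℚₚ.+-monoˡ-≤ η (ℚₚ.+-monoˡ-≤ (ε * ½) (proj₂ (nearx m K≤m))) ⟩
    seq x m + η + ε * ½ + η            ≤⟨ ≤-by (η + η) (0≤+ (ℚₚ.<⇒≤ 0<η) (ℚₚ.<⇒≤ 0<η))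
      (solve 2 (λ x e → x :+ e := (x :+ e :* con 1/8 :+ e :* con ½ :+ e :* con 1/8) :+ (e :* con 1/8 :+ e :* con 1/8)) refl (seq x m) ε) ⟩
    seq x m + ε                        ∎)
  dichotomy (no y≰x) = inj₂ (η , 0<η , K , λ m K≤m → begin
    seq x m + η                        ≤⟨ ℚₚ.+-monoˡ-≤ η (proj₁ (nearx m K≤m)) ⟩
    seq x K + η + η                    ≤⟨ ≤-by η (ℚₚ.<⇒≤ 0<η) refl ⟩
    seq x K + η + η + η
      ≡⟨ solve 2 (λ x e → x :+ e :* con 1/8 :+ e :* con 1/8 :+ e :* con 1/8 := (x :+ e :* con ½) :- e :* con 1/8) refl (seq x K) ε ⟩
    seq x K + ε * ½ - η                ≤⟨ ℚₚ.+-monoˡ-≤ (- η) (ℚₚ.<⇒≤ (ℚₚ.≰⇒> y≰x)) ⟩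
    seq y K - η                        ≤⟨ ℚₚ.+-monoˡ-≤ (- η) (proj₂ (neary m K≤m)) ⟩
    seq y m + η - η                    ≡⟨ solve 2 (λ y e → y :+ e :- e := y) refl (seq y m) η ⟩
    seq y m                            ∎)

<ℝ⇒≤ℝ : ∀ {x y} → x <ℝ y → x ≤ℝ y
<ℝ⇒≤ℝ {x} {y} (η , 0<η , x<y) ε 0<ε = eventually-map {P = λ m → seq x m + η ℚ.≤ seq y m}
  (λ m x+η≤y → ℚₚ.≤-trans (≤-by η (ℚₚ.<⇒≤ 0<η) refl) (ℚₚ.≤-trans x+η≤y (≤-by ε (ℚₚ.<⇒≤ 0<ε) refl))) x<y

<ℝ⇒≱ℝ : ∀ {x y} → x <ℝ y → ¬ (y ≤ℝ x)
<ℝ⇒≱ℝ {x} {y} (η , 0<η , x<y) y≤x = ℚₚ.<-irrefl refl (ℚₚ.<-≤-trans (half-pos η 0<η)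
  (≤-by (b + η * ½ - (b + η)) (0≤-diff (ℚₚ.≤-trans (proj₁ (proj₂ both K ℕₚ.≤-refl)) (proj₂ (proj₂ both K ℕₚ.≤-refl))))
    (solve 2 (λ b e → con 0ℚ := e :* con ½ :+ (b :+ e :* con ½ :- (b :+ e))) refl b η)))
  where
  both : Eventually (λ m → seq x m + η ℚ.≤ seq y m × seq y m ℚ.≤ seq x m + η * ½)
  both = eventually-× x<y (y≤x (η * ½) (half-pos η 0<η))
  K : ℕ
  K = proj₁ both
  b : ℚ
  b = seq x K

≰ℝ⇒≥ℝ : ∀ {x y} → ¬ (x ≤ℝ y) → y ≤ℝ x
≰ℝ⇒≥ℝ {x} {y} x≰y ε 0<ε with ≤-or-<ℝ x y ε 0<ε
... | inj₁ y≤x = y≤x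
... | inj₂ x<y = contradiction (<ℝ⇒≤ℝ {x} {y} x<y) x≰y

-- For each ε separately, `≤-or-<ℝ` yields either the required estimate or `y <ℝ x`, and the latter
-- refutes `x ≤ℝ y`.
≤ℝ-stable : ∀ {x y} → ¬ ¬ (x ≤ℝ y) → x ≤ℝ y
≤ℝ-stable {x} {y} ¬¬x≤y ε 0<ε with ≤-or-<ℝ y x ε 0<ε
... | inj₁ x≤y = x≤y
... | inj₂ y<x = contradiction (<ℝ⇒≱ℝ {y} {x} y<x) ¬¬x≤y

-- Takes the place of rewriting: reals with the same terms may carry different Cauchy proofs and so
-- need not be equal as records.
≤ℝ-pointwise : ∀ {x y x′ y′} → (∀ m → seq x m ≡ seq x′ m) → (∀ m → seq y m ≡ seq y′ m) → x ≤ℝ y → x′ ≤ℝ y′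
≤ℝ-pointwise {x} {y} x≡ y≡ x≤y ε 0<ε = eventually-map {P = λ m → seq x m ℚ.≤ seq y m + ε}
  (λ m → subst₂ (λ a b → a ℚ.≤ b + ε) (x≡ m) (y≡ m)) (x≤y ε 0<ε)

-- A nonnegative real has terms that are only eventually at least -δ, so `a` may be slightly
-- negative. In that case |a| ≤ δ, and the reversed inequality costs at most δ(B + C).
*-mono-approx : ∀ a b c {A B C δ} → 0ℚ ℚ.≤ δ → ℚ.∣ a ∣ ℚ.≤ A → ℚ.∣ b ∣ ℚ.≤ B → ℚ.∣ c ∣ ℚ.≤ C →
                0ℚ ℚ.≤ a + δ → b ℚ.≤ c + δ → a * b ℚ.≤ a * c + (A * δ + δ * (B + C))
*-mono-approx a b c {A} {B} {C} {δ} 0≤δ ∣a∣≤A ∣b∣≤B ∣c∣≤C 0≤a+δ b≤c+δ with ℚₚ.≤-total 0ℚ a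
... | inj₁ 0≤a = begin
  a * b                            ≤⟨ *-monoʳ a 0≤a b≤c+δ ⟩
  a * (c + δ)                      ≡⟨ ℚₚ.*-distribˡ-+ a c δ ⟩
  a * c + a * δ                    ≤⟨ ℚₚ.+-monoʳ-≤ (a * c) (*-monoˡ δ 0≤δ (ℚₚ.≤-trans (p≤∣p∣ a) ∣a∣≤A)) ⟩
  a * c + A * δ                    ≤⟨ ≤-by (δ * (B + C)) (0≤* 0≤δ 0≤B+C) (sym (ℚₚ.+-assoc (a * c) (A * δ) (δ * (B + C)))) ⟩
  a * c + (A * δ + δ * (B + C))    ∎
  where
  open ≤-Reasoning
  0≤B+C : 0ℚ ℚ.≤ B + C
  0≤B+C = 0≤+ (ℚₚ.≤-trans (ℚₚ.0≤∣p∣ b) ∣b∣≤B) (ℚₚ.≤-trans (ℚₚ.0≤∣p∣ c) ∣c∣≤C)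
... | inj₂ a≤0 = begin
  a * b                            ≡⟨ solve 3 (λ a b c → a :* b := a :* c :+ (:- a) :* (c :- b)) refl a b c ⟩
  a * c + (- a) * (c - b)          ≤⟨ ℚₚ.+-monoʳ-≤ (a * c) (ℚₚ.≤-trans (*-monoʳ (- a) 0≤-a c-b≤) (*-monoˡ (B + C) 0≤B+C -a≤δ)) ⟩
  a * c + δ * (B + C)              ≤⟨ ≤-by (A * δ) (0≤* (ℚₚ.≤-trans (ℚₚ.0≤∣p∣ a) ∣a∣≤A) 0≤δ)
    (solve 3 (λ x y z → x :+ (y :+ z) := x :+ z :+ y) refl (a * c) (A * δ) (δ * (B + C))) ⟩
  a * c + (A * δ + δ * (B + C))    ∎
  where
  open ≤-Reasoning
  0≤B+C : 0ℚ ℚ.≤ B + C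
  0≤B+C = 0≤+ (ℚₚ.≤-trans (ℚₚ.0≤∣p∣ b) ∣b∣≤B) (ℚₚ.≤-trans (ℚₚ.0≤∣p∣ c) ∣c∣≤C)
  0≤-a : 0ℚ ℚ.≤ - a
  0≤-a = ℚₚ.neg-antimono-≤ a≤0
  -a≤δ : - a ℚ.≤ δ
  -a≤δ = ≤-by (a + δ) 0≤a+δ (solve 2 (λ a d → d := :- a :+ (a :+ d)) refl a δ)
  c-b≤ : c - b ℚ.≤ B + C
  c-b≤ = ℚₚ.≤-trans (ℚₚ.≤-reflexive (ℚₚ.+-comm c (- b)))
    (ℚₚ.+-mono-≤ (ℚₚ.≤-trans (p≤∣p∣ (- b)) (ℚₚ.≤-trans (ℚₚ.≤-reflexive (ℚₚ.∣-p∣≡∣p∣ b)) ∣b∣≤B))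
                 (ℚₚ.≤-trans (p≤∣p∣ c) ∣c∣≤C))

*ℝ-monoʳ : ∀ z {x y} → 0ℝ ≤ℝ z → x ≤ℝ y → z *ℝ x ≤ℝ z *ℝ y
*ℝ-monoʳ z {x} {y} 0≤z x≤y ε 0<ε =
  let A , posA , evA = bounded z
      B , posB , evB = bounded x
      C , posC , evC = bounded y
      δ , 0<δ , eq   = rescale A (B + C) posA (ℚₚ.pos+pos⇒pos B {{posB}} C {{posC}}) ε 0<ε
  in eventually-map
       (λ m (((a , b) , c) , 0≤z+δ , x≤y+δ) → subst (λ t → seq z m * seq x m ℚ.≤ seq z m * seq y m + t) eq
         (*-mono-approx (seq z m) (seq x m) (seq y m) (ℚₚ.<⇒≤ 0<δ) a b c 0≤z+δ x≤y+δ))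
       (eventually-× (eventually-× (eventually-× evA evB) evC) (eventually-× (0≤z δ 0<δ) (x≤y δ 0<δ)))

*ℝ-mono : ∀ {x y z w} → 0ℝ ≤ℝ x → x ≤ℝ y → 0ℝ ≤ℝ w → z ≤ℝ w → x *ℝ z ≤ℝ y *ℝ w
*ℝ-mono {x} {y} {z} {w} 0≤x x≤y 0≤w z≤w = ≤ℝ-trans {x *ℝ z} {x *ℝ w} {y *ℝ w} (*ℝ-monoʳ x {z} {w} 0≤x z≤w)
  (≤ℝ-pointwise {w *ℝ x} {w *ℝ y} {x *ℝ w} {y *ℝ w}
    (λ m → ℚₚ.*-comm (seq w m) (seq x m)) (λ m → ℚₚ.*-comm (seq w m) (seq y m))
    (*ℝ-monoʳ w {x} {y} 0≤w x≤y))

0≤*ℝ : ∀ {x y} → 0ℝ ≤ℝ x → 0ℝ ≤ℝ y → 0ℝ ≤ℝ x *ℝ y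
0≤*ℝ {x} {y} 0≤x 0≤y = ≤ℝ-pointwise {x *ℝ 0ℝ} {x *ℝ y} {0ℝ} {x *ℝ y}
  (λ m → ℚₚ.*-zeroʳ (seq x m)) (λ _ → refl) (*ℝ-monoʳ x {0ℝ} {y} 0≤x 0≤y)

0≤∏ℝ : ∀ {r} (α : Vec ℝ r) → (∀ j → 0ℝ ≤ℝ lookup α j) → 0ℝ ≤ℝ ∏ α
0≤∏ℝ []      0≤α = fromℚ-mono 0≤1
0≤∏ℝ (x ∷ α) 0≤α = 0≤*ℝ {x} {∏ α} (0≤α zero) (0≤∏ℝ α (0≤α ∘ suc))

∏ℝ-mono : ∀ {r} (α β : Vec ℝ r) → (∀ j → 0ℝ ≤ℝ lookup α j) → (∀ j → lookup α j ≤ℝ lookup β j) → ∏ α ≤ℝ ∏ β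
∏ℝ-mono []      []      _   _   = ≤ℝ-refl {1ℝ}
∏ℝ-mono (x ∷ α) (y ∷ β) 0≤α α≤β = *ℝ-mono {x} {y} {∏ α} {∏ β} (0≤α zero) (α≤β zero)
  (0≤∏ℝ β (λ j → ≤ℝ-trans {0ℝ} {lookup α j} {lookup β j} (0≤α (suc j)) (α≤β (suc j))))
  (∏ℝ-mono α β (0≤α ∘ suc) (α≤β ∘ suc))

∏ℝ-fromℚ : ∀ {r} (β : Vec ℚ r) m → seq (∏ (Vec.map fromℚ β)) m ≡ ∏ℚ β
∏ℝ-fromℚ []      m = refl
∏ℝ-fromℚ (b ∷ β) m = cong (b *_) (∏ℝ-fromℚ β m)

fromℕ≡ : ∀ n → fromℕ n ≡ fromℚ (ι n)
fromℕ≡ n = cong fromℚ (sym (ι-def n))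

-- The supremum as a finite maximum

bernoulli : ∀ {δ} → 0ℚ ℚ.≤ δ → δ ℚ.≤ 1ℚ → ∀ r → 1ℚ - ι r * δ ℚ.≤ (1ℚ - δ) ^ℚ r
bernoulli {δ} 0≤δ δ≤1 zero = ℚₚ.≤-reflexive (trans (cong (λ t → 1ℚ - t * δ) ι-0)
  (solve 1 (λ d → con 1ℚ :- con 0ℚ :* d := con 1ℚ) refl δ))
bernoulli {δ} 0≤δ δ≤1 (suc r) = begin
  1ℚ - ι (suc r) * δ
    ≡⟨ cong (λ t → 1ℚ - t * δ) (ι-suc r) ⟩
  1ℚ - (1ℚ + ι r) * δ
    ≤⟨ ≤-by (ι r * (δ * δ)) (0≤* (0≤ι r) (0≤* 0≤δ 0≤δ))
         (solve 2 (λ r d → (con 1ℚ :- d) :* (con 1ℚ :- r :* d) := con 1ℚ :- (con 1ℚ :+ r) :* d :+ r :* (d :* d)) refl (ι r) δ) ⟩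
  (1ℚ - δ) * (1ℚ - ι r * δ)
    ≤⟨ *-monoʳ (1ℚ - δ) (0≤-diff δ≤1) (bernoulli 0≤δ δ≤1 r) ⟩
  (1ℚ - δ) ^ℚ suc r ∎
  where open ≤-Reasoning

fromℕ-mono : ∀ {a b} → a ≤ b → fromℕ a ≤ℝ fromℕ b
fromℕ-mono {a} {b} a≤b = subst₂ _≤ℝ_ (sym (fromℕ≡ a)) (sym (fromℕ≡ b)) (fromℚ-mono (ι-mono a≤b))

-- The integer parts by their universal property among the naturals, which is all that the condition
-- in `F` sees of `α`.
HasFloors : ∀ {r} → ℕ → Vec ℝ r → Vec ℕ r → Set
HasFloors n α b = ∀ j x → fromℕ x ≤ℝ fromℕ n *ℝ lookup α j ⇔ x ℕ.≤ lookup b j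

floors⇒F : ∀ {r n} {α : Vec ℝ r} {b} → HasFloors n α b → F r n α (count b)
floors⇒F {b = b} h = coprimes b , coprimes-unique b , (λ x → mk⇔
    (λ x∈ → let 𝒞x , x≤b = Equivalence.to (∈-coprimes b x) x∈ in 𝒞x , λ j → Equivalence.from (h j (lookup x j)) (x≤b j))
    (λ (𝒞x , x≤nα) → Equivalence.from (∈-coprimes b x) (𝒞x , λ j → Equivalence.to (h j (lookup x j)) (x≤nα j))))
  , refl

cardinality-≤ : ∀ {A : Set} {P : A → Set} {a b} → HasCardinality P a → HasCardinality P b → a ℕ.≤ b
cardinality-≤ (xs , uxs , x∈⇔ , refl) (ys , _ , y∈⇔ , refl) =
  unique-⊆-length uxs (λ {x} x∈ → Equivalence.from (y∈⇔ x) (Equivalence.to (x∈⇔ x) x∈))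

cardinality-unique : ∀ {A : Set} {P : A → Set} {a b} → HasCardinality P a → HasCardinality P b → a ≡ b
cardinality-unique h h′ = ℕₚ.≤-antisym (cardinality-≤ h h′) (cardinality-≤ h′ h)

fromℕ-*-floor : ∀ n β b → (∀ x → ι x ℚ.≤ ι n * β ⇔ x ℕ.≤ b) →
                ∀ x → fromℕ x ≤ℝ fromℕ n *ℝ fromℚ β ⇔ x ℕ.≤ b
fromℕ-*-floor n β b h x = subst (λ t → t ⇔ x ℕ.≤ b) (sym type≡)
  (mk⇔ (Equivalence.to (h x) ∘ cancel) (mono ∘ Equivalence.from (h x)))
  where
  type≡ : (fromℕ x ≤ℝ fromℕ n *ℝ fromℚ β) ≡ (fromℚ (ι x) ≤ℝ fromℚ (ι n) *ℝ fromℚ β)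
  type≡ = cong₂ (λ s t → s ≤ℝ t *ℝ fromℚ β) (fromℕ≡ x) (fromℕ≡ n)
  cancel : fromℚ (ι x) ≤ℝ fromℚ (ι n) *ℝ fromℚ β → ι x ℚ.≤ ι n * β
  cancel p = fromℚ-cancel (≤ℝ-pointwise {fromℚ (ι x)} {fromℚ (ι n) *ℝ fromℚ β} {fromℚ (ι x)} {fromℚ (ι n * β)}
    (λ _ → refl) (λ _ → refl) p)
  mono : ι x ℚ.≤ ι n * β → fromℚ (ι x) ≤ℝ fromℚ (ι n) *ℝ fromℚ β
  mono p = ≤ℝ-pointwise {fromℚ (ι x)} {fromℚ (ι n * β)} {fromℚ (ι x)} {fromℚ (ι n) *ℝ fromℚ β}
    (λ _ → refl) (λ _ → refl) (fromℚ-mono p)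

ι-*1-floor : ∀ n x → ι x ℚ.≤ ι n * 1ℚ ⇔ x ℕ.≤ n
ι-*1-floor n x = mk⇔ (λ p → ι-cancel (subst (ι x ℚ.≤_) (ℚₚ.*-identityʳ (ι n)) p))
                     (λ p → subst (ι x ℚ.≤_) (sym (ℚₚ.*-identityʳ (ι n))) (ι-mono p))

F[n,𝟏] : ∀ r n → F r n (𝟏 r) (total r n)
F[n,𝟏] r n = floors⇒F {r} {n} {𝟏 r} {replicate r n} λ j x → subst₂ (λ s t → fromℕ x ≤ℝ fromℕ n *ℝ s ⇔ x ℕ.≤ t)
  (sym (Vecₚ.lookup-replicate j 1ℝ)) (sym (Vecₚ.lookup-replicate j n))
  (fromℕ-*-floor n 1ℚ n (ι-*1-floor n) x)

-- Samples at and just below grid points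

-- The point α with αⱼ = β kⱼ, for which ⌊n αⱼ⌋ = b kⱼ.
record RationalPoint (n r : ℕ) : Set where
  field
    β         : ℕ → ℚ
    b         : ℕ → ℕ
    k         : Vec ℕ r
    β≥0       : ∀ j → 0ℚ ℚ.≤ β (lookup k j)
    β≤1       : ∀ j → β (lookup k j) ℚ.≤ 1ℚ
    floor     : ∀ j x → ι x ℚ.≤ ι n * β (lookup k j) ⇔ x ℕ.≤ b (lookup k j)

module _ {ρ n : ℕ} .{{_ : NonZero n}} (p : RationalPoint n (suc ρ)) where
  open RationalPoint p

  private
    α : Vec ℝ (suc ρ)
    α = Vec.map fromℚ (Vec.map β k)

    lookup-α : ∀ j → lookup α j ≡ fromℚ (β (lookup k j))
    lookup-α j = trans (Vecₚ.lookup-map j fromℚ (Vec.map β k)) (cong fromℚ (Vecₚ.lookup-map j β k))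

  sampleAt : Sample (suc ρ) n
  sampleAt = record
    { α         = α
    ; α≥0       = λ j → subst (0ℝ ≤ℝ_) (sym (lookup-α j)) (fromℚ-mono (β≥0 j))
    ; α≤1       = λ j → subst (_≤ℝ 1ℝ) (sym (lookup-α j)) (fromℚ-mono (β≤1 j))
    ; Fα        = count (Vec.map b k)
    ; F𝟏        = total (suc ρ) n
    ; F[n,α]≡Fα = floors⇒F {suc ρ} {n} {α} {Vec.map b k} λ j x →
        subst₂ (λ s t → fromℕ x ≤ℝ fromℕ n *ℝ s ⇔ x ℕ.≤ t) (sym (lookup-α j)) (sym (Vecₚ.lookup-map j b k))
          (fromℕ-*-floor n (β (lookup k j)) (b (lookup k j)) (floor j) x)
    ; F[n,𝟏]≡F𝟏 = F[n,𝟏] (suc ρ) n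
    ; F𝟏≢0      = total-nonZero ρ n
    }

  deviation-sampleAt : ∀ m → seq (deviation sampleAt) m ≡ ℚ.∣ coprimeShare n (Vec.map b k) - ∏ℚ (Vec.map β k) ∣
  deviation-sampleAt m = cong₂ (λ s t → ℚ.∣ s - t ∣)
    (/≡ι*inv (count (Vec.map b k)) (total (suc ρ) n) {{total-nonZero ρ n}}) (∏ℝ-fromℚ (Vec.map β k) m)

lookup-all : ∀ {r} {P : ℕ → Set} {k : Vec ℕ r} → VAll P k → ∀ j → P (lookup k j)
lookup-all (p ∷ _)  zero    = p
lookup-all (_ ∷ ps) (suc j) = lookup-all ps j

tabulate-all : ∀ {r} {P : ℕ → Set} (k : Vec ℕ r) → (∀ j → P (lookup k j)) → VAll P k
tabulate-all []      h = []
tabulate-all (_ ∷ k) h = h zero ∷ tabulate-all k (h ∘ suc)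

n*[i/n] : ∀ n .{{_ : NonZero n}} i → ι n * (ι i * inv n) ≡ ι i
n*[i/n] n i = trans (solve 3 (λ n i v → n :* (i :* v) := i :* (n :* v)) refl (ι n) (ι i) (inv n))
  (trans (cong (ι i *_) (ι*inv n)) (ℚₚ.*-identityʳ (ι i)))

i/n≤1 : ∀ n .{{_ : NonZero n}} {i} → i ℕ.≤ n → ι i * inv n ℚ.≤ 1ℚ
i/n≤1 n i≤n = ℚₚ.≤-trans (*-monoˡ (inv n) (0≤inv n) (ι-mono i≤n)) (ℚₚ.≤-reflexive (ι*inv n))

module _ {ρ} (n : ℕ) .{{_ : NonZero n}} (k : Vec ℕ (suc ρ)) (k≤n : VAll (ℕ._≤ n) k) where

  cornerPoint : RationalPoint n (suc ρ)
  cornerPoint = record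
    { β     = λ i → ι i * inv n
    ; b     = λ i → i
    ; k     = k
    ; β≥0   = λ j → 0≤* (0≤ι (lookup k j)) (0≤inv n)
    ; β≤1   = λ j → i/n≤1 n (lookup-all k≤n j)
    ; floor = λ j x → mk⇔ (λ p → ι-cancel (subst (ι x ℚ.≤_) (n*[i/n] n (lookup k j)) p))
                          (λ p → subst (ι x ℚ.≤_) (sym (n*[i/n] n (lookup k j))) (ι-mono p))
    }

  excess-≤-deviation : ∀ m → excess n k ℚ.≤ seq (deviation (sampleAt cornerPoint)) m
  excess-≤-deviation m = ℚₚ.≤-trans (p≤∣p∣ (excess n k)) (ℚₚ.≤-reflexive (sym (trans
    (deviation-sampleAt cornerPoint m)
    (cong₂ (λ s t → ℚ.∣ coprimeShare n s - t ∣) (Vecₚ.map-id k) (∏ℚ-scale ι (inv n) k)))))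

  module _ (m : ℕ) (n≤m : n ℕ.≤ m) where

    private
      δ : ℚ
      δ = inv (suc m)

      0≤1-δ : 0ℚ ℚ.≤ 1ℚ - δ
      0≤1-δ = 0≤-diff (inv≤1 (suc m))

      β : ℕ → ℚ
      β i = ι i * inv n * (1ℚ - δ)

      -- Clears the denominators, so that the floor of n·β i becomes a matter of natural numbers.
      [1+m]β : ∀ i → ι (suc m) * (ι n * β i) ≡ ι (i ℕ.* m)
      [1+m]β i = trans
        (solve 5 (λ s n i v d → s :* (n :* (i :* v :* (con 1ℚ :- d))) := n :* (i :* v) :* (s :- s :* d)) refl
          (ι (suc m)) (ι n) (ι i) (inv n) δ)
        (trans (cong₂ _*_ (n*[i/n] n i) (trans (cong₂ _-_ (ι-suc m) (ι*inv (suc m)))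
          (solve 1 (λ m → con 1ℚ :+ m :- con 1ℚ := m) refl (ι m)))) (sym (ι-* i m)))

      -- Here n·β i = i - i/(m + 1). For i ≥ 1 this is below i, and at least i - 1 because i ≤ n ≤
      -- m; for i = 0 it is 0, which agrees with `pred 0`.
      floor-β : ∀ i → i ℕ.≤ n → ∀ x → ι x ℚ.≤ ι n * β i ⇔ x ℕ.≤ pred i
      floor-β i i≤n x = mk⇔ to from
        where
        to : ι x ℚ.≤ ι n * β i → x ℕ.≤ pred i
        to p = from-ℕ i (ι-cancel (begin
          ι (suc m ℕ.* x)            ≡⟨ ι-* (suc m) x ⟩
          ι (suc m) * ι x            ≤⟨ *-monoʳ (ι (suc m)) (0≤ι (suc m)) p ⟩
          ι (suc m) * (ι n * β i)    ≡⟨ [1+m]β i ⟩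
          ι (i ℕ.* m)                ∎))
          where
          open ≤-Reasoning
          from-ℕ : ∀ i → suc m ℕ.* x ℕ.≤ i ℕ.* m → x ℕ.≤ pred i
          from-ℕ zero    h = ℕₚ.≤-trans (ℕₚ.m≤m+n x (m ℕ.* x)) h
          from-ℕ (suc i) h with x ℕₚ.≤? i
          ... | yes x≤i = x≤i
          ... | no  x≰i = contradiction h (ℕₚ.<⇒≱ (ℕₚ.<-≤-trans
                  (ℕₚ.≤-trans (ℕₚ.*-monoʳ-< (suc i) (ℕₚ.n<1+n m)) (ℕₚ.≤-reflexive (ℕₚ.*-comm (suc i) (suc m))))
                  (ℕₚ.*-monoʳ-≤ (suc m) (ℕₚ.≰⇒> x≰i))))
        from : x ℕ.≤ pred i → ι x ℚ.≤ ι n * β i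
        from x≤ = begin
          ι x                                      ≡⟨ trans (cong (ι x *_) (ι*inv (suc m))) (ℚₚ.*-identityʳ (ι x)) ⟨
          ι x * (ι (suc m) * δ)                    ≡⟨ trans (sym (ℚₚ.*-assoc (ι x) (ι (suc m)) δ)) (cong (_* δ) (sym (ι-* x (suc m)))) ⟩
          ι (x ℕ.* suc m) * δ                      ≤⟨ *-monoˡ δ (0≤inv (suc m)) (ι-mono (from-ℕ i x≤ i≤n)) ⟩
          ι (i ℕ.* m) * δ                          ≡⟨ cong (_* δ) ([1+m]β i) ⟨
          ι (suc m) * (ι n * β i) * δ              ≡⟨ solve 3 (λ s b d → s :* b :* d := b :* (s :* d)) refl (ι (suc m)) (ι n * β i) δ ⟩
          ι n * β i * (ι (suc m) * δ)              ≡⟨ trans (cong (ι n * β i *_) (ι*inv (suc m))) (ℚₚ.*-identityʳ (ι n * β i)) ⟩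
          ι n * β i                                ∎
          where
          open ≤-Reasoning
          from-ℕ : ∀ i → x ℕ.≤ pred i → i ℕ.≤ n → x ℕ.* suc m ℕ.≤ i ℕ.* m
          from-ℕ zero    ℕ.z≤n i≤n = ℕ.z≤n
          from-ℕ (suc i) x≤i   i≤n = ℕₚ.≤-trans (ℕₚ.*-monoˡ-≤ (suc m) x≤i) (ℕₚ.≤-trans
            (ℕₚ.≤-reflexive (ℕₚ.*-suc i m))
            (ℕₚ.+-monoˡ-≤ (i ℕ.* m) (ℕₚ.≤-trans (ℕₚ.n≤1+n i) (ℕₚ.≤-trans i≤n n≤m))))

    -- α = (1 − 1/(m + 1)) k/n; as m ≥ n, it lies in the cell just below k/n.
    belowCornerPoint : RationalPoint n (suc ρ)
    belowCornerPoint = record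
      { β     = β
      ; b     = pred
      ; k     = k
      ; β≥0   = λ j → 0≤* (0≤* (0≤ι (lookup k j)) (0≤inv n)) 0≤1-δ
      ; β≤1   = λ j → *-mono (0≤* (0≤ι (lookup k j)) (0≤inv n)) (i/n≤1 n (lookup-all k≤n j)) 0≤1-δ
                       (≤-by δ (0≤inv (suc m)) (solve 1 (λ d → con 1ℚ := con 1ℚ :- d :+ d) refl δ))
      ; floor = λ j → floor-β (lookup k j) (lookup-all k≤n j)
      }

    -- At this sample |α| is (1 - δ)ʳ|k/n|, which by Bernoulli is at least (1 - rδ)|k/n|. As |k/n| ≤
    -- 1, the volume lost is at most rδ.
    deficit-≤-deviation : ∀ i → deficit n k ℚ.≤ seq (deviation (sampleAt belowCornerPoint)) i + ι (suc ρ) * inv (suc m)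
    deficit-≤-deviation i = begin
      V - A
        ≡⟨ solve 3 (λ V A e → V :- A := V :* (con 1ℚ :- e) :- A :+ V :* e) refl V A e ⟩
      V * (1ℚ - e) - A + V * e
        ≤⟨ ℚₚ.+-mono-≤ (ℚₚ.+-monoˡ-≤ (- A) (*-monoʳ V 0≤V (bernoulli (0≤inv (suc m)) (inv≤1 (suc m)) (suc ρ))))
             (ℚₚ.≤-trans (*-monoˡ e (0≤* (0≤ι (suc ρ)) (0≤inv (suc m))) V≤1) (ℚₚ.≤-reflexive (ℚₚ.*-identityˡ e))) ⟩
      V * (1ℚ - δ) ^ℚ suc ρ - A + e
        ≡⟨ cong (λ t → t * (1ℚ - δ) ^ℚ suc ρ - A + e) (∏ℚ-scale ι (inv n) k) ⟨
      ∏ℚ (Vec.map (λ i → ι i * inv n) k) * (1ℚ - δ) ^ℚ suc ρ - A + e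
        ≡⟨ cong (λ t → t - A + e) (∏ℚ-scale (λ i → ι i * inv n) (1ℚ - δ) k) ⟨
      Q - A + e
        ≤⟨ ℚₚ.+-monoˡ-≤ e (p≤∣p∣ (Q - A)) ⟩
      ℚ.∣ Q - A ∣ + e
        ≡⟨ cong (_+ e) (trans (-‿comm-∣∣ Q A) (sym (deviation-sampleAt belowCornerPoint i))) ⟩
      seq (deviation (sampleAt belowCornerPoint)) i + e ∎
      where
      open ≤-Reasoning
      V A Q e : ℚ
      V = share n k
      A = coprimeShare n (Vec.map pred k)
      Q = ∏ℚ (Vec.map β k)
      e = ι (suc ρ) * δ
      0≤V : 0ℚ ℚ.≤ V
      0≤V = 0≤* (0≤vol k) (0≤^ (0≤inv n) (suc ρ))
      V≤1 : V ℚ.≤ 1ℚ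
      V≤1 = ℚₚ.≤-trans (*-monoˡ (inv n ^ℚ suc ρ) (0≤^ (0≤inv n) (suc ρ)) (vol-≤ n k k≤n))
        (ℚₚ.≤-reflexive (^-inverse (ι n) (inv n) (ι*inv n) (suc ρ)))

-- Integer parts under double negation

-- `P` is not assumed decidable. A refutation of `P` at the top moves the search one step down, and
-- `P 0` stops it.
¬¬-last : ∀ (P : ℕ → Set) n → P 0 → ¬ P (suc n) → ¬ ¬ (∃[ k ] k ℕ.≤ n × P k × ¬ P (suc k))
¬¬-last P zero    p0 ¬p1 ¬∃ = ¬∃ (0 , ℕ.z≤n , p0 , ¬p1)
¬¬-last P (suc n) p0 ¬p  ¬∃ = ¬¬p (λ p → ¬∃ (suc n , ℕₚ.≤-refl , p , ¬p))
  where
  ¬¬p : ¬ ¬ P (suc n)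
  ¬¬p ¬p′ = ¬¬-last P n p0 ¬p′ λ (k , k≤n , pk , ¬psk) → ¬∃ (k , ℕₚ.m≤n⇒m≤1+n k≤n , pk , ¬psk)

-- Double negation commutes with finite conjunctions, so the coordinatewise floors combine into one
-- vector.
¬¬-choice : ∀ r (P : Fin r → ℕ → Set) → (∀ j → ¬ ¬ ∃ (P j)) → ¬ ¬ (∃[ k ] ∀ j → P j (lookup {n = r} k j))
¬¬-choice zero    P h ¬∃ = ¬∃ ([] , λ ())
¬¬-choice (suc r) P h ¬∃ = h zero λ (k₀ , p₀) → ¬¬-choice r (P ∘ suc) (h ∘ suc) λ (k , p) →
  ¬∃ (k₀ ∷ k , λ { zero → p₀ ; (suc j) → p j })

-- The integer part of n αⱼ is not computable, but as ≤ℝ is ¬¬-stable, it may be used in proofs of ≤ℝ.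
IsFloor : ℕ → ℝ → ℕ → Set
IsFloor n x k = k ℕ.≤ n × fromℕ k ≤ℝ fromℕ n *ℝ x × ¬ (fromℕ (suc k) ≤ℝ fromℕ n *ℝ x)

module _ (n : ℕ) .{{_ : NonZero n}} (x : ℝ) where

  scale-≤ : ∀ k → fromℕ n *ℝ x ≤ℝ fromℕ k → x ≤ℝ fromℚ (ι k * inv n)
  scale-≤ k nx≤k ε 0<ε = eventually-map {P = λ m → ℤ.+ n / 1 * seq x m ℚ.≤ ℤ.+ k / 1 + ε}
    (λ m p → begin
      seq x m                            ≡⟨ trans (cong (seq x m *_) (ι*inv n)) (ℚₚ.*-identityʳ (seq x m)) ⟨
      seq x m * (ι n * inv n)            ≡⟨ solve 3 (λ x n i → x :* (n :* i) := (n :* x) :* i) refl (seq x m) (ι n) (inv n) ⟩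
      ι n * seq x m * inv n              ≤⟨ *-monoˡ (inv n) (0≤inv n) (subst₂ (λ s t → s * seq x m ℚ.≤ t + ε) (sym (ι-def n)) (sym (ι-def k)) p) ⟩
      (ι k + ε) * inv n                  ≡⟨ ℚₚ.*-distribʳ-+ (inv n) (ι k) ε ⟩
      ι k * inv n + ε * inv n            ≤⟨ ℚₚ.+-monoʳ-≤ (ι k * inv n) (*-monoʳ ε (ℚₚ.<⇒≤ 0<ε) (inv≤1 n)) ⟩
      ι k * inv n + ε * 1ℚ               ≡⟨ cong (ι k * inv n +_) (ℚₚ.*-identityʳ ε) ⟩
      ι k * inv n + ε                    ∎)
    (nx≤k ε 0<ε)
    where open ≤-Reasoning

  scale-≥ : ∀ k → fromℕ k ≤ℝ fromℕ n *ℝ x → fromℚ (ι k * inv n) ≤ℝ x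
  scale-≥ k k≤nx ε 0<ε = eventually-map {P = λ m → ℤ.+ k / 1 ℚ.≤ ℤ.+ n / 1 * seq x m + ε}
    (λ m p → begin
      ι k * inv n                        ≤⟨ *-monoˡ (inv n) (0≤inv n) (subst₂ (λ s t → s ℚ.≤ t * seq x m + ε) (sym (ι-def k)) (sym (ι-def n)) p) ⟩
      (ι n * seq x m + ε) * inv n        ≡⟨ solve 4 (λ x n i e → (n :* x :+ e) :* i := x :* (n :* i) :+ e :* i) refl (seq x m) (ι n) (inv n) ε ⟩
      seq x m * (ι n * inv n) + ε * inv n ≤⟨ ℚₚ.+-mono-≤ (ℚₚ.≤-reflexive (trans (cong (seq x m *_) (ι*inv n)) (ℚₚ.*-identityʳ (seq x m))))
                                             (*-monoʳ ε (ℚₚ.<⇒≤ 0<ε) (inv≤1 n)) ⟩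
      seq x m + ε * 1ℚ                   ≡⟨ cong (seq x m +_) (ℚₚ.*-identityʳ ε) ⟩
      seq x m + ε                        ∎)
    (k≤nx ε 0<ε)
    where open ≤-Reasoning

  0≤fromℕ* : 0ℝ ≤ℝ x → fromℕ 0 ≤ℝ fromℕ n *ℝ x
  0≤fromℕ* 0≤x = 0≤*ℝ {fromℕ n} {x} (fromℚ-mono (0≤/ n 0)) 0≤x

  fromℕ*≤ : x ≤ℝ 1ℝ → fromℕ n *ℝ x ≤ℝ fromℕ n
  fromℕ*≤ x≤1 = ≤ℝ-pointwise {fromℕ n *ℝ x} {fromℕ n *ℝ 1ℝ} {fromℕ n *ℝ x} {fromℕ n}
    (λ _ → refl) (λ _ → ℚₚ.*-identityʳ (ℤ.+ n / 1)) (*ℝ-monoʳ (fromℕ n) {x} {1ℝ} (fromℚ-mono (0≤/ n 0)) x≤1)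

  ¬¬-floor : 0ℝ ≤ℝ x → x ≤ℝ 1ℝ → ¬ ¬ ∃ (IsFloor n x)
  ¬¬-floor 0≤x x≤1 = ¬¬-last (λ k → fromℕ k ≤ℝ fromℕ n *ℝ x) n (0≤fromℕ* 0≤x) λ 1+n≤nx →
    ℕₚ.1+n≰n (ι-cancel (fromℚ-cancel (subst₂ _≤ℝ_ (fromℕ≡ (suc n)) (fromℕ≡ n)
      (≤ℝ-trans {fromℕ (suc n)} {fromℕ n *ℝ x} {fromℕ n} 1+n≤nx (fromℕ*≤ x≤1)))))

  floor-⇔ : ∀ {k} → IsFloor n x k → ∀ a → fromℕ a ≤ℝ fromℕ n *ℝ x ⇔ a ℕ.≤ k
  floor-⇔ {k} (_ , k≤nx , 1+k≰nx) a = mk⇔ to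
    (λ a≤k → ≤ℝ-trans {fromℕ a} {fromℕ k} {fromℕ n *ℝ x} (fromℕ-mono a≤k) k≤nx)
    where
    to : fromℕ a ≤ℝ fromℕ n *ℝ x → a ℕ.≤ k
    to a≤nx with a ℕₚ.≤? k
    ... | yes a≤k = a≤k
    ... | no  a≰k = contradiction
          (≤ℝ-trans {fromℕ (suc k)} {fromℕ a} {fromℕ n *ℝ x} (fromℕ-mono (ℕₚ.≰⇒> a≰k)) a≤nx) 1+k≰nx

  -- The cap at `n` keeps the upper corner of the cell in the grid when the floor is already `n`;
  -- there the estimate is just x ≤ 1.
  ≤-floor+1 : ∀ {k} → x ≤ℝ 1ℝ → IsFloor n x k → x ≤ℝ fromℚ (ι (suc k ℕ.⊓ n) * inv n)
  ≤-floor+1 {k} x≤1 (k≤n , _ , 1+k≰nx) with ℕₚ.⊓-sel (suc k) n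
  ... | inj₁ eq = subst (λ t → x ≤ℝ fromℚ (ι t * inv n)) (sym eq)
                    (scale-≤ (suc k) (≰ℝ⇒≥ℝ {fromℕ (suc k)} {fromℕ n *ℝ x} 1+k≰nx))
  ... | inj₂ eq = subst (λ t → x ≤ℝ fromℚ (ι t * inv n)) (sym eq) (scale-≤ n (fromℕ*≤ x≤1))

-- The maximum over the grid is the supremum

-- The default 0 takes part in every maximum. It does not raise the supremum of the deviations,
-- which are nonnegative; `discrepancy-≤` accounts for it by `0≤u`.
maximum : {A : Set} → List A → (A → ℚ) → ℚ
maximum []       f = 0ℚ
maximum (x ∷ xs) f = f x ℚ.⊔ maximum xs f

≤-maximum : ∀ {A : Set} {xs : List A} (f : A → ℚ) {x} → x ∈ xs → f x ℚ.≤ maximum xs f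
≤-maximum {xs = x ∷ xs} f (here refl) = ℚₚ.p≤p⊔q (f x) (maximum xs f)
≤-maximum {xs = x ∷ xs} f (there x∈)  = ℚₚ.≤-trans (≤-maximum f x∈) (ℚₚ.p≤q⊔p (f x) (maximum xs f))

⊔-elim : ∀ (P : ℚ → Set) {p q} → P p → P q → P (p ℚ.⊔ q)
⊔-elim P {p} {q} hp hq with ℚₚ.⊔-sel p q
... | inj₁ eq = subst P (sym eq) hp
... | inj₂ eq = subst P (sym eq) hq

maximum-elim : ∀ {A : Set} (P : ℚ → Set) (xs : List A) f → P 0ℚ → (∀ x → x ∈ xs → P (f x)) → P (maximum xs f)
maximum-elim P []       f p0 h = p0
maximum-elim P (x ∷ xs) f p0 h = ⊔-elim P (h x (here refl)) (maximum-elim P xs f p0 (λ y → h y ∘ there))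

grid : ∀ r → ℕ → List (Vec ℕ r)
grid r n = prod (replicate r (upTo (suc n)))

∈-grid⁺ : ∀ {r} n {k : Vec ℕ r} → VAll (ℕ._≤ n) k → k ∈ grid r n
∈-grid⁺ {r} n {k} k≤n = ∈-prod⁺ (replicate r (upTo (suc n))) λ j →
  subst (lookup k j ∈_) (sym (Vecₚ.lookup-replicate j (upTo (suc n)))) (∈-upTo⁺ (ℕ.s≤s (lookup-all k≤n j)))

∈-grid⁻ : ∀ {r} n {k : Vec ℕ r} → k ∈ grid r n → VAll (ℕ._≤ n) k
∈-grid⁻ {r} n {k} k∈ = tabulate-all k λ j → ℕ.s≤s⁻¹ (∈-upTo⁻
  (subst (lookup k j ∈_) (Vecₚ.lookup-replicate j (upTo (suc n))) (∈-prod⁻ (replicate r (upTo (suc n))) k∈ j)))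

opaque
  discrepancy : ℕ → ℕ → ℚ
  discrepancy r n = maximum (grid r n) (λ k → excess n k ℚ.⊔ deficit n k)

opaque
  unfolding discrepancy

  excess-≤-discrepancy : ∀ {r} n {k : Vec ℕ r} → VAll (ℕ._≤ n) k → excess n k ℚ.≤ discrepancy r n
  excess-≤-discrepancy n {k} k≤n = ℚₚ.≤-trans (ℚₚ.p≤p⊔q (excess n k) (deficit n k)) (≤-maximum _ (∈-grid⁺ n k≤n))

  deficit-≤-discrepancy : ∀ {r} n {k : Vec ℕ r} → VAll (ℕ._≤ n) k → deficit n k ℚ.≤ discrepancy r n
  deficit-≤-discrepancy n {k} k≤n = ℚₚ.≤-trans (ℚₚ.p≤q⊔p (excess n k) (deficit n k)) (≤-maximum _ (∈-grid⁺ n k≤n))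

  discrepancy-elim : ∀ (P : ℚ → Set) r n → P 0ℚ →
                     (∀ (k : Vec ℕ r) → VAll (ℕ._≤ n) k → P (excess n k)) →
                     (∀ (k : Vec ℕ r) → VAll (ℕ._≤ n) k → P (deficit n k)) → P (discrepancy r n)
  discrepancy-elim P r n p0 pexcess pdeficit = maximum-elim P (grid r n) _ p0 λ k k∈ →
    ⊔-elim P (pexcess k (∈-grid⁻ n k∈)) (pdeficit k (∈-grid⁻ n k∈))

∣fromℚ-∣≤ℝ : ∀ {c y s t d} → fromℚ s ≤ℝ y → y ≤ℝ fromℚ t → c - s ℚ.≤ d → t - c ℚ.≤ d →
             ∣ fromℚ c -ℝ y ∣ℝ ≤ℝ fromℚ d
∣fromℚ-∣≤ℝ {c} {y} {s} {t} {d} s≤y y≤t c-s≤d t-c≤d ε 0<ε = eventually-map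
  (λ m (p , q) → ∣∣≤
    (≤-by (d - (c - s) + (seq y m + ε - s)) (0≤+ (0≤-diff c-s≤d) (0≤-diff p))
      (solve 5 (λ c s d e y → d :+ e := c :- y :+ (d :- (c :- s) :+ (y :+ e :- s))) refl c s d ε (seq y m)))
    (≤-by (d - (t - c) + (t + ε - seq y m)) (0≤+ (0≤-diff t-c≤d) (0≤-diff q))
      (solve 5 (λ c t d e y → d :+ e := :- (c :- y) :+ (d :- (t :- c) :+ (t :+ e :- y))) refl c t d ε (seq y m))))
  (eventually-× {P = λ m → s ℚ.≤ seq y m + ε} {Q = λ m → seq y m ℚ.≤ t + ε} (s≤y ε 0<ε) (y≤t ε 0<ε))

count-mono : ∀ {r} (k l : Vec ℕ r) → (∀ j → lookup k j ℕ.≤ lookup l j) → count k ℕ.≤ count l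
count-mono k l k≤l = unique-⊆-length (coprimes-unique k) λ {x} x∈ →
  let 𝒞x , x≤k = Equivalence.to (∈-coprimes k x) x∈
  in Equivalence.from (∈-coprimes l x) (𝒞x , λ j → ℕₚ.≤-trans (x≤k j) (k≤l j))

coprimeShare-mono : ∀ {r} n (k l : Vec ℕ r) → (∀ j → lookup k j ℕ.≤ lookup l j) → coprimeShare n k ℚ.≤ coprimeShare n l
coprimeShare-mono {r} n k l k≤l = *-monoˡ (inv (total r n)) (0≤inv (total r n)) (ι-mono (count-mono k l k≤l))

module _ {ρ : ℕ} (n : ℕ) .{{_ : NonZero n}} where

  private
    r : ℕ
    r = suc ρ

  -- Let `k` and `l` be the lower and upper corners of the cell of α. Then F(n,α) is `count k`, and
  -- |α| lies between |k/n| and |l/n|, so the deviation is controlled by the excess at `k` on one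
  -- side and the deficit at `l` on the other.
  deviation-≤-discrepancy : ∀ (s : Sample r n) → deviation s ≤ℝ fromℚ (discrepancy r n)
  deviation-≤-discrepancy s = ≤ℝ-stable {deviation s} {fromℚ (discrepancy r n)} (¬¬-map withFloors
    (¬¬-choice r (λ j → IsFloor n (lookup α j)) λ j → ¬¬-floor n (lookup α j) (α≥0 j) (α≤1 j)))
    where
    open Sample s
    withFloors : (∃[ k ] ∀ j → IsFloor n (lookup α j) (lookup k j)) → deviation s ≤ℝ fromℚ (discrepancy r n)
    withFloors (k , floors) = subst (λ c → ∣ fromℚ c -ℝ ∏ α ∣ℝ ≤ℝ fromℚ (discrepancy r n)) (sym ratio≡)
      (∣fromℚ-∣≤ℝ {coprimeShare n k} {∏ α} {share n k} {share n l} {discrepancy r n}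
        lower upper (excess-≤-discrepancy n k≤n)
        -- `pred` of `l` may fall short of `k`: where k has the entry n, so does l, and `pred` gives
        -- n - 1. Monotonicity of the count bridges the gap.
        (ℚₚ.≤-trans (ℚₚ.+-monoʳ-≤ (share n l) (ℚₚ.neg-antimono-≤ (coprimeShare-mono n (Vec.map pred l) k pred-l≤k)))
          (deficit-≤-discrepancy n l≤n)))
      where
      l : Vec ℕ r
      l = Vec.map (λ i → suc i ℕ.⊓ n) k
      k≤n : VAll (ℕ._≤ n) k
      k≤n = tabulate-all k (proj₁ ∘ floors)
      lookup-l : ∀ j → lookup l j ≡ suc (lookup k j) ℕ.⊓ n
      lookup-l j = Vecₚ.lookup-map j _ k
      l≤n : VAll (ℕ._≤ n) l
      l≤n = tabulate-all l λ j → subst (ℕ._≤ n) (sym (lookup-l j)) (ℕₚ.m⊓n≤n (suc (lookup k j)) n)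
      pred-l≤k : ∀ j → lookup (Vec.map pred l) j ℕ.≤ lookup k j
      pred-l≤k j = subst (ℕ._≤ lookup k j) (sym (trans (Vecₚ.lookup-map j pred l) (cong pred (lookup-l j))))
        (ℕₚ.pred-mono-≤ (ℕₚ.m⊓n≤m (suc (lookup k j)) n))
      Fα≡ : Fα ≡ count k
      Fα≡ = cardinality-unique F[n,α]≡Fα (floors⇒F {r} {n} {α} {k} (λ j → floor-⇔ n (lookup α j) (floors j)))
      F𝟏≡ : F𝟏 ≡ total r n
      F𝟏≡ = cardinality-unique F[n,𝟏]≡F𝟏 (F[n,𝟏] r n)
      ratio≡ : _/_ (ℤ.+ Fα) F𝟏 {{F𝟏≢0}} ≡ coprimeShare n k
      ratio≡ = trans (/≡ι*inv Fα F𝟏 {{F𝟏≢0}}) (cong₂ (λ a b → ι a * inv b) Fα≡ F𝟏≡)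
      corner : Vec ℕ r → Vec ℝ r
      corner v = Vec.map fromℚ (Vec.map (λ i → ι i * inv n) v)
      lookup-corner : ∀ v j → lookup (corner v) j ≡ fromℚ (ι (lookup v j) * inv n)
      lookup-corner v j = trans (Vecₚ.lookup-map j fromℚ (Vec.map (λ i → ι i * inv n) v)) (cong fromℚ (Vecₚ.lookup-map j _ v))
      seq-corner : ∀ v m → seq (∏ (corner v)) m ≡ share n v
      seq-corner v m = trans (∏ℝ-fromℚ (Vec.map (λ i → ι i * inv n) v) m) (∏ℚ-scale ι (inv n) v)
      lower : fromℚ (share n k) ≤ℝ ∏ α
      lower = ≤ℝ-pointwise {∏ (corner k)} {∏ α} {fromℚ (share n k)} {∏ α} (seq-corner k) (λ _ → refl)
        (∏ℝ-mono (corner k) α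
          (λ j → subst (0ℝ ≤ℝ_) (sym (lookup-corner k j)) (fromℚ-mono (0≤* (0≤ι (lookup k j)) (0≤inv n))))
          (λ j → subst (_≤ℝ lookup α j) (sym (lookup-corner k j))
            (scale-≥ n (lookup α j) (lookup k j) (proj₁ (proj₂ (floors j))))))
      upper : ∏ α ≤ℝ fromℚ (share n l)
      upper = ≤ℝ-pointwise {∏ α} {∏ (corner l)} {∏ α} {fromℚ (share n l)} (λ _ → refl) (seq-corner l)
        (∏ℝ-mono α (corner l) α≥0 (λ j → subst (lookup α j ≤ℝ_)
          (trans (cong (λ t → fromℚ (ι t * inv n)) (sym (lookup-l j))) (sym (lookup-corner l j)))
          (≤-floor+1 n (lookup α j) (α≤1 j) (floors j))))

  -- Excesses are bounded by deviations at actual samples, whereas deficits are only limits. For a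
  -- given ε the sample below the corner is chosen so close that r/(m + 1) ≤ ε/2, and the other half
  -- of ε pays for the comparison with `u`.
  discrepancy-≤ : ∀ u → (∀ (s : Sample r n) → deviation s ≤ℝ u) → fromℚ (discrepancy r n) ≤ℝ u
  discrepancy-≤ u dev≤u = discrepancy-elim (λ q → fromℚ q ≤ℝ u) r n 0≤u excess≤u deficit≤u
    where
    excess≤u : ∀ k → VAll (ℕ._≤ n) k → fromℚ (excess n k) ≤ℝ u
    excess≤u k k≤n ε 0<ε = eventually-map {P = λ m → seq (deviation s) m ℚ.≤ seq u m + ε}
      (λ m → ℚₚ.≤-trans (excess-≤-deviation n k k≤n m)) (dev≤u s ε 0<ε)
      where
      s : Sample r n
      s = sampleAt (cornerPoint n k k≤n)
    0≤u : 0ℝ ≤ℝ u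
    0≤u ε 0<ε = eventually-map {P = λ m → seq (deviation s) m ℚ.≤ seq u m + ε}
      (λ m → ℚₚ.≤-trans (ℚₚ.0≤∣p∣ _)) (dev≤u s ε 0<ε)
      where
      s : Sample r n
      s = sampleAt (cornerPoint n (replicate r n) (all-≤-replicate r n))
    deficit≤u : ∀ k → VAll (ℕ._≤ n) k → fromℚ (deficit n k) ≤ℝ u
    deficit≤u k k≤n ε 0<ε = eventually-map {P = λ i → seq (deviation s) i ℚ.≤ seq u i + ε * ½}
      (λ i dev≤ → begin
        deficit n k                                ≤⟨ deficit-≤-deviation n k k≤n m n≤m i ⟩
        seq (deviation s) i + ι r * inv (suc m)    ≤⟨ ℚₚ.+-mono-≤ dev≤ r/m≤ ⟩
        seq u i + ε * ½ + ε * ½                    ≡⟨ trans (ℚₚ.+-assoc (seq u i) (ε * ½) (ε * ½)) (cong (seq u i +_) (halves ε)) ⟩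
        seq u i + ε                                ∎)
      (dev≤u s (ε * ½) (half-pos ε 0<ε))
      where
      open ≤-Reasoning
      M : ∃[ N ] ∀ m → N ℕ.≤ m → ℤ.+ r / suc m ℚ.≤ ε * ½
      M = archimedean r (ε * ½) (half-pos ε 0<ε)
      m : ℕ
      m = proj₁ M ℕ.⊔ n
      n≤m : n ℕ.≤ m
      n≤m = ℕₚ.m≤n⊔m (proj₁ M) n
      r/m≤ : ι r * inv (suc m) ℚ.≤ ε * ½
      r/m≤ = subst (ℚ._≤ ε * ½) (/≡ι*inv r (suc m)) (proj₂ M m (ℕₚ.m≤m⊔n (proj₁ M) n))
      s : Sample r n
      s = sampleAt (belowCornerPoint n k k≤n m n≤m)

isDiscrepancy : ∀ r n .{{_ : NonZero r}} .{{_ : NonZero n}} → IsDiscrepancy r n (fromℚ (discrepancy r n))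
isDiscrepancy (suc ρ) n = record { upper = deviation-≤-discrepancy n ; least = discrepancy-≤ n }

-- Upper and lower bounds for the maximum

discrepancy-≤-bound : ∀ {ρ} n .{{_ : NonZero n}} → 1 ℕ.≤ ρ → discrepancy (suc ρ) n ℚ.≤ bound ρ n
discrepancy-≤-bound {ρ} n 1≤ρ = discrepancy-elim (ℚ._≤ bound ρ n) (suc ρ) n 0≤bound
  (excess-≤ n 1≤ρ) (deficit-≤ n 1≤ρ)
  where
  0≤bound : 0ℚ ℚ.≤ bound ρ n
  0≤bound = 0≤* (0≤ι 9) (0≤* (0≤* (0≤ι (suc ρ))
    (ℚₚ.≤-trans 0≤1 (subst (λ m → 1ℚ ℚ.≤ invPowerSum ρ m) (ℕₚ.suc-pred n) (1≤invPowerSum ρ (pred n))))) (0≤inv n))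

discrepancy-≥ : ∀ ρ n .{{_ : NonZero n}} → inv 3 ^ℚ suc ρ * inv n ℚ.≤ discrepancy (suc ρ) n
discrepancy-≥ ρ n with n ℕₚ.≟ 1
... | no n≢1   = ℚₚ.≤-trans (excess-≥ ρ n (ℕₚ.≤∧≢⇒< 1≤n (n≢1 ∘ sym)))
  (excess-≤-discrepancy n (1≤n ∷ all-≤-replicate ρ n))
  where
  1≤n : 1 ≤ n
  1≤n = ℕ.>-nonZero⁻¹ n
... | yes refl = begin
  inv 3 ^ℚ suc ρ * inv 1    ≤⟨ *-mono (0≤^ (0≤inv 3) (suc ρ)) (^-≤1 (0≤inv 3) (inv≤1 3) (suc ρ)) (0≤inv 1) (inv≤1 1) ⟩
  1ℚ                        ≡⟨ deficit-1 ρ ⟨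
  deficit 1 (replicate (suc ρ) 1) ≤⟨ deficit-≤-discrepancy 1 (all-≤-replicate (suc ρ) 1) ⟩
  discrepancy (suc ρ) 1     ∎
  where open ≤-Reasoning

-- The harmonic sum against the Mercator series of ln n

-- By Bernoulli, (1 − 1/n)ʲ/j ≥ 1/j − 1/n.
mercator-≥ : ∀ n .{{_ : NonZero n}} j → invPowerSum 1 j - ι j * inv n ℚ.≤ mercator (1ℚ - inv n) j
mercator-≥ n zero    = ℚₚ.≤-reflexive (trans (cong (λ t → 0ℚ - t * inv n) ι-0)
  (solve 1 (λ i → con 0ℚ :- con 0ℚ :* i := con 0ℚ) refl (inv n)))
mercator-≥ n (suc j) = begin
  inv (suc j) * 1ℚ + invPowerSum 1 j - ι (suc j) * inv n
    ≡⟨ split ⟩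
  (invPowerSum 1 j - ι j * inv n) + (1ℚ - ι (suc j) * inv n) * inv (suc j)
    ≤⟨ ℚₚ.+-mono-≤ (mercator-≥ n j) (*-monoˡ (inv (suc j)) (0≤inv (suc j)) (bernoulli (0≤inv n) (inv≤1 n) (suc j))) ⟩
  mercator (1ℚ - inv n) j + (1ℚ - inv n) ^ℚ suc j * inv (suc j)
    ≡⟨ cong (λ t → mercator (1ℚ - inv n) j + (1ℚ - inv n) ^ℚ suc j * t) (inv-def j) ⟩
  mercator (1ℚ - inv n) (suc j) ∎
  where
  open ≤-Reasoning
  split : inv (suc j) * 1ℚ + invPowerSum 1 j - ι (suc j) * inv n ≡
          (invPowerSum 1 j - ι j * inv n) + (1ℚ - ι (suc j) * inv n) * inv (suc j)
  split = trans (cong (λ t → inv (suc j) * 1ℚ + invPowerSum 1 j - t * inv n) (ι-suc j))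
    (trans (solve 4 (λ u p j i → u :* con 1ℚ :+ p :- (con 1ℚ :+ j) :* i := (p :- j :* i) :+ (u :- con 1ℚ :* i)) refl
             (inv (suc j)) (invPowerSum 1 j) (ι j) (inv n))
      (cong ((invPowerSum 1 j - ι j * inv n) +_) (trans
        (cong (λ t → inv (suc j) - t * inv n) (sym (ι*inv (suc j))))
        (solve 3 (λ u s i → u :- s :* u :* i := (con 1ℚ :- s :* i) :* u) refl (inv (suc j)) (ι (suc j)) (inv n)))))

3/2 : ℚ
3/2 = ℤ.+ 3 / 2

3/2≤invPowerSum-1 : ∀ m → 3/2 ℚ.≤ invPowerSum 1 (suc (suc m))
3/2≤invPowerSum-1 zero    = ℚₚ.≤-reflexive (sym (cong₂ (λ a b → a * 1ℚ + (b * 1ℚ + 0ℚ)) (inv-def 1) inv-1))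
3/2≤invPowerSum-1 (suc m) = ℚₚ.≤-trans (3/2≤invPowerSum-1 m) (≤-by (inv (suc (suc (suc m))) ^ℚ 1) (0≤^ (0≤inv (suc (suc (suc m)))) 1)
  (ℚₚ.+-comm (inv (suc (suc (suc m))) ^ℚ 1) (invPowerSum 1 (suc (suc m)))))

3ℚ : ℚ
3ℚ = ℤ.+ 3 / 1

-- `mercator-≥` with n terms bounds H - 1 by the Mercator sum, and later terms only increase it. The
-- factor 3 is due to H ≤ 3(H - 1), which is the same as H ≥ 3/2 and so holds from n = 2 on.
invPowerSum-1-≤-mercator : ∀ k → 2 ℕ.≤ suc k → ∀ m → suc k ℕ.≤ m →
                        invPowerSum 1 (suc k) ℚ.≤ 3ℚ * mercator (1ℚ - ℤ.+ 1 / suc k) m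
invPowerSum-1-≤-mercator k@(suc k′) _ m n≤m = begin
  H
    ≤⟨ ≤-by ((1ℚ + 1ℚ) * (H - 3/2)) (0≤* (0≤/ 2 0) (0≤-diff (3/2≤invPowerSum-1 k′)))
         (solve 1 (λ h → con 3ℚ :* (h :- con 1ℚ) := h :+ con (1ℚ + 1ℚ) :* (h :- con 3/2)) refl H) ⟩
  3ℚ * (H - 1ℚ)
    ≡⟨ cong (λ t → 3ℚ * (H - t)) (ι*inv (suc k)) ⟨
  3ℚ * (H - ι (suc k) * inv (suc k))
    ≤⟨ *-monoʳ 3ℚ (0≤/ 3 0) (mercator-≥ (suc k) (suc k)) ⟩
  3ℚ * mercator (1ℚ - inv (suc k)) (suc k)
    ≡⟨ cong (λ t → 3ℚ * mercator (1ℚ - t) (suc k)) (inv-def k) ⟩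
  3ℚ * mercator (1ℚ - ℤ.+ 1 / suc k) (suc k)
    ≤⟨ *-monoʳ 3ℚ (0≤/ 3 0) (mercator-mono k (ℕₚ.≤⇒≤′ n≤m)) ⟩
  3ℚ * mercator (1ℚ - ℤ.+ 1 / suc k) m ∎
  where
  open ≤-Reasoning
  H : ℚ
  H = invPowerSum 1 (suc k)
invPowerSum-1-≤-mercator zero (ℕ.s≤s ())

-- The constants of the two estimates

0<inv : ∀ k → 0ℚ ℚ.< inv (suc k)
0<inv k = subst (0ℚ ℚ.<_) (sym (inv-def k)) (ℚₚ.positive⁻¹ _ {{ℚₚ.normalize-pos 1 (suc k)}})

0<^ : ∀ {a} → 0ℚ ℚ.< a → ∀ r → 0ℚ ℚ.< a ^ℚ r
0<^ 0<a zero    = ℚₚ.positive⁻¹ 1ℚ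
0<^ {a} 0<a (suc r) = ℚₚ.positive⁻¹ _ {{ℚₚ.pos*pos⇒pos a {{positive 0<a}} (a ^ℚ r) {{positive (0<^ 0<a r)}}}}

-- The 9·r comes from `bound`, and `s` bounds the power sum: 3 in front of ln n when r = 2, and 2 as
-- an integer above 7/4 when r ≥ 3.
upperConstant : ℕ → ℕ → ℕ
upperConstant r s = 9 ℕ.* (r ℕ.* s)

bound-≤ : ∀ ρ n s x → invPowerSum ρ n ℚ.≤ ι s * x → bound ρ n ℚ.≤ ι (upperConstant (suc ρ) s) * (x * inv n)
bound-≤ ρ n s x h = begin
  ι 9 * (ι (suc ρ) * invPowerSum ρ n * inv n)
    ≤⟨ *-monoʳ (ι 9) (0≤ι 9) (*-monoˡ (inv n) (0≤inv n) (*-monoʳ (ι (suc ρ)) (0≤ι (suc ρ)) h)) ⟩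
  ι 9 * (ι (suc ρ) * (ι s * x) * inv n)
    ≡⟨ solve 5 (λ a r s x i → a :* (r :* (s :* x) :* i) := a :* (r :* s) :* (x :* i)) refl (ι 9) (ι (suc ρ)) (ι s) x (inv n) ⟩
  ι 9 * (ι (suc ρ) * ι s) * (x * inv n)
    ≡⟨ cong (_* (x * inv n)) (trans (ι-* 9 (suc ρ ℕ.* s)) (cong (ι 9 *_) (ι-* (suc ρ) s))) ⟨
  ι (upperConstant (suc ρ) s) * (x * inv n) ∎
  where open ≤-Reasoning

0<lowerConstant : ∀ r → 0ℝ <ℝ fromℚ (inv 3 ^ℚ r)
0<lowerConstant r = inv 3 ^ℚ r , 0<^ (0<inv 2) r , always λ _ → ℚₚ.≤-reflexive (ℚₚ.+-identityˡ (inv 3 ^ℚ r))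

lowerConstant<upperConstant : ∀ r s .{{_ : NonZero r}} → 1 ≤ s → fromℚ (inv 3 ^ℚ r) <ℝ fromℚ (ι (upperConstant r s))
lowerConstant<upperConstant (suc ρ) s 1≤s = 1ℚ , ℚₚ.positive⁻¹ 1ℚ , always λ _ → begin
  inv 3 ^ℚ suc ρ + 1ℚ            ≤⟨ ℚₚ.+-monoˡ-≤ 1ℚ (^-≤1 (0≤inv 3) (inv≤1 3) (suc ρ)) ⟩
  1ℚ + 1ℚ                        ≡⟨ trans (ι-suc 1) (cong (1ℚ +_) ι-1) ⟨
  ι 2                            ≤⟨ ι-mono (ℕₚ.≤-trans (ℕₚ.m≤m+n 2 7) (ℕₚ.*-monoʳ-≤ 9 (ℕₚ.*-mono-≤ (ℕ.s≤s (ℕ.z≤n {ρ})) 1≤s))) ⟩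
  ι (upperConstant (suc ρ) s)    ∎
  where open ≤-Reasoning

lowerConstant-≤ : ∀ r k .{{_ : NonZero r}} → fromℚ (inv 3 ^ℚ r) /ℕ suc k ≤ℝ fromℚ (discrepancy r (suc k))
lowerConstant-≤ (suc ρ) k = ≤ℝ-pointwise {fromℚ (inv 3 ^ℚ suc ρ * inv (suc k))} {Δ} {fromℚ (inv 3 ^ℚ suc ρ) /ℕ suc k} {Δ}
  (λ _ → cong (inv 3 ^ℚ suc ρ *_) (inv-def k)) (λ _ → refl) (fromℚ-mono (discrepancy-≥ ρ (suc k)))
  where
  Δ : ℝ
  Δ = fromℚ (discrepancy (suc ρ) (suc k))

-- From index n on, the terms of the sequence defining `ln` already satisfy the estimate, so n
-- serves as the threshold for every ε.
≤-upperConstant-ln : ∀ k → 2 ≤ suc k → fromℚ (discrepancy 2 (suc k)) ≤ℝ fromℚ (ι (upperConstant 2 3)) *ℝ (ln (suc k) /ℕ suc k)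
≤-upperConstant-ln k 2≤n ε 0<ε = suc k , λ m n≤m → begin
  discrepancy 2 (suc k)
    ≤⟨ discrepancy-≤-bound (suc k) ℕₚ.≤-refl ⟩
  bound 1 (suc k)
    ≤⟨ bound-≤ 1 (suc k) 3 (seq (ln (suc k)) m) (subst (λ t → invPowerSum 1 (suc k) ℚ.≤ t * seq (ln (suc k)) m) (sym (ι-def 3))
         (invPowerSum-1-≤-mercator k 2≤n m n≤m)) ⟩
  ι (upperConstant 2 3) * (seq (ln (suc k)) m * inv (suc k))
    ≡⟨ cong (λ t → ι (upperConstant 2 3) * (seq (ln (suc k)) m * t)) (inv-def k) ⟩
  ι (upperConstant 2 3) * (seq (ln (suc k)) m * (ℤ.+ 1 / suc k))
    ≤⟨ ≤-by ε (ℚₚ.<⇒≤ 0<ε) refl ⟩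
  ι (upperConstant 2 3) * (seq (ln (suc k)) m * (ℤ.+ 1 / suc k)) + ε ∎
  where open ≤-Reasoning

≤-upperConstant : ∀ ρ k → 2 ≤ ρ → fromℚ (discrepancy (suc ρ) (suc k)) ≤ℝ fromℚ (ι (upperConstant (suc ρ) 2)) /ℕ suc k
≤-upperConstant ρ k 2≤ρ = ≤ℝ-pointwise {Δ} {fromℚ (C * (1ℚ * inv (suc k)))} {Δ} {fromℚ C /ℕ suc k}
  (λ _ → refl) (λ _ → cong (C *_) (trans (ℚₚ.*-identityˡ (inv (suc k))) (inv-def k)))
  (fromℚ-mono (ℚₚ.≤-trans (discrepancy-≤-bound (suc k) (ℕₚ.≤-trans (ℕ.s≤s ℕ.z≤n) 2≤ρ))
    (bound-≤ ρ (suc k) 2 1ℚ (ℚₚ.≤-trans (invPowerSum-≤ ρ (suc k) 2≤ρ) 7/4≤2))))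
  where
  Δ : ℝ
  Δ = fromℚ (discrepancy (suc ρ) (suc k))
  C : ℚ
  C = ι (upperConstant (suc ρ) 2)
  7/4≤2 : 7/4 ℚ.≤ ι 2 * 1ℚ
  7/4≤2 = subst (7/4 ℚ.≤_) (sym (trans (ℚₚ.*-identityʳ (ι 2)) (ι-def 2))) (ℚ.*≤* (ℤ.+≤+ (ℕₚ.m≤m+n 7 1)))

theorem4p1 : (∃[ c₂ ] ∃[ C₂ ] 0ℝ <ℝ c₂ × c₂ <ℝ C₂ ×
    (∀ (n : ℕ) .{{_ : NonZero n}} → 2 ≤ n →
    ∃[ Δ ] IsDiscrepancy 2 n Δ × c₂ /ℕ n ≤ℝ Δ × Δ ≤ℝ C₂ *ℝ (ln n /ℕ n)))
    ×
    (∀ (r : ℕ) → 3 ≤ r →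
    ∃[ cᵣ ] ∃[ Cᵣ ] 0ℝ <ℝ cᵣ × cᵣ <ℝ Cᵣ ×
    (∀ (n : ℕ) .{{_ : NonZero n}} →
    ∃[ Δ ] IsDiscrepancy r n Δ × cᵣ /ℕ n ≤ℝ Δ × Δ ≤ℝ Cᵣ /ℕ n))
theorem4p1 =
  ( fromℚ (inv 3 ^ℚ 2) , fromℚ (ι (upperConstant 2 3))
  , 0<lowerConstant 2 , lowerConstant<upperConstant 2 3 (ℕ.s≤s ℕ.z≤n)
  , λ { (suc k) 2≤n → fromℚ (discrepancy 2 (suc k)) , isDiscrepancy 2 (suc k)
                    , lowerConstant-≤ 2 k , ≤-upperConstant-ln k 2≤n } )
  -- The error sum has exponent ρ = r - 1, and r ≥ 3 is what makes it at least 2, hence the sum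
  -- bounded by 7/4.
  , λ { (suc ρ) (ℕ.s≤s 2≤ρ) →
    fromℚ (inv 3 ^ℚ suc ρ) , fromℚ (ι (upperConstant (suc ρ) 2))
    , 0<lowerConstant (suc ρ) , lowerConstant<upperConstant (suc ρ) 2 (ℕ.s≤s ℕ.z≤n)
    , λ { (suc k) → fromℚ (discrepancy (suc ρ) (suc k)) , isDiscrepancy (suc ρ) (suc k)
                  , lowerConstant-≤ (suc ρ) k , ≤-upperConstant ρ k 2≤ρ } }
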